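{- Let $n,m\ge 1$ be integers and let $A=(a_{ij})$ be an $n\times m$ matrix with entries in $\mathbb{R}$. Let $1/4<\alpha<1$, $\beta=4/(4\alpha-1)$, and let $\varepsilon,d,q_{\max}$ be real numbers with $0<\varepsilon<1<d$ and $q_{\max}>1$. Then the ILLL algorithm (as described in the context) with input $A,\varepsilon,d,q_{\max}$ and reduction parameter $\alpha$ finds a sequence of $m$-tuples $(q_1,\dots,q_m)$ of integers such that for every real $Q$ with $$\varepsilon^{ -\frac{n}{m}}\,\beta^{\frac{(m+n-1)(m+n)}{4m}}\le Q\le q_{\max},$$ one of these $m$-tuples satisfies $$\max_{1\le j\le m}|q_j|\le Q$$ and $$\max_{1\le i\le n}\|q_1a_{i1}+\cdots+q_ma_{im}\|\le d\,Q^{ -\frac{m}{n}}\,\beta^{\frac{(m+n-1)(m+n)}{4n}}.$$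
   Context: For real $x$, $\|x\|$ denotes the distance from $x$ to the nearest integer. LLL algorithm. Let $\vec b_1,\dots,\vec b_N$ be a basis of $\mathbb{R}^N$, with Gram-Schmidt vectors $\vec b_i^*=\vec b_i-\sum_{j<i}\mu_{i,j}\vec b_j^*$, where $\mu_{i,j}=\langle \vec b_i,\vec b_j^*\rangle/\langle \vec b_j^*,\vec b_j^*\rangle$. For a reduction parameter $1/4<\alpha<1$, the LLL algorithm applied to a basis of a full-rank lattice $L\subset\mathbb{R}^N$ returns a basis $\vec b_1,\dots,\vec b_N$ of the same lattice $L$ such that $|\mu_{i,j}|\le \frac12$ for $1\le j<i\le N$ and $|\vec b_i^*+\mu_{i,i-1}\vec b_{i-1}^*|^2\ge \alpha|\vec b_{i-1}^*|^2$ for $2\le i\le N$. Throughout, $\beta=4/(4\alpha-1)$. Basis matrix. For a real $n\times m$ matrix $A$ and $c>0$, let $B_{A,c}$ be the $(n+m)\times(n+m)$ block matrix $$B_{A,c}=\begin{pmatrix} I_n & A\\ O & cI_m\end{pmatrix},$$ whose columns form a basis of a lattice in $\mathbb{R}^{n+m}$. For $0<\eta<1$ put $$c(\eta)=\beta^{\frac{(1-m-n)(n+m)}{4m}}\,\eta^{1+\frac nm}.$$ ILLL (iterated LLL) algorithm. Input: a real $n\times m$ matrix $A$, real numbers $\varepsilon,d$ with $0<\varepsilon<1<d$, a reduction parameter $1/4<\alpha<1$, and an upper bound $q_{\max}>1$. In iteration $k=1,2,\dots$: (1) Apply the LLL algorithm with parameter $\alpha$ to the columns of $B_{A,c_k}$,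 where $c_1=c(\varepsilon)$ and $c_{k+1}=c_k\,d^{ -\frac{n+m}{m}}$ (so $c_k=c(\varepsilon d^{1-k})$). (2) Let $\vec b_1$ be the first vector of the returned basis, and write $\vec b_1=B_{A,c_k}\,(p_1,\dots,p_n,q_1,\dots,q_m)^T$ with integers $p_i,q_j$. This yields the $m$-tuple $q(k)=(q_1(k),\dots,q_m(k))=(q_1,\dots,q_m)$. (3) If $\max_{1\le j\le m}|q_j(k)|\le q_{\max}$, go on to iteration $k+1$; otherwise stop. The sequence of $m$-tuples found by the algorithm consists of the $q(k)$ for integers $1\le k\le k'$, where $$k'=\left\lceil \frac mn\log_d(q_{\max})+1+\log_d(\varepsilon)-\frac{(m+n-1)(m+n)}{4n}\log_d(\beta)\right\rceil .$$ -}

module Defs where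

open import Algebra.Bundles using (CommutativeRing; Semiring)
open import Axiom.ExcludedMiddle using (ExcludedMiddle)
open import Data.Fin.Base as Fin using (Fin; Fin′; inject; splitAt; toℕ; _↑ˡ_)
open import Data.Fin.Properties using (_≟_)
open import Data.Integer.Base as ℤ using (ℤ; +_; -[1+_]; 0ℤ; 1ℤ)
open import Data.Nat.Base as ℕ using (ℕ; zero; suc; NonZero)
open import Data.Nat.Properties using (m*n≢0)
open import Data.Product.Base using (∃; ∃-syntax; _×_; _,_)
open import Data.Rational.Unnormalised.Base as ℚ using (ℚᵘ; ↥_; ↧_; ↧ₙ_)
open import Data.Sum.Base using (inj₁; inj₂)
open import Data.Vec.Functional using (Vector; foldr; _++_)
open import Level using (0ℓ)
open import Relation.Binary.Bundles using (TotalOrder)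
open import Relation.Binary.Core using (Rel)
open import Relation.Binary.PropositionalEquality.Core using (_≡_)
open import Relation.Binary.Structures using (IsTotalOrder)
open import Relation.Nullary using (¬_; yes; no)
open import Relation.Unary using (Pred; Satisfiable; _≐_)
import Relation.Binary.Construct.NonStrictToStrict as NonStrictToStrict

-- The classical axioms characterising the real numbers up to isomorphism.
-- The value of 0# ⁻¹ is left unspecified.
record CompleteOrderedField : Set₁ where
  infix  4 _≤_ _<_
  infix  8 _⁻¹
  field
    commutativeRing : CommutativeRing 0ℓ 0ℓ

  open CommutativeRing commutativeRing public

  field
    _≤_          : Rel Carrier 0ℓ
    _⁻¹          : Carrier → Carrier
    isTotalOrder : IsTotalOrder _≈_ _≤_
    0≉1          : ¬ 0# ≈ 1#
    ⁻¹-cong      : ∀ {x y} → x ≈ y → x ⁻¹ ≈ y ⁻¹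
    ⁻¹-inverseʳ  : ∀ {x} → ¬ x ≈ 0# → x * x ⁻¹ ≈ 1#
    +-monoˡ-≤    : ∀ z {x y} → x ≤ y → x + z ≤ y + z
    *-nonNeg     : ∀ {x y} → 0# ≤ x → 0# ≤ y → 0# ≤ x * y

  _<_ : Rel Carrier 0ℓ
  _<_ = NonStrictToStrict._<_ _≈_ _≤_

  IsUpperBound : Pred Carrier 0ℓ → Pred Carrier 0ℓ
  IsUpperBound S u = ∀ x → S x → x ≤ u

  IsSupremum : Pred Carrier 0ℓ → Pred Carrier 0ℓ
  IsSupremum S s = IsUpperBound S s × (∀ u → IsUpperBound S u → s ≤ u)

  field
    complete : ∀ S → Satisfiable S → Satisfiable (IsUpperBound S) →
               Satisfiable (IsSupremum S)

  totalOrder : TotalOrder 0ℓ 0ℓ 0ℓ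
  totalOrder = record { isTotalOrder = isTotalOrder }

-- (1 - m - n)(n + m)/4m and the like; m*n≢0 is not an instance.
infixl 7 _/4·_
_/4·_ : ℤ → (k : ℕ) → .{{NonZero k}} → ℚᵘ
p /4· k = ℚ._/_ p (4 ℕ.* k) {{m*n≢0 4 k}}

firstIndex : ∀ n m → .{{NonZero n}} → Fin (n ℕ.+ m)
firstIndex (suc n) m = Fin.zero

module Reals (em : ExcludedMiddle 0ℓ) (R : CompleteOrderedField) where

  open CompleteOrderedField R public
    using ( _≈_; _≤_; _<_; _+_; _*_; _-_; -_; _⁻¹; 0#; 1#; IsSupremum
          ; commutativeRing; semiring; totalOrder )
    renaming (Carrier to ℝ)
  open import Algebra.Construct.NaturalChoice.Max totalOrder public
    using (_⊔_)
  open import Algebra.Definitions.RawSemiring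
    (Semiring.rawSemiring semiring) public
    using (_^_; sum) renaming (_×_ to _·_)

  -- Some element satisfying P, or the default value if there is none.
  choose : {A : Set} → A → Pred A 0ℓ → A
  choose default P with em {∃ P}
  ... | yes (x , _) = x
  ... | no  _       = default

  fromℤ : ℤ → ℝ
  fromℤ (+ n)    = n · 1#
  fromℤ -[1+ n ] = - (suc n · 1#)

  fromℚ : ℚᵘ → ℝ
  fromℚ r = fromℤ (↥ r) * fromℤ (↧ r) ⁻¹

  infix 10 ∣_∣
  ∣_∣ : ℝ → ℝ
  ∣ x ∣ = x ⊔ (- x)

  -- Only used for non-negative entries, so that starting from 0# is harmless.
  maximum : ∀ {n} → Vector ℝ n → ℝ
  maximum = foldr _⊔_ 0#

  IsCeiling : ℝ → Pred ℤ 0ℓ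
  IsCeiling x z = x ≤ fromℤ z × fromℤ z < x + 1#

  ⌈_⌉ : ℝ → ℤ
  ⌈ x ⌉ = choose 0ℤ (IsCeiling x)

  IsNearestInteger : ℝ → Pred ℤ 0ℓ
  IsNearestInteger x z = ∀ w → ∣ x - fromℤ z ∣ ≤ ∣ x - fromℤ w ∣

  ‖_‖ : ℝ → ℝ
  ‖ x ‖ = ∣ x - fromℤ (choose 0ℤ (IsNearestInteger x)) ∣

  infixr 8 _^ℤ_ _^ℚ_
  _^ℤ_ : ℝ → ℤ → ℝ
  x ^ℤ (+ n)    = x ^ n
  x ^ℤ -[1+ n ] = (x ^ suc n) ⁻¹

  IsRoot : ℕ → ℝ → Pred ℝ 0ℓ
  IsRoot q x y = 0# ≤ y × y ^ q ≈ x

  -- The usual power when x is positive.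
  _^ℚ_ : ℝ → ℚᵘ → ℝ
  x ^ℚ r = choose 0# (IsRoot (↧ₙ r) (x ^ℤ (↥ r)))

  -- The usual logarithm when 1# < b and 0# < x, obtained as
  -- sup { r ∈ ℚ ∣ b ^ r ≤ x }, so that only rational powers are needed.
  log : ℝ → ℝ → ℝ
  log b x = choose 0# (IsSupremum λ y → ∃[ r ] y ≈ fromℚ r × b ^ℚ r ≤ x)

  Matrix : ℕ → ℕ → Set
  Matrix n m = Fin n → Fin m → ℝ

  infix 10 ⟨_,_⟩
  ⟨_,_⟩ : ∀ {N} → Vector ℝ N → Vector ℝ N → ℝ
  ⟨ u , v ⟩ = sum λ i → u i * v i

  ∣_∣² : ∀ {N} → Vector ℝ N → ℝ
  ∣ v ∣² = ⟨ v , v ⟩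

  LinearlyIndependent : ∀ {N k} → Vector (Vector ℝ N) k → Set
  LinearlyIndependent {k = k} b =
    ∀ (x : Vector ℝ k) → (∀ i → sum (λ j → x j * b j i) ≈ 0#) → ∀ j → x j ≈ 0#

  Lattice : ∀ {N k} → Vector (Vector ℝ N) k → Pred (Vector ℝ N) 0ℓ
  Lattice {k = k} b v =
    ∃ λ (z : Vector ℤ k) → ∀ i → v i ≈ sum λ j → fromℤ (z j) * b j i

  IsBasisOf : ∀ {N} → Vector (Vector ℝ N) N → Pred (Vector ℝ N) 0ℓ → Set
  IsBasisOf b L = LinearlyIndependent b × Lattice b ≐ L

  -- The recursion determines b* uniquely when b is linearly independent.
  record GramSchmidt {N} (b : Vector (Vector ℝ N) N) : Set where
    field
      b* : Vector (Vector ℝ N) N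

    μ : Fin N → Fin N → ℝ
    μ i j = ⟨ b i , b* j ⟩ * ⟨ b* j , b* j ⟩ ⁻¹

    field
      b*-recursion : ∀ i c →
        b* i c ≈ b i c - sum {toℕ i} (λ j → μ i (inject j) * b* (inject j) c)

  record IsReduced (α : ℝ) {N} (b : Vector (Vector ℝ N) N) : Set where
    field
      gramSchmidt : GramSchmidt b

    open GramSchmidt gramSchmidt public

    field
      size   : ∀ i j → j Fin.< i → ∣ μ i j ∣ ≤ fromℚ ℚ.½
      lovász : ∀ i j → toℕ i ≡ suc (toℕ j) →
               α * ∣ b* j ∣² ≤ ∣ (λ c → b* i c + μ i j * b* j c) ∣²

  -- Any procedure with the input-output behaviour of the LLL algorithm.
  record LLLAlgorithm (α : ℝ) (N : ℕ) : Set where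
    field
      reduce    : Vector (Vector ℝ N) N → Vector (Vector ℝ N) N
      isBasis   : ∀ b → LinearlyIndependent b → IsBasisOf (reduce b) (Lattice b)
      isReduced : ∀ b → LinearlyIndependent b → IsReduced α (reduce b)

  β[_] : ℝ → ℝ
  β[ α ] = fromℤ (+ 4) * (fromℤ (+ 4) * α - 1#) ⁻¹

  δ : ∀ {k} → Matrix k k
  δ i j with i ≟ j
  ... | yes _ = 1#
  ... | no  _ = 0#

  basisMatrix : ∀ {n m} → Matrix n m → ℝ → Matrix (n ℕ.+ m) (n ℕ.+ m)
  basisMatrix {n} A c r s with splitAt n r | splitAt n s
  ... | inj₁ i | inj₁ j = δ i j
  ... | inj₁ i | inj₂ j = A i j
  ... | inj₂ i | inj₁ j = 0#
  ... | inj₂ i | inj₂ j = c * δ i j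

  columns : ∀ {k l} → Matrix k l → Vector (Vector ℝ k) l
  columns B j i = B i j

  module ILLL {n m : ℕ} .{{_ : NonZero n}} .{{_ : NonZero m}}
              (A : Matrix n m) (α ε d qmax : ℝ)
              (lll : LLLAlgorithm α (n ℕ.+ m)) where

    open LLLAlgorithm lll using (reduce)

    c[_] : ℝ → ℝ
    c[ η ] =
      β[ α ] ^ℚ ((1ℤ ℤ.- + m ℤ.- + n) ℤ.* (+ n ℤ.+ + m) /4· m)
        * η ^ℚ (ℚ.1ℚᵘ ℚ.+ + n ℚ./ m)

    -- Iterations are counted from zero: index k below is the (k+1)-st
    -- iteration.
    c : ℕ → ℝ
    c zero    = c[ ε ]
    c (suc k) = c k * d ^ℚ (ℚ.- (+ (n ℕ.+ m) ℚ./ m))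

    Yields : ℕ → Vector ℤ m → Set
    Yields k q = ∃[ p ] ∀ i →
      reduce (columns (basisMatrix A (c k))) (firstIndex n m) i
        ≈ sum (λ s → basisMatrix A (c k) i s * fromℤ ((p ++ q) s))

    data Executed : ℕ → Set where
      start    : Executed zero
      continue : ∀ {k q} → Executed k → Yields k q →
                 maximum (λ j → ∣ fromℤ (q j) ∣) ≤ qmax → Executed (suc k)

    k′ : ℤ
    k′ = ⌈ fromℚ (+ m ℚ./ n) * log d qmax + 1# + log d ε
           - fromℚ ((+ m ℤ.+ + n ℤ.- 1ℤ) ℤ.* (+ m ℤ.+ + n) /4· n)
               * log d β[ α ] ⌉

    Found : Vector ℤ m → Set
    Found q = ∃[ k ] Executed k × + suc k ℤ.≤ k′ × Yields k q

{-# OPTIONS --safe #-}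
module Submission where

-- The lattice spanned by the columns of B_{A,c} has determinant c^m. Along a
-- reduced basis |b*_j|² ≤ β |b*_{j+1}|², so |b_1|^{2N} ≤ β^{N(N-1)/2} ∏ |b*_i|²
-- with N = n + m, and the product is at most det² because the columns are
-- integral combinations of the reduced basis. For c = c_k this gives
-- |b_1| ≤ η_k = ε d^{-k}: the first n coordinates of b_1 bound the distances to
-- the integers and the last m bound c_k |q_j|. Put T = Q^{-m/n} β^{N(N-1)/4n}.
-- As long as T ≤ η_k the second bound amounts to |q_j| ≤ Q, and at the last
-- such k also η_k ≤ d T. The hypothesis on Q says T ≤ ε = η_0, and taking
-- logarithms of T d^k ≤ ε shows that this k is within the limit k′.
-- Determinants are top coefficients of wedge products, and rational powers
-- enter only through the identities (x^{p/q})^q = x^p.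

open import Defs
open import Algebra.Bundles using (CommutativeMonoid; CommutativeRing)
open import Axiom.ExcludedMiddle using (ExcludedMiddle)
open import Data.Empty using (⊥)
open import Data.Fin.Base as Fin using (Fin; toℕ; inject; fromℕ<; _↑ˡ_; _↑ʳ_)
open import Data.Fin.Subset.Properties using (∣p∣≡n⇒p≡⊤)
open import Data.Integer.Base as ℤ using (ℤ; +_; -[1+_]; 0ℤ; 1ℤ; _⊖_)
open import Data.Integer.Tactic.RingSolver using (solve-∀)
open import Data.Maybe.Base using (Maybe; just; nothing)
open import Data.Nat.Base as ℕ using (ℕ; zero; suc; NonZero)
open import Data.Nat.Tactic.RingSolver using () renaming (solve-∀ to ℕ-solve-∀)
open import Data.Product.Base using (∃; ∃-syntax; _×_; _,_; proj₁; proj₂)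
open import Data.Rational.Unnormalised.Base as ℚ using (_/_; ↥_; ↧_; ↧ₙ_)
open import Data.Sum.Base using (_⊎_; inj₁; inj₂; [_,_]′)
open import Data.Vec.Base as Vec using ([]; _∷_)
open import Data.Vec.Functional using (Vector; head; tail; _++_)
open import Function.Base using (_∘_; flip; id)
open import Level using (0ℓ)
open import Relation.Binary.Bundles using (TotalOrder)
open import Relation.Binary.Definitions using (Tri; tri<; tri≈; tri>)
open import Relation.Binary.PropositionalEquality.Core as ≡ using (_≡_; _≢_)
open import Relation.Nullary using (¬_; Dec; yes; no; contradiction)
open import Relation.Unary using (Pred)
import Algebra.Construct.NaturalChoice.Max as Max
import Algebra.Properties.AbelianGroup as AbelianGroupProperties
import Algebra.Properties.CommutativeMonoid.Sum as CommutativeMonoidSum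
import Algebra.Properties.CommutativeSemiring.Exp as Exp
import Algebra.Properties.Ring as RingProperties
import Algebra.Properties.Semiring.Mult as SemiringMult
import Algebra.Properties.Semiring.Sum as SemiringSum
import Algebra.Solver.Ring
import Algebra.Solver.Ring.AlmostCommutativeRing as ACR
import Data.Fin.Properties as Fin
import Data.Fin.Subset as Subset
import Data.Integer.Properties as ℤ
import Data.Nat.Properties as ℕ
import Relation.Binary.Construct.NonStrictToStrict as NonStrictToStrict
import Relation.Binary.Reasoning.PartialOrder
import Relation.Binary.Reasoning.Setoid

-- Squaring the bound on |b_1|^{2N} gives |b_1|^{4N} ≤ β^{N(N-1)} c^{4m}, and c(η) is normalised so
-- that for c = c(η) the right side is exactly η^{4N}. The exponents of the statement have
-- denominators 4m and 4n, so comparisons are made between 4m-th or 4n-th powers, where only integer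
-- exponents remain, and are then undone by monotonicity of powers. The two sides of the argument
-- meet in T^{4n} Q^{4m} = β^{N(N-1)} and c_k^{4m} β^{N(N-1)} = η_k^{4N}: at T = η_k they give η_k /
-- c_k = Q, which is why the bound on |q_j| comes out as Q. The squared determinant occurs as
-- `det B * det (flip B)`. For the orthogonal family this is the determinant of the Gram matrix, and
-- for an integral change of basis it is a product of two integers. Multiplicativity of `det` comes
-- from applying a homomorphism of exterior algebras to a form of top degree. Ceilings, nearest
-- integers, roots and logarithms are all picked by `choose`, so each needs an existence proof;
-- completeness and excluded middle supply these.

module SumSplitting (M : CommutativeMonoid 0ℓ 0ℓ) where

  open CommutativeMonoid M
  open CommutativeMonoidSum M using (sum)

  -- Stated for a commutative monoid so that it splits sums as well as products, such as the product
  -- of a diagonal, at a block boundary.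
  sum-↑ : ∀ n {m} (f : Vector Carrier (n ℕ.+ m)) →
          sum f ≈ sum (λ i → f (i ↑ˡ m)) ∙ sum (λ j → f (n ↑ʳ j))
  sum-↑ zero    f = sym (identityˡ _)
  sum-↑ (suc n) f = trans (∙-congˡ (sum-↑ n (f ∘ Fin.suc))) (sym (assoc _ _ _))

-- Integers in a commutative ring, and a ring solver with integer coefficients

module IntegerMultiples (CR : CommutativeRing 0ℓ 0ℓ) where

  open CommutativeRing CR
  open AbelianGroupProperties +-abelianGroup using (⁻¹-∙-comm; ε⁻¹≈ε; ⁻¹-involutive)
  open RingProperties ring using (-‿distribˡ-*; -‿distribʳ-*)
  open SemiringMult semiring using (×-homo-+; ×1-homo-*) renaming (_×_ to _·_)
  open Relation.Binary.Reasoning.Setoid setoid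

  -- Same clauses as `fromℤ`, over any commutative ring: it is the coefficient map of the ring
  -- solver, and `fromℤ≡⟦⟧` later transfers its homomorphism laws to `fromℤ`.
  ⟦_⟧ : ℤ → Carrier
  ⟦ + n ⟧      = n · 1#
  ⟦ -[1+ n ] ⟧ = - (suc n · 1#)

  ⟦⟧-⊖ : ∀ a b → ⟦ a ⊖ b ⟧ ≈ a · 1# - b · 1#
  ⟦⟧-⊖ zero    zero    = sym (-‿inverseʳ 0#)
  ⟦⟧-⊖ zero    (suc b) = sym (+-identityˡ _)
  ⟦⟧-⊖ (suc a) zero    = sym (trans (+-congˡ ε⁻¹≈ε) (+-identityʳ _))
  ⟦⟧-⊖ (suc a) (suc b) = begin
    ⟦ suc a ⊖ suc b ⟧                    ≡⟨ ≡.cong ⟦_⟧ (ℤ.[1+m]⊖[1+n]≡m⊖n a b) ⟩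
    ⟦ a ⊖ b ⟧                            ≈⟨ ⟦⟧-⊖ a b ⟩
    a · 1# - b · 1#                      ≈⟨ +-congʳ (+-identityˡ _) ⟨
    0# + a · 1# - b · 1#                 ≈⟨ +-congʳ (+-congʳ (-‿inverseʳ 1#)) ⟨
    1# - 1# + a · 1# - b · 1#            ≈⟨ +-congʳ (trans (+-assoc _ _ _) (+-congˡ (+-comm _ _))) ⟩
    1# + (a · 1# - 1#) - b · 1#          ≈⟨ +-congʳ (+-assoc _ _ _) ⟨
    1# + a · 1# - 1# - b · 1#            ≈⟨ +-assoc _ _ _ ⟩
    1# + a · 1# + (- 1# - b · 1#)        ≈⟨ +-congˡ (⁻¹-∙-comm _ _) ⟩
    suc a · 1# - suc b · 1#              ∎

  ⟦⟧-neg : ∀ i → ⟦ ℤ.- i ⟧ ≈ - ⟦ i ⟧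
  ⟦⟧-neg (+ zero)  = sym ε⁻¹≈ε
  ⟦⟧-neg (+ suc n) = refl
  ⟦⟧-neg -[1+ n ]  = sym (⁻¹-involutive _)

  ⟦⟧-+ : ∀ i j → ⟦ i ℤ.+ j ⟧ ≈ ⟦ i ⟧ + ⟦ j ⟧
  ⟦⟧-+ (+ a)    (+ b)    = ×-homo-+ 1# a b
  ⟦⟧-+ (+ a)    -[1+ b ] = ⟦⟧-⊖ a (suc b)
  ⟦⟧-+ -[1+ a ] (+ b)    = trans (⟦⟧-⊖ b (suc a)) (+-comm _ _)
  ⟦⟧-+ -[1+ a ] -[1+ b ] = begin
    - (suc (suc (a ℕ.+ b)) · 1#)         ≡⟨ ≡.cong (λ k → - (suc k · 1#)) (≡.sym (ℕ.+-suc a b)) ⟩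
    - ((suc a ℕ.+ suc b) · 1#)           ≈⟨ -‿cong (×-homo-+ 1# (suc a) (suc b)) ⟩
    - (suc a · 1# + suc b · 1#)          ≈⟨ ⁻¹-∙-comm _ _ ⟨
    - (suc a · 1#) - suc b · 1#          ∎

  ⟦⟧-* : ∀ i j → ⟦ i ℤ.* j ⟧ ≈ ⟦ i ⟧ * ⟦ j ⟧
  ⟦⟧-* (+ a) (+ b) = begin
    ⟦ + a ℤ.* + b ⟧          ≡⟨ ≡.cong ⟦_⟧ (≡.sym (ℤ.pos-* a b)) ⟩
    (a ℕ.* b) · 1#           ≈⟨ ×1-homo-* a b ⟩
    (a · 1#) * (b · 1#)      ∎
  ⟦⟧-* (+ a) -[1+ b ] = begin
    ⟦ + a ℤ.* -[1+ b ] ⟧     ≡⟨ ≡.cong ⟦_⟧ (≡.sym (ℤ.neg-distribʳ-* (+ a) (+ suc b))) ⟩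
    ⟦ ℤ.- (+ a ℤ.* + suc b) ⟧ ≈⟨ ⟦⟧-neg (+ a ℤ.* + suc b) ⟩
    - ⟦ + a ℤ.* + suc b ⟧    ≈⟨ -‿cong (⟦⟧-* (+ a) (+ suc b)) ⟩
    - (⟦ + a ⟧ * ⟦ + suc b ⟧) ≈⟨ -‿distribʳ-* _ _ ⟩
    ⟦ + a ⟧ * ⟦ -[1+ b ] ⟧   ∎
  ⟦⟧-* -[1+ a ] (+ b) = begin
    ⟦ -[1+ a ] ℤ.* + b ⟧     ≡⟨ ≡.cong ⟦_⟧ (≡.sym (ℤ.neg-distribˡ-* (+ suc a) (+ b))) ⟩
    ⟦ ℤ.- (+ suc a ℤ.* + b) ⟧ ≈⟨ ⟦⟧-neg (+ suc a ℤ.* + b) ⟩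
    - ⟦ + suc a ℤ.* + b ⟧    ≈⟨ -‿cong (⟦⟧-* (+ suc a) (+ b)) ⟩
    - (⟦ + suc a ⟧ * ⟦ + b ⟧) ≈⟨ -‿distribˡ-* _ _ ⟩
    ⟦ -[1+ a ] ⟧ * ⟦ + b ⟧   ∎
  ⟦⟧-* -[1+ a ] -[1+ b ] = begin
    (suc a ℕ.* suc b) · 1#   ≈⟨ ×1-homo-* (suc a) (suc b) ⟩
    x * y                    ≈⟨ ⁻¹-involutive _ ⟨
    - - (x * y)              ≈⟨ -‿cong (-‿distribˡ-* x y) ⟩
    - (- x * y)              ≈⟨ -‿distribʳ-* (- x) y ⟩
    - x * - y                ∎
    where
    x y : Carrier
    x = suc a · 1#
    y = suc b · 1#

  private
    almostCR : ACR.AlmostCommutativeRing 0ℓ 0ℓ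
    almostCR = ACR.fromCommutativeRing CR

    morphism : ℤ.+-*-rawRing ACR.-Raw-AlmostCommutative⟶ almostCR
    morphism = record
      { ⟦_⟧    = ⟦_⟧
      ; +-homo = ⟦⟧-+
      ; *-homo = ⟦⟧-*
      ; -‿homo = ⟦⟧-neg
      ; 0-homo = refl
      ; 1-homo = +-identityʳ 1#
      }

    coeff≟ : ∀ i j → Maybe (⟦ i ⟧ ≈ ⟦ j ⟧)
    coeff≟ i j with i ℤ.≟ j
    ... | yes i≡j = just (reflexive (≡.cong ⟦_⟧ i≡j))
    ... | no  _   = nothing

  module Solver = Algebra.Solver.Ring ℤ.+-*-rawRing almostCR morphism coeff≟

-- Exterior algebra and determinants

module Determinant (CR : CommutativeRing 0ℓ 0ℓ) where

  open CommutativeRing CR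
  open Subset using (Subset; inside; outside; ⊤; ∣_∣)
  open IntegerMultiples CR using (module Solver)
  open Solver using (solve; _:+_; _:*_; _:-_; :-_; _:=_; con)
  open AbelianGroupProperties +-abelianGroup using (ε⁻¹≈ε)
  open SemiringSum semiring using (sum)
  open CommutativeMonoidSum *-commutativeMonoid public using () renaming (sum to product)
  open Relation.Binary.Reasoning.Setoid setoid

  -- An element of the exterior algebra on N generators, given by its
  -- coefficients on the monomials, which are indexed by subsets.
  Form : ℕ → Set
  Form N = Subset N → Carrier

  infix 4 _≋_
  _≋_ : ∀ {N} → Form N → Form N → Set
  x ≋ y = ∀ S → x S ≈ y S

  infixr 7 _∧_
  -- Left multiplication by a form of degree one. The monomials have their generators in increasing
  -- order, and the minus sign comes from moving `tail v` past the first generator.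
  _∧_ : ∀ {N} → Vector Carrier N → Form N → Form N
  (v ∧ x) []            = 0#
  (v ∧ x) (outside ∷ S) = (tail v ∧ λ T → x (outside ∷ T)) S
  (v ∧ x) (inside ∷ S)  = head v * x (outside ∷ S) - (tail v ∧ λ T → x (inside ∷ T)) S

  unit : ∀ {N} → Form N
  unit []            = 1#
  unit (outside ∷ S) = unit S
  unit (inside ∷ S)  = 0#

  ⋀ : ∀ {N k} → Vector (Vector Carrier N) k → Form N
  ⋀ {k = zero}  X = unit
  ⋀ {k = suc k} X = head X ∧ ⋀ (tail X)

  det : ∀ {N} → Vector (Vector Carrier N) N → Carrier
  det X = ⋀ X ⊤

  ∧-cong : ∀ {N} {v w : Vector Carrier N} {x y : Form N} →
           (∀ i → v i ≈ w i) → x ≋ y → v ∧ x ≋ w ∧ y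
  ∧-cong v≈w x≋y []            = refl
  ∧-cong v≈w x≋y (outside ∷ S) = ∧-cong (v≈w ∘ Fin.suc) (x≋y ∘ (outside ∷_)) S
  ∧-cong v≈w x≋y (inside ∷ S)  = +-cong (*-cong (v≈w Fin.zero) (x≋y (outside ∷ S)))
    (-‿cong (∧-cong (v≈w ∘ Fin.suc) (x≋y ∘ (inside ∷_)) S))

  ∧-congˡ : ∀ {N} (v : Vector Carrier N) {x y : Form N} → x ≋ y → v ∧ x ≋ v ∧ y
  ∧-congˡ v = ∧-cong {v = v} (λ _ → refl)

  ∧-distribˡ : ∀ {N} (v : Vector Carrier N) (x y : Form N) →
               v ∧ (λ S → x S + y S) ≋ λ S → (v ∧ x) S + (v ∧ y) S
  ∧-distribˡ v x y []            = sym (+-identityʳ 0#)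
  ∧-distribˡ v x y (outside ∷ S) = ∧-distribˡ (tail v) (x ∘ (outside ∷_)) (y ∘ (outside ∷_)) S
  ∧-distribˡ v x y (inside ∷ S)  = trans
    (+-congˡ (-‿cong (∧-distribˡ (tail v) (x ∘ (inside ∷_)) (y ∘ (inside ∷_)) S)))
    (solve 5 (λ a b c d e → a :* (b :+ c) :- (d :+ e) := a :* b :- d :+ (a :* c :- e))
      refl (head v) (x (outside ∷ S)) (y (outside ∷ S)) _ _)

  ∧-scaleʳ : ∀ {N} (v : Vector Carrier N) a (x : Form N) →
             v ∧ (λ S → a * x S) ≋ λ S → a * (v ∧ x) S
  ∧-scaleʳ v a x []            = sym (zeroʳ a)
  ∧-scaleʳ v a x (outside ∷ S) = ∧-scaleʳ (tail v) a (x ∘ (outside ∷_)) S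
  ∧-scaleʳ v a x (inside ∷ S)  = trans
    (+-congˡ (-‿cong (∧-scaleʳ (tail v) a (x ∘ (inside ∷_)) S)))
    (solve 4 (λ a b c d → b :* (a :* c) :- a :* d := a :* (b :* c :- d))
      refl a (head v) (x (outside ∷ S)) _)

  ∧-distribʳ : ∀ {N} (v w : Vector Carrier N) (x : Form N) →
               (λ i → v i + w i) ∧ x ≋ λ S → (v ∧ x) S + (w ∧ x) S
  ∧-distribʳ v w x []            = sym (+-identityʳ 0#)
  ∧-distribʳ v w x (outside ∷ S) = ∧-distribʳ (tail v) (tail w) (x ∘ (outside ∷_)) S
  ∧-distribʳ v w x (inside ∷ S)  = trans
    (+-congˡ (-‿cong (∧-distribʳ (tail v) (tail w) (x ∘ (inside ∷_)) S)))
    (solve 5 (λ a b c d e → (a :+ b) :* c :- (d :+ e) := a :* c :- d :+ (b :* c :- e))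
      refl (head v) (head w) (x (outside ∷ S)) _ _)

  ∧-scaleˡ : ∀ {N} (v : Vector Carrier N) a (x : Form N) →
             (λ i → a * v i) ∧ x ≋ λ S → a * (v ∧ x) S
  ∧-scaleˡ v a x []            = sym (zeroʳ a)
  ∧-scaleˡ v a x (outside ∷ S) = ∧-scaleˡ (tail v) a (x ∘ (outside ∷_)) S
  ∧-scaleˡ v a x (inside ∷ S)  = trans
    (+-congˡ (-‿cong (∧-scaleˡ (tail v) a (x ∘ (inside ∷_)) S)))
    (solve 4 (λ a b c d → a :* b :* c :- a :* d := a :* (b :* c :- d))
      refl a (head v) (x (outside ∷ S)) _)

  ∧-zeroˡ : ∀ {N} {v : Vector Carrier N} (x : Form N) →
            (∀ i → v i ≈ 0#) → v ∧ x ≋ λ _ → 0#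
  ∧-zeroˡ {v = v} x v≈0 S = begin
    (v ∧ x) S                    ≈⟨ ∧-cong (λ i → trans (v≈0 i) (sym (zeroˡ (v i)))) (λ _ → refl) S ⟩
    ((λ i → 0# * v i) ∧ x) S     ≈⟨ ∧-scaleˡ v 0# x S ⟩
    0# * (v ∧ x) S               ≈⟨ zeroˡ _ ⟩
    0#                           ∎

  ∧-zeroʳ : ∀ {N} (v : Vector Carrier N) {x : Form N} →
            (x ≋ λ _ → 0#) → v ∧ x ≋ λ _ → 0#
  ∧-zeroʳ v {x} x≋0 S = begin
    (v ∧ x) S                    ≈⟨ ∧-congˡ v (λ T → trans (x≋0 T) (sym (zeroˡ (x T)))) S ⟩
    (v ∧ λ T → 0# * x T) S       ≈⟨ ∧-scaleʳ v 0# x S ⟩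
    0# * (v ∧ x) S               ≈⟨ zeroˡ _ ⟩
    0#                           ∎

  ∧-linear : ∀ {N} (v : Vector Carrier N) a (x y : Form N) →
             v ∧ (λ S → a * x S - y S) ≋ λ S → a * (v ∧ x) S - (v ∧ y) S
  ∧-linear v a x y S = begin
    (v ∧ λ T → a * x T - y T) S
      ≈⟨ ∧-congˡ v (λ T → solve 2 (λ p q → p :- q := p :+ con ℤ.-1ℤ :* q) refl (a * x T) (y T)) S ⟩
    (v ∧ λ T → a * x T + m * y T) S
      ≈⟨ ∧-distribˡ v (λ T → a * x T) (λ T → m * y T) S ⟩
    (v ∧ λ T → a * x T) S + (v ∧ λ T → m * y T) S
      ≈⟨ +-cong (∧-scaleʳ v a x S) (∧-scaleʳ v m y S) ⟩
    a * (v ∧ x) S + m * (v ∧ y) S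
      ≈⟨ solve 2 (λ p q → p :+ con ℤ.-1ℤ :* q := p :- q) refl (a * (v ∧ x) S) ((v ∧ y) S) ⟩
    a * (v ∧ x) S - (v ∧ y) S ∎
    where
    -- This is the value of the solver constant `con ℤ.-1ℤ`, so the terms match those of the solver
    -- by computation.
    m : Carrier
    m = - (1# + 0#)

  -- The two terms that involve the head of only one vector trade places, and the term that involves
  -- neither head is the induction hypothesis.
  ∧-anticomm : ∀ {N} (v w : Vector Carrier N) (x : Form N) →
               v ∧ w ∧ x ≋ λ S → - (w ∧ v ∧ x) S
  ∧-anticomm v w x []            = sym ε⁻¹≈ε
  ∧-anticomm v w x (outside ∷ S) = ∧-anticomm (tail v) (tail w) (x ∘ (outside ∷_)) S
  ∧-anticomm v w x (inside ∷ S)  = begin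
    v₀ * w∧o - (v′ ∧ λ T → w₀ * x (outside ∷ T) - (w′ ∧ xᵢ) T) S
      ≈⟨ +-congˡ (-‿cong (trans (∧-linear v′ w₀ xₒ (w′ ∧ xᵢ) S) (+-congˡ (-‿cong (∧-anticomm v′ w′ xᵢ S))))) ⟩
    v₀ * w∧o - (w₀ * v∧o - - w∧v∧i)
      ≈⟨ solve 5 (λ a b c d e → a :* b :- (c :* d :- :- e) := :- (c :* d :- (a :* b :- e)))
           refl v₀ w∧o w₀ v∧o w∧v∧i ⟩
    - (w₀ * v∧o - (v₀ * w∧o - w∧v∧i))
      ≈⟨ -‿cong (+-congˡ (-‿cong (∧-linear w′ v₀ xₒ (v′ ∧ xᵢ) S))) ⟨
    - (w₀ * v∧o - (w′ ∧ λ T → v₀ * x (outside ∷ T) - (v′ ∧ xᵢ) T) S) ∎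
    where
    v′ = tail v
    w′ = tail w
    v₀ = head v
    w₀ = head w
    xₒ = λ T → x (outside ∷ T)
    xᵢ = λ T → x (inside ∷ T)
    w∧o = (w′ ∧ xₒ) S
    v∧o = (v′ ∧ xₒ) S
    w∧v∧i = (w′ ∧ v′ ∧ xᵢ) S

  -- In a general commutative ring anticommutativity yields only twice this identity, hence the
  -- separate induction.
  ∧-alternating : ∀ {N} (v : Vector Carrier N) (x : Form N) → v ∧ v ∧ x ≋ λ _ → 0#
  ∧-alternating v x []            = refl
  ∧-alternating v x (outside ∷ S) = ∧-alternating (tail v) (x ∘ (outside ∷_)) S
  ∧-alternating v x (inside ∷ S)  = begin
    v₀ * v∧o - (v′ ∧ λ T → v₀ * x (outside ∷ T) - (v′ ∧ xᵢ) T) S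
      ≈⟨ +-congˡ (-‿cong (trans (∧-linear v′ v₀ xₒ (v′ ∧ xᵢ) S) (+-congˡ (-‿cong (∧-alternating v′ xᵢ S))))) ⟩
    v₀ * v∧o - (v₀ * v∧o - 0#)
      ≈⟨ solve 1 (λ a → a :- (a :- con 0ℤ) := con 0ℤ) refl (v₀ * v∧o) ⟩
    0# ∎
    where
    v′ = tail v
    v₀ = head v
    xₒ = λ T → x (outside ∷ T)
    xᵢ = λ T → x (inside ∷ T)
    v∧o = (v′ ∧ xₒ) S

  infixl 7 _⊗_
  _⊗_ : ∀ {l m n} → (Fin l → Fin m → Carrier) → (Fin m → Fin n → Carrier) →
        Fin l → Fin n → Carrier
  (X ⊗ Y) i j = sum λ k → X i k * Y k j

  -- The algebra homomorphism sending the generators to the rows of Y.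
  substitute : ∀ {k N} → Vector (Vector Carrier N) k → Form k → Form N
  substitute {zero}  Y x S = x [] * unit S
  substitute {suc k} Y x S =
    substitute (tail Y) (x ∘ (outside ∷_)) S + (head Y ∧ substitute (tail Y) (x ∘ (inside ∷_))) S

  substitute-cong : ∀ {k N} (Y : Vector (Vector Carrier N) k) {x y : Form k} →
                    x ≋ y → substitute Y x ≋ substitute Y y
  substitute-cong {zero}  Y x≋y S = *-congʳ (x≋y [])
  substitute-cong {suc k} Y x≋y S = +-cong
    (substitute-cong (tail Y) (x≋y ∘ (outside ∷_)) S)
    (∧-congˡ (head Y) (substitute-cong (tail Y) (x≋y ∘ (inside ∷_))) S)

  substitute-linear : ∀ {k N} (Y : Vector (Vector Carrier N) k) a (x y : Form k) →
    substitute Y (λ S → a * x S - y S) ≋ λ S → a * substitute Y x S - substitute Y y S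
  substitute-linear {zero} Y a x y S =
    solve 4 (λ a b c d → (a :* b :- c) :* d := a :* (b :* d) :- c :* d) refl a (x []) (y []) (unit S)
  substitute-linear {suc k} Y a x y S = trans
    (+-cong (substitute-linear Y′ a (x ∘ (outside ∷_)) (y ∘ (outside ∷_)) S)
      (trans (∧-congˡ (head Y) (substitute-linear Y′ a (x ∘ (inside ∷_)) (y ∘ (inside ∷_))) S)
             (∧-linear (head Y) a (substitute Y′ (x ∘ (inside ∷_))) (substitute Y′ (y ∘ (inside ∷_))) S)))
    (solve 5 (λ a b c d e → a :* b :- c :+ (a :* d :- e) := a :* (b :+ d) :- (c :+ e)) refl a _ _ _ _)
    where Y′ = tail Y

  substitute-zero : ∀ {k N} (Y : Vector (Vector Carrier N) k) {x : Form k} →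
                    (x ≋ λ _ → 0#) → substitute Y x ≋ λ _ → 0#
  substitute-zero {zero}  Y x≋0 S = trans (*-congʳ (x≋0 [])) (zeroˡ _)
  substitute-zero {suc k} Y x≋0 S = trans
    (+-cong (substitute-zero (tail Y) (x≋0 ∘ (outside ∷_)) S)
            (∧-zeroʳ (head Y) (substitute-zero (tail Y) (x≋0 ∘ (inside ∷_))) S))
    (+-identityʳ 0#)

  -- Multiplicativity for a factor of degree one. The part of `x` containing the first generator
  -- goes to `Y₀ ∧ î`; moving `w` past `Y₀` there accounts for the sign in `_∧_`, and the term
  -- `v₀ * (Y₀ ∧ Y₀ ∧ î) S` is zero, so it can be added to complete `Y₀ ∧ substitute Y x`.
  substitute-∧ : ∀ {k N} (Y : Vector (Vector Carrier N) k) (v : Vector Carrier k) (x : Form k) →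
                 substitute Y (v ∧ x) ≋ (λ c → sum λ j → v j * Y j c) ∧ substitute Y x
  substitute-∧ {zero}  Y v x S = trans (zeroˡ _) (sym (∧-zeroˡ _ (λ _ → refl) S))
  substitute-∧ {suc k} Y v x S = begin
    substitute Y′ (v′ ∧ xₒ) S
      + (Y₀ ∧ substitute Y′ (λ T → v₀ * x (outside ∷ T) - (v′ ∧ xᵢ) T)) S
      ≈⟨ +-cong (substitute-∧ Y′ v′ xₒ S)
           (∧-congˡ Y₀ (λ T → trans (substitute-linear Y′ v₀ xₒ (v′ ∧ xᵢ) T)
                                    (+-congˡ (-‿cong (substitute-∧ Y′ v′ xᵢ T)))) S) ⟩
    (w ∧ ô) S + (Y₀ ∧ λ T → v₀ * ô T - (w ∧ î) T) S
      ≈⟨ +-congˡ (trans (∧-linear Y₀ v₀ ô (w ∧ î) S) (+-congˡ (-‿cong (∧-anticomm Y₀ w î S)))) ⟩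
    (w ∧ ô) S + (v₀ * (Y₀ ∧ ô) S - - (w ∧ Y₀ ∧ î) S)
      ≈⟨ solve 4 (λ a b c d → a :+ (b :* c :- :- d) := b :* (c :+ con 0ℤ) :+ (a :+ d))
           refl ((w ∧ ô) S) v₀ ((Y₀ ∧ ô) S) ((w ∧ Y₀ ∧ î) S) ⟩
    v₀ * ((Y₀ ∧ ô) S + 0#) + ((w ∧ ô) S + (w ∧ Y₀ ∧ î) S)
      ≈⟨ +-cong (*-congˡ (+-congˡ (∧-alternating Y₀ î S))) (∧-distribˡ w ô (Y₀ ∧ î) S) ⟨
    v₀ * ((Y₀ ∧ ô) S + (Y₀ ∧ Y₀ ∧ î) S) + (w ∧ substitute Y x) S
      ≈⟨ +-congʳ (*-congˡ (∧-distribˡ Y₀ ô (Y₀ ∧ î) S)) ⟨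
    v₀ * (Y₀ ∧ substitute Y x) S + (w ∧ substitute Y x) S
      ≈⟨ +-congʳ (∧-scaleˡ Y₀ v₀ (substitute Y x) S) ⟨
    ((λ c → v₀ * Y₀ c) ∧ substitute Y x) S + (w ∧ substitute Y x) S
      ≈⟨ ∧-distribʳ (λ c → v₀ * Y₀ c) w (substitute Y x) S ⟨
    ((λ c → sum λ j → v j * Y j c) ∧ substitute Y x) S ∎
    where
    v′ = tail v
    v₀ = head v
    Y′ = tail Y
    Y₀ = head Y
    xₒ = λ T → x (outside ∷ T)
    xᵢ = λ T → x (inside ∷ T)
    ô = substitute Y′ xₒ
    î = substitute Y′ xᵢ
    w = λ c → sum λ j → v′ j * Y′ j c

  substitute-unit : ∀ {k N} (Y : Vector (Vector Carrier N) k) → substitute Y unit ≋ unit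
  substitute-unit {zero}  Y S = *-identityˡ _
  substitute-unit {suc k} Y S = trans
    (+-cong (substitute-unit (tail Y) S)
            (∧-zeroʳ (head Y) (substitute-zero (tail Y) (λ _ → refl)) S))
    (+-identityʳ _)

  -- A row of `X ⊗ Y` is the image of the corresponding row of `X` under the homomorphism, so the
  -- product of the rows is the image of the product.
  ⋀-⊗ : ∀ {l k N} (X : Vector (Vector Carrier k) l) (Y : Vector (Vector Carrier N) k) →
        ⋀ (X ⊗ Y) ≋ substitute Y (⋀ X)
  ⋀-⊗ {zero}  X Y S = sym (substitute-unit Y S)
  ⋀-⊗ {suc l} X Y S = begin
    ((X ⊗ Y) Fin.zero ∧ ⋀ (tail X ⊗ Y)) S               ≈⟨ ∧-congˡ ((X ⊗ Y) Fin.zero) (⋀-⊗ (tail X) Y) S ⟩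
    ((X ⊗ Y) Fin.zero ∧ substitute Y (⋀ (tail X))) S    ≈⟨ substitute-∧ Y (head X) (⋀ (tail X)) S ⟨
    substitute Y (⋀ X) S                                ∎

  -- The offset `a` counts the `inside` entries already stripped off: the coefficients with the
  -- first generator present form a family whose degree is shifted by one, and the offset keeps `k`
  -- fixed along the induction.
  ∧-degree : ∀ {N} k a (v : Vector Carrier N) (x : Form N) →
             (∀ S → ∣ S ∣ ℕ.+ a ≢ k → x S ≈ 0#) → ∀ S → ∣ S ∣ ℕ.+ a ≢ suc k → (v ∧ x) S ≈ 0#
  ∧-degree k a v x supp []            _ = refl
  ∧-degree k a v x supp (outside ∷ S) ≢k = ∧-degree k a (tail v) _ (supp ∘ (outside ∷_)) S ≢k
  ∧-degree k a v x supp (inside ∷ S)  ≢k = begin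
    head v * x (outside ∷ S) - (tail v ∧ λ T → x (inside ∷ T)) S
      ≈⟨ +-cong (*-congˡ (supp (outside ∷ S) (≢k ∘ ≡.cong suc)))
           (-‿cong (∧-degree k (suc a) (tail v) _
             (λ T ≢k′ → supp (inside ∷ T) (≢k′ ∘ ≡.trans (ℕ.+-suc ∣ T ∣ a)))
             S (≢k ∘ ≡.trans (≡.sym (ℕ.+-suc ∣ S ∣ a))))) ⟩
    head v * 0# - 0#
      ≈⟨ solve 1 (λ v → v :* con 0ℤ :- con 0ℤ := con 0ℤ) refl (head v) ⟩
    0# ∎

  unit-degree : ∀ {N} (S : Subset N) → ∣ S ∣ ≢ 0 → unit S ≈ 0#
  unit-degree []            ≢0 = contradiction ≡.refl ≢0
  unit-degree (outside ∷ S) ≢0 = unit-degree S ≢0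
  unit-degree (inside ∷ S)  ≢0 = refl

  ⋀-degree : ∀ {k N} (X : Vector (Vector Carrier N) k) S → ∣ S ∣ ≢ k → ⋀ X S ≈ 0#
  ⋀-degree {zero}  X S ≢k = unit-degree S ≢k
  ⋀-degree {suc k} X S ≢k = ∧-degree k 0 (head X) (⋀ (tail X))
    (λ T ≢k′ → ⋀-degree (tail X) T (≢k′ ∘ ≡.trans (ℕ.+-identityʳ ∣ T ∣)))
    S (≢k ∘ ≡.trans (≡.sym (ℕ.+-identityʳ ∣ S ∣)))

  -- A form concentrated in the top monomial is a multiple of the product of all generators, and
  -- that product is sent to `⋀ Y`.
  substitute-top : ∀ {k N} (Y : Vector (Vector Carrier N) k) (x : Form k) →
                   (∀ S → S ≢ ⊤ → x S ≈ 0#) → substitute Y x ≋ λ S → x ⊤ * ⋀ Y S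
  substitute-top {zero}  Y x supp S = refl
  substitute-top {suc k} Y x supp S = begin
    substitute (tail Y) (x ∘ (outside ∷_)) S + (head Y ∧ substitute (tail Y) (x ∘ (inside ∷_))) S
      ≈⟨ +-cong (substitute-zero (tail Y) (λ T → supp (outside ∷ T) λ ()) S)
           (∧-congˡ (head Y) (substitute-top (tail Y) (x ∘ (inside ∷_))
             (λ T T≢⊤ → supp (inside ∷ T) (T≢⊤ ∘ ≡.cong Vec.tail))) S) ⟩
    0# + (head Y ∧ λ T → x ⊤ * ⋀ (tail Y) T) S
      ≈⟨ +-identityˡ _ ⟩
    (head Y ∧ λ T → x ⊤ * ⋀ (tail Y) T) S
      ≈⟨ ∧-scaleʳ (head Y) (x ⊤) (⋀ (tail Y)) S ⟩
    x ⊤ * ⋀ Y S ∎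

  -- N vectors on N generators have a product of degree N, which leaves `⊤` as the only possible
  -- monomial of `⋀ X`.
  det-⊗ : ∀ {N} (X Y : Fin N → Fin N → Carrier) → det (X ⊗ Y) ≈ det X * det Y
  det-⊗ X Y = trans (⋀-⊗ X Y ⊤)
    (substitute-top Y (⋀ X) (λ S S≢⊤ → ⋀-degree X S (S≢⊤ ∘ ∣p∣≡n⇒p≡⊤)) ⊤)

  ⋀-cong : ∀ {N k} {X Y : Vector (Vector Carrier N) k} → (∀ i j → X i j ≈ Y i j) → ⋀ X ≋ ⋀ Y
  ⋀-cong {k = zero}  X≈Y S = refl
  ⋀-cong {k = suc k} X≈Y S = ∧-cong (X≈Y Fin.zero) (⋀-cong (X≈Y ∘ Fin.suc)) S

  ⋀-outside : ∀ {N k} (X : Vector (Vector Carrier (suc N)) k) S →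
              ⋀ X (outside ∷ S) ≈ ⋀ (tail ∘ X) S
  ⋀-outside {k = zero}  X S = refl
  ⋀-outside {k = suc k} X S = ∧-congˡ (tail (head X)) (⋀-outside (tail X)) S

  ⋀-inside : ∀ {N k} (X : Vector (Vector Carrier (suc N)) k) → (∀ i → X i Fin.zero ≈ 0#) →
             ∀ S → ⋀ X (inside ∷ S) ≈ 0#
  ⋀-inside {k = zero}  X X₀≈0 S = refl
  ⋀-inside {k = suc k} X X₀≈0 S = begin
    head X Fin.zero * ⋀ (tail X) (outside ∷ S) - (tail (head X) ∧ λ T → ⋀ (tail X) (inside ∷ T)) S
      ≈⟨ +-cong (*-congʳ (X₀≈0 Fin.zero))
           (-‿cong (∧-zeroʳ (tail (head X)) (⋀-inside (tail X) (X₀≈0 ∘ Fin.suc)) S)) ⟩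
    0# * ⋀ (tail X) (outside ∷ S) - 0#
      ≈⟨ solve 1 (λ a → con 0ℤ :* a :- con 0ℤ := con 0ℤ) refl _ ⟩
    0# ∎

  private
    -- Splits off the first row and column. The first hypothesis removes the terms that avoid the
    -- corner entry: in the upper triangular case because the first column vanishes below the
    -- corner, in the lower triangular case because the first row vanishes to its right.
    det-reduce : ∀ {N} (X : Fin (suc N) → Fin (suc N) → Carrier) →
                 (tail (head X) ∧ λ T → ⋀ (tail X) (inside ∷ T)) ⊤ ≈ 0# →
                 det (tail ∘ tail X) ≈ product (λ i → X (Fin.suc i) (Fin.suc i)) →
                 det X ≈ product (λ i → X i i)
    det-reduce X rest≈0 minor = begin
      X Fin.zero Fin.zero * ⋀ (tail X) (outside ∷ ⊤) - _
        ≈⟨ +-cong (*-congˡ (trans (⋀-outside (tail X) ⊤) minor)) (-‿cong rest≈0) ⟩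
      product (λ i → X i i) - 0#
        ≈⟨ solve 1 (λ a → a :- con 0ℤ := a) refl _ ⟩
      product (λ i → X i i) ∎

  det-upperTriangular : ∀ {N} (X : Fin N → Fin N → Carrier) →
                        (∀ i j → j Fin.< i → X i j ≈ 0#) → det X ≈ product (λ i → X i i)
  det-upperTriangular {zero}  X upper = refl
  det-upperTriangular {suc N} X upper = det-reduce X
    (∧-zeroʳ (tail (head X)) (⋀-inside (tail X) (λ i → upper (Fin.suc i) Fin.zero ℕ.z<s)) ⊤)
    (det-upperTriangular (tail ∘ tail X) (λ i j j<i → upper (Fin.suc i) (Fin.suc j) (ℕ.s<s j<i)))

  det-lowerTriangular : ∀ {N} (X : Fin N → Fin N → Carrier) →
                        (∀ i j → i Fin.< j → X i j ≈ 0#) → det X ≈ product (λ i → X i i)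
  det-lowerTriangular {zero}  X lower = refl
  det-lowerTriangular {suc N} X lower = det-reduce X
    (∧-zeroˡ {v = tail (head X)} (λ T → ⋀ (tail X) (inside ∷ T))
      (λ j → lower Fin.zero (Fin.suc j) ℕ.z<s) ⊤)
    (det-lowerTriangular (tail ∘ tail X) (λ i j i<j → lower (Fin.suc i) (Fin.suc j) (ℕ.s<s i<j)))

  module _ (P : Pred Carrier 0ℓ) (P0 : P 0#) (P1 : P 1#)
           (P- : ∀ {a b} → P a → P b → P (a - b)) (P* : ∀ {a b} → P a → P b → P (a * b)) where

    ∧-closed : ∀ {N} {v : Vector Carrier N} {x : Form N} →
               (∀ i → P (v i)) → (∀ S → P (x S)) → ∀ S → P ((v ∧ x) S)
    ∧-closed Pv Px []            = P0
    ∧-closed Pv Px (outside ∷ S) = ∧-closed (Pv ∘ Fin.suc) (Px ∘ (outside ∷_)) S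
    ∧-closed Pv Px (inside ∷ S)  =
      P- (P* (Pv Fin.zero) (Px (outside ∷ S))) (∧-closed (Pv ∘ Fin.suc) (Px ∘ (inside ∷_)) S)

    unit-closed : ∀ {N} (S : Subset N) → P (unit S)
    unit-closed []            = P1
    unit-closed (outside ∷ S) = unit-closed S
    unit-closed (inside ∷ S)  = P0

    -- The coefficients are integer polynomials in the entries of `X`, so they stay in every
    -- subring; applied to the integers inside the reals, this gives integral determinants.
    ⋀-closed : ∀ {N k} (X : Vector (Vector Carrier N) k) → (∀ i j → P (X i j)) → ∀ S → P (⋀ X S)
    ⋀-closed {k = zero}  X PX S = unit-closed S
    ⋀-closed {k = suc k} X PX S = ∧-closed (PX Fin.zero) (⋀-closed (tail X) (PX ∘ Fin.suc)) S

-- Order, absolute values and the embedded integers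

module OrderedField (em : ExcludedMiddle 0ℓ) (R : CompleteOrderedField) where

  open Reals em R
  open CompleteOrderedField R public
    using ( refl; sym; trans; reflexive; +-abelianGroup; commutativeSemiring
          ; +-cong; +-congˡ; +-congʳ; +-comm; +-assoc; +-identityˡ; +-identityʳ; -‿cong; -‿inverseʳ
          ; *-cong; *-congˡ; *-congʳ; *-comm; *-assoc; *-identityˡ; *-identityʳ; zeroˡ; zeroʳ; distribˡ; distribʳ
          ; *-commutativeMonoid; +-commutativeMonoid; 0≉1; ⁻¹-inverseʳ; *-nonNeg; complete; IsUpperBound; +-monoˡ-≤ )
  open TotalOrder totalOrder public
    using (total; poset; ≤-resp-≈)
    renaming ( refl to ≤-refl; trans to ≤-trans; antisym to ≤-antisym; reflexive to ≤-reflexive)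
  open IntegerMultiples commutativeRing public using (module Solver; ⟦_⟧; ⟦⟧-+; ⟦⟧-*; ⟦⟧-neg)
  open Solver public using (solve; _:+_; _:*_; _:-_; :-_; _:=_; con)
  open Exp commutativeSemiring public using (^-congˡ; ^-homo-*; ^-assocʳ; ^-distrib-*)
  open SemiringSum semiring public
    using (sum-cong-≋; ∑-distrib-+; ∑-comm; *-distribˡ-sum; *-distribʳ-sum; sum-replicate-zero)
  open Max totalOrder public using (⊔-lub; x≤x⊔y; x≤y⊔x; x≤y⇒x⊔y≈y; x≤y⇒y⊔x≈y; ⊔-cong; ⊔-comm)
  open AbelianGroupProperties +-abelianGroup public using (ε⁻¹≈ε; ⁻¹-involutive)
  module ≤-Reasoning = Relation.Binary.Reasoning.PartialOrder poset
  open ≤-Reasoning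

  ≤-respˡ : ∀ {x y z} → x ≈ y → x ≤ z → y ≤ z
  ≤-respˡ x≈y = proj₂ ≤-resp-≈ x≈y

  ≤-respʳ : ∀ {x y z} → x ≈ y → z ≤ x → z ≤ y
  ≤-respʳ x≈y = proj₁ ≤-resp-≈ x≈y

  <-respʳ : ∀ {x y z} → x ≈ y → z < x → z < y
  <-respʳ = NonStrictToStrict.<-respʳ-≈ _≈_ _≤_ sym trans ≤-respʳ

  ≰⇒> : ∀ {x y} → ¬ x ≤ y → y < x
  ≰⇒> = NonStrictToStrict.≰⇒> _≈_ _≤_ sym ≤-reflexive total

  <⇒≱ : ∀ {x y} → x < y → ¬ y ≤ x
  <⇒≱ = NonStrictToStrict.<⇒≱ _≈_ _≤_ ≤-antisym

  ≮⇒≥ : ∀ {x y} → ¬ y < x → x ≤ y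
  ≮⇒≥ {x} {y} y≮x with em {x ≤ y}
  ... | yes x≤y = x≤y
  ... | no  x≰y = contradiction (≰⇒> x≰y) y≮x

  -- Turns an inequality into the nonnegativity of a term that the ring solver can identify with the
  -- difference; many order facts below are obtained in this way.
  ≤-by-difference : ∀ {x y w} → w ≈ y - x → 0# ≤ w → x ≤ y
  ≤-by-difference {x} {y} {w} w≈y-x 0≤w = begin
    x          ≈⟨ +-identityˡ x ⟨
    0# + x     ≤⟨ +-monoˡ-≤ x 0≤w ⟩
    w + x      ≈⟨ +-congʳ w≈y-x ⟩
    y - x + x  ≈⟨ solve 2 (λ x y → y :- x :+ x := y) refl x y ⟩
    y          ∎

  difference-nonNeg : ∀ {x y} → x ≤ y → 0# ≤ y - x
  difference-nonNeg {x} x≤y = ≤-respˡ (-‿inverseʳ x) (+-monoˡ-≤ (- x) x≤y)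

  <-by-difference : ∀ {x y w} → w ≈ y - x → 0# < w → x < y
  <-by-difference {x} {y} w≈y-x (0≤w , 0≉w) =
    ≤-by-difference w≈y-x 0≤w ,
    λ x≈y → 0≉w (sym (trans w≈y-x (trans (+-congˡ (-‿cong x≈y)) (-‿inverseʳ y))))

  difference-pos : ∀ {x y} → x < y → 0# < y - x
  difference-pos {x} {y} (x≤y , x≉y) = difference-nonNeg x≤y , λ 0≈y-x → x≉y (trans
    (trans (sym (+-identityˡ x)) (+-congʳ 0≈y-x))
    (solve 2 (λ x y → y :- x :+ x := y) refl x y))

  +-mono-≤ : ∀ {x y u v} → x ≤ y → u ≤ v → x + u ≤ y + v
  +-mono-≤ {x} {y} {u} {v} x≤y u≤v = begin
    x + u  ≤⟨ +-monoˡ-≤ u x≤y ⟩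
    y + u  ≈⟨ +-comm y u ⟩
    u + y  ≤⟨ +-monoˡ-≤ y u≤v ⟩
    v + y  ≈⟨ +-comm v y ⟩
    y + v  ∎

  +-monoʳ-< : ∀ x {y z} → y < z → x + y < x + z
  +-monoʳ-< x {y} {z} y<z =
    <-by-difference (solve 3 (λ x y z → z :- y := x :+ z :- (x :+ y)) refl x y z) (difference-pos y<z)

  +-nonNeg : ∀ {x y} → 0# ≤ x → 0# ≤ y → 0# ≤ x + y
  +-nonNeg 0≤x 0≤y = ≤-respˡ (+-identityʳ 0#) (+-mono-≤ 0≤x 0≤y)

  +-pos-nonNeg : ∀ {x y} → 0# < x → 0# ≤ y → 0# < x + y
  +-pos-nonNeg {x} {y} 0<x 0≤y = begin-strict
    0#      <⟨ 0<x ⟩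
    x       ≈⟨ +-identityʳ x ⟨
    x + 0#  ≤⟨ +-mono-≤ ≤-refl 0≤y ⟩
    x + y   ∎

  neg-antimono-≤ : ∀ {x y} → x ≤ y → - y ≤ - x
  neg-antimono-≤ {x} {y} x≤y =
    ≤-by-difference (solve 2 (λ x y → y :- x := :- x :- :- y) refl x y) (difference-nonNeg x≤y)

  -x≤y⇒-y≤x : ∀ {x y} → - x ≤ y → - y ≤ x
  -x≤y⇒-y≤x {x} -x≤y = ≤-respʳ (⁻¹-involutive x) (neg-antimono-≤ -x≤y)

  x≤-y⇒y≤-x : ∀ {x y} → x ≤ - y → y ≤ - x
  x≤-y⇒y≤-x {y = y} x≤-y = ≤-respˡ (⁻¹-involutive y) (neg-antimono-≤ x≤-y)

  -x<y+z⇒-y<x+z : ∀ {x y z} → - x < y + z → - y < x + z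
  -x<y+z⇒-y<x+z {x} {y} {z} -x<y+z =
    <-by-difference (solve 3 (λ x y z → y :+ z :- :- x := x :+ z :- :- y) refl x y z) (difference-pos -x<y+z)

  x-y≤z⇒x≤z+y : ∀ {x y z} → x - y ≤ z → x ≤ z + y
  x-y≤z⇒x≤z+y {x} {y} {z} x-y≤z =
    ≤-by-difference (solve 3 (λ x y z → z :- (x :- y) := z :+ y :- x) refl x y z) (difference-nonNeg x-y≤z)

  *-monoˡ-≤ : ∀ {x y z} → 0# ≤ z → x ≤ y → z * x ≤ z * y
  *-monoˡ-≤ {x} {y} {z} 0≤z x≤y =
    ≤-by-difference (solve 3 (λ x y z → z :* (y :- x) := z :* y :- z :* x) refl x y z)
      (*-nonNeg 0≤z (difference-nonNeg x≤y))

  *-monoʳ-≤ : ∀ {x y z} → 0# ≤ z → x ≤ y → x * z ≤ y * z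
  *-monoʳ-≤ {x} {y} {z} 0≤z x≤y = begin
    x * z  ≈⟨ *-comm x z ⟩
    z * x  ≤⟨ *-monoˡ-≤ 0≤z x≤y ⟩
    z * y  ≈⟨ *-comm z y ⟩
    y * z  ∎

  *-mono-≤ : ∀ {x y u v} → 0# ≤ y → 0# ≤ u → x ≤ y → u ≤ v → x * u ≤ y * v
  *-mono-≤ 0≤y 0≤u x≤y u≤v = ≤-trans (*-monoʳ-≤ 0≤u x≤y) (*-monoˡ-≤ 0≤y u≤v)

  pos⇒≉0 : ∀ {x} → 0# < x → ¬ x ≈ 0#
  pos⇒≉0 (_ , 0≉x) x≈0 = 0≉x (sym x≈0)

  *-cancelˡ-0 : ∀ {x y} → ¬ x ≈ 0# → x * y ≈ 0# → y ≈ 0#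
  *-cancelˡ-0 {x} {y} x≉0 xy≈0 = begin-equality
    y               ≈⟨ *-identityˡ y ⟨
    1# * y          ≈⟨ *-congʳ (⁻¹-inverseʳ x≉0) ⟨
    x * x ⁻¹ * y    ≈⟨ solve 3 (λ x x′ y → x :* x′ :* y := x′ :* (x :* y)) refl x (x ⁻¹) y ⟩
    x ⁻¹ * (x * y)  ≈⟨ *-congˡ xy≈0 ⟩
    x ⁻¹ * 0#       ≈⟨ zeroʳ _ ⟩
    0#              ∎

  *-pos : ∀ {x y} → 0# < x → 0# < y → 0# < x * y
  *-pos 0<x 0<y = *-nonNeg (proj₁ 0<x) (proj₁ 0<y) ,
    λ 0≈xy → pos⇒≉0 0<y (*-cancelˡ-0 (pos⇒≉0 0<x) (sym 0≈xy))

  *-monoʳ-< : ∀ {x y z} → 0# < z → x < y → x * z < y * z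
  *-monoʳ-< {x} {y} {z} 0<z x<y =
    <-by-difference (solve 3 (λ x y z → (y :- x) :* z := y :* z :- x :* z) refl x y z)
      (*-pos (difference-pos x<y) 0<z)

  *-cancelʳ-≤ : ∀ {x y z} → 0# < z → x * z ≤ y * z → x ≤ y
  *-cancelʳ-≤ 0<z xz≤yz = ≮⇒≥ λ y<x → <⇒≱ (*-monoʳ-< 0<z y<x) xz≤yz

  *-cancelʳ-≈ : ∀ {x y z} → 0# < z → x * z ≈ y * z → x ≈ y
  *-cancelʳ-≈ 0<z xz≈yz =
    ≤-antisym (*-cancelʳ-≤ 0<z (≤-reflexive xz≈yz)) (*-cancelʳ-≤ 0<z (≤-reflexive (sym xz≈yz)))

  square-nonNeg : ∀ x → 0# ≤ x * x
  square-nonNeg x with total 0# x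
  ... | inj₁ 0≤x = *-nonNeg 0≤x 0≤x
  ... | inj₂ x≤0 = ≤-respʳ (solve 1 (λ x → :- x :* :- x := x :* x) refl x) (*-nonNeg 0≤-x 0≤-x)
    where
    0≤-x : 0# ≤ - x
    0≤-x = ≤-respˡ ε⁻¹≈ε (neg-antimono-≤ x≤0)

  0<1 : 0# < 1#
  0<1 = ≤-respʳ (*-identityʳ 1#) (square-nonNeg 1#) , 0≉1

  ⁻¹-pos : ∀ {x} → 0# < x → 0# < x ⁻¹
  ⁻¹-pos {x} 0<x = ≰⇒> λ x⁻¹≤0 → <⇒≱ 0<1 (begin
    1#        ≈⟨ ⁻¹-inverseʳ (pos⇒≉0 0<x) ⟨
    x * x ⁻¹  ≤⟨ *-monoˡ-≤ (proj₁ 0<x) x⁻¹≤0 ⟩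
    x * 0#    ≈⟨ zeroʳ x ⟩
    0#        ∎)

  x*y⁻¹*y≈x : ∀ {x y} → 0# < y → x * y ⁻¹ * y ≈ x
  x*y⁻¹*y≈x {x} {y} 0<y = trans (*-assoc x _ y)
    (trans (*-congˡ (trans (*-comm _ y) (⁻¹-inverseʳ (pos⇒≉0 0<y)))) (*-identityʳ x))

  x*y*y⁻¹≈x : ∀ {x y} → 0# < y → x * y * y ⁻¹ ≈ x
  x*y*y⁻¹≈x {x} {y} 0<y = trans (*-assoc x y _) (trans (*-congˡ (⁻¹-inverseʳ (pos⇒≉0 0<y))) (*-identityʳ x))

  ^-pos : ∀ {x} n → 0# < x → 0# < x ^ n
  ^-pos zero    0<x = 0<1
  ^-pos (suc n) 0<x = *-pos 0<x (^-pos n 0<x)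

  ^-nonNeg : ∀ {x} n → 0# ≤ x → 0# ≤ x ^ n
  ^-nonNeg zero    0≤x = proj₁ 0<1
  ^-nonNeg (suc n) 0≤x = *-nonNeg 0≤x (^-nonNeg n 0≤x)

  ^-mono-≤ : ∀ {x y} n → 0# ≤ x → x ≤ y → x ^ n ≤ y ^ n
  ^-mono-≤ zero    0≤x x≤y = ≤-refl
  ^-mono-≤ (suc n) 0≤x x≤y =
    *-mono-≤ (≤-trans 0≤x x≤y) (^-nonNeg n 0≤x) x≤y (^-mono-≤ n 0≤x x≤y)

  ^-mono-< : ∀ {x y} n .{{_ : NonZero n}} → 0# ≤ x → x < y → x ^ n < y ^ n
  ^-mono-< {x} {y} (suc n) 0≤x x<y@(x≤y , _) = begin-strict
    x * x ^ n  ≤⟨ *-monoˡ-≤ 0≤x (^-mono-≤ n 0≤x x≤y) ⟩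
    x * y ^ n  <⟨ *-monoʳ-< (^-pos n (begin-strict 0# ≤⟨ 0≤x ⟩ x <⟨ x<y ⟩ y ∎)) x<y ⟩
    y * y ^ n  ∎

  -- The device for inequalities between roots: both sides are raised to a power that clears the
  -- denominators of the exponents.
  ^-cancel-≤ : ∀ {x y} n .{{_ : NonZero n}} → 0# ≤ y → x ^ n ≤ y ^ n → x ≤ y
  ^-cancel-≤ n 0≤y xⁿ≤yⁿ = ≮⇒≥ λ y<x → <⇒≱ (^-mono-< n 0≤y y<x) xⁿ≤yⁿ

  1≤x⇒1≤x^n : ∀ {x} n → 1# ≤ x → 1# ≤ x ^ n
  1≤x⇒1≤x^n zero    1≤x = ≤-refl
  1≤x⇒1≤x^n {x} (suc n) 1≤x = begin
    1#         ≈⟨ *-identityʳ 1# ⟨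
    1# * 1#    ≤⟨ *-mono-≤ (≤-trans (proj₁ 0<1) 1≤x) (proj₁ 0<1) 1≤x (1≤x⇒1≤x^n n 1≤x) ⟩
    x * x ^ n  ∎

  square-cancel-≤ : ∀ {x y} → 0# ≤ y → x * x ≤ y * y → x ≤ y
  square-cancel-≤ {x} {y} 0≤y x²≤y² = ^-cancel-≤ 2 0≤y (begin
    x * (x * 1#)  ≈⟨ *-congˡ (*-identityʳ x) ⟩
    x * x         ≤⟨ x²≤y² ⟩
    y * y         ≈⟨ *-congˡ (*-identityʳ y) ⟨
    y * (y * 1#)  ∎)

  square≈0⇒≈0 : ∀ {x} → x * x ≈ 0# → x ≈ 0#
  square≈0⇒≈0 {x} x²≈0 with em {x ≈ 0#}
  ... | yes x≈0 = x≈0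
  ... | no  x≉0 = *-cancelˡ-0 x≉0 x²≈0

  ∣∣-nonNeg : ∀ x → 0# ≤ ∣ x ∣
  ∣∣-nonNeg x with total 0# x
  ... | inj₁ 0≤x = ≤-trans 0≤x (x≤x⊔y x (- x))
  ... | inj₂ x≤0 = ≤-trans (≤-respˡ ε⁻¹≈ε (neg-antimono-≤ x≤0)) (x≤y⊔x x (- x))

  ∣∣-square : ∀ x → ∣ x ∣ * ∣ x ∣ ≈ x * x
  ∣∣-square x with total x (- x)
  ... | inj₁ x≤-x = trans (*-cong (x≤y⇒x⊔y≈y x≤-x) (x≤y⇒x⊔y≈y x≤-x))
                          (solve 1 (λ x → :- x :* :- x := x :* x) refl x)
  ... | inj₂ -x≤x = *-cong (x≤y⇒y⊔x≈y -x≤x) (x≤y⇒y⊔x≈y -x≤x)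

  ∣∣-cong : ∀ {x y} → x ≈ y → ∣ x ∣ ≈ ∣ y ∣
  ∣∣-cong x≈y = ⊔-cong x≈y (-‿cong x≈y)

  0≤x⇒∣x∣≈x : ∀ {x} → 0# ≤ x → ∣ x ∣ ≈ x
  0≤x⇒∣x∣≈x 0≤x = x≤y⇒y⊔x≈y (≤-trans (neg-antimono-≤ 0≤x) (≤-respˡ (sym ε⁻¹≈ε) 0≤x))

  ∣x-y∣≈∣y-x∣ : ∀ x y → ∣ x - y ∣ ≈ ∣ y - x ∣
  ∣x-y∣≈∣y-x∣ x y = trans (⊔-comm _ _)
    (⊔-cong (solve 2 (λ x y → :- (x :- y) := y :- x) refl x y)
            (solve 2 (λ x y → x :- y := :- (y :- x)) refl x y))

  square≤⇒∣∣≤ : ∀ {x y} → 0# ≤ y → x * x ≤ y * y → ∣ x ∣ ≤ y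
  square≤⇒∣∣≤ {x} 0≤y x²≤y² = square-cancel-≤ 0≤y (≤-respˡ (sym (∣∣-square x)) x²≤y²)

  maximum-lub : ∀ {n} {v : Vector ℝ n} {b} → 0# ≤ b → (∀ i → v i ≤ b) → maximum v ≤ b
  maximum-lub {zero}  0≤b v≤b = 0≤b
  maximum-lub {suc n} 0≤b v≤b = ⊔-lub (v≤b Fin.zero) (maximum-lub 0≤b (v≤b ∘ Fin.suc))

  sum-nonNeg : ∀ {n} {v : Vector ℝ n} → (∀ i → 0# ≤ v i) → 0# ≤ sum v
  sum-nonNeg {zero}  0≤v = ≤-refl
  sum-nonNeg {suc n} 0≤v = +-nonNeg (0≤v Fin.zero) (sum-nonNeg (0≤v ∘ Fin.suc))

  term≤sum : ∀ {n} {v : Vector ℝ n} → (∀ i → 0# ≤ v i) → ∀ i → v i ≤ sum v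
  term≤sum {v = v} 0≤v Fin.zero = ≤-respˡ (+-identityʳ _) (+-mono-≤ ≤-refl (sum-nonNeg (0≤v ∘ Fin.suc)))
  term≤sum {v = v} 0≤v (Fin.suc i) =
    ≤-respˡ (+-identityˡ _) (+-mono-≤ (0≤v Fin.zero) (term≤sum (0≤v ∘ Fin.suc) i))

  fromℤ≡⟦⟧ : ∀ i → fromℤ i ≡ ⟦ i ⟧
  fromℤ≡⟦⟧ (+ n)    = ≡.refl
  fromℤ≡⟦⟧ -[1+ n ] = ≡.refl

  fromℤ-+ : ∀ i j → fromℤ (i ℤ.+ j) ≈ fromℤ i + fromℤ j
  fromℤ-+ i j rewrite fromℤ≡⟦⟧ i | fromℤ≡⟦⟧ j | fromℤ≡⟦⟧ (i ℤ.+ j) = ⟦⟧-+ i j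

  fromℤ-* : ∀ i j → fromℤ (i ℤ.* j) ≈ fromℤ i * fromℤ j
  fromℤ-* i j rewrite fromℤ≡⟦⟧ i | fromℤ≡⟦⟧ j | fromℤ≡⟦⟧ (i ℤ.* j) = ⟦⟧-* i j

  fromℤ-neg : ∀ i → fromℤ (ℤ.- i) ≈ - fromℤ i
  fromℤ-neg i rewrite fromℤ≡⟦⟧ i | fromℤ≡⟦⟧ (ℤ.- i) = ⟦⟧-neg i

  fromℤ-nonNeg : ∀ n → 0# ≤ fromℤ (+ n)
  fromℤ-nonNeg zero    = ≤-refl
  fromℤ-nonNeg (suc n) = +-nonNeg (proj₁ 0<1) (fromℤ-nonNeg n)

  fromℤ-pos : ∀ n .{{_ : NonZero n}} → 0# < fromℤ (+ n)
  fromℤ-pos (suc n) = +-pos-nonNeg 0<1 (fromℤ-nonNeg n)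

  fromℤ-mono-≤ : ∀ {i j} → i ℤ.≤ j → fromℤ i ≤ fromℤ j
  fromℤ-mono-≤ {i} {j} i≤j = ≤-by-difference
    (trans (fromℤ-+ j (ℤ.- i)) (+-congˡ (fromℤ-neg i)))
    (≡.subst (λ k → 0# ≤ fromℤ k) (ℤ.0≤i⇒+∣i∣≡i (ℤ.i≤j⇒0≤j-i i≤j)) (fromℤ-nonNeg ℤ.∣ j ℤ.- i ∣))

  fromℤ-suc : ∀ i → fromℤ (ℤ.suc i) ≈ fromℤ i + 1#
  fromℤ-suc i = trans (fromℤ-+ 1ℤ i) (trans (+-congʳ (+-identityʳ 1#)) (+-comm 1# _))

  x<x+1 : ∀ x → x < x + 1#
  x<x+1 x = <-by-difference (solve 2 (λ x y → y := x :+ y :- x) refl x 1#) 0<1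

  fromℤ-cancel-≤ : ∀ {i j} → fromℤ i ≤ fromℤ j → i ℤ.≤ j
  fromℤ-cancel-≤ {i} {j} fi≤fj = ℤ.≮⇒≥ λ j<i → <⇒≱ (x<x+1 (fromℤ j)) (begin
    fromℤ j + 1#      ≈⟨ fromℤ-suc j ⟨
    fromℤ (ℤ.suc j)   ≤⟨ fromℤ-mono-≤ (ℤ.i<j⇒suc[i]≤j j<i) ⟩
    fromℤ i           ≤⟨ fi≤fj ⟩
    fromℤ j           ∎)

  fromℤ-cancel-< : ∀ {i j} → fromℤ i < fromℤ j → i ℤ.< j
  fromℤ-cancel-< fi<fj = ℤ.≰⇒> λ j≤i → <⇒≱ fi<fj (fromℤ-mono-≤ j≤i)

-- Completeness: Archimedean property, integer parts, roots, rational powers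

module Powers (em : ExcludedMiddle 0ℓ) (R : CompleteOrderedField) where

  open Reals em R
  open OrderedField em R
  open ≤-Reasoning

  -- A witness rules out the default branch of `choose`. Ceilings, nearest integers, rational powers
  -- and logarithms are all made usable by an existence proof passed to this lemma.
  choose-satisfies : ∀ {A : Set} (default : A) (P : Pred A 0ℓ) → ∃ P → P (choose default P)
  choose-satisfies default P ∃P with em {∃ P}
  ... | yes (_ , px) = px
  ... | no  ∄P       = contradiction ∃P ∄P

  -- Descends from a known failure to the nearest success below it, which is `0` at the latest. It
  -- yields integer parts, brackets between consecutive powers, and the decisive iteration of the
  -- algorithm.
  last-before-failure : ∀ {P : Pred ℕ 0ℓ} → P 0 → ∀ n → ¬ P n → ∃[ k ] P k × ¬ P (suc k)
  last-before-failure         p₀ zero    ¬pₙ = contradiction p₀ ¬pₙ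
  last-before-failure {P = P} p₀ (suc n) ¬pₙ with em {P n}
  ... | yes p = n , p , ¬pₙ
  ... | no ¬p = last-before-failure p₀ n ¬p

  -- If the values were bounded, `improve` would produce an upper bound strictly below their
  -- supremum. The improved bound is `s - 1#` for the integers and `s * d ⁻¹` for the powers of `d`;
  -- in both cases the bound `s` at index n + 1 is read as a smaller bound at n.
  unbounded : (f : ℕ → ℝ) → (∀ s → (∀ n → f n ≤ s) → ∃[ u ] u < s × (∀ n → f n ≤ u)) →
              ∀ x → ∃[ n ] x < f n
  unbounded f improve x with em {∃[ n ] x < f n}
  ... | yes found = found
  ... | no  none  = contradiction (least u (λ { _ (n , y≈fn) → ≤-respˡ (sym y≈fn) (f≤u n) })) (<⇒≱ u<s)
    where
    image : Pred ℝ 0ℓ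
    image y = ∃[ n ] y ≈ f n
    sup : ∃ (IsSupremum image)
    sup = complete image (f 0 , 0 , refl)
      (x , λ { _ (n , y≈fn) → ≤-respˡ (sym y≈fn) (≮⇒≥ λ x<fn → none (n , x<fn)) })
    s : ℝ
    s = proj₁ sup
    least : ∀ u → IsUpperBound image u → s ≤ u
    least = proj₂ (proj₂ sup)
    improved : ∃[ u ] u < s × (∀ n → f n ≤ u)
    improved = improve s (λ n → proj₁ (proj₂ sup) (f n) (n , refl))
    u : ℝ
    u = proj₁ improved
    u<s : u < s
    u<s = proj₁ (proj₂ improved)
    f≤u : ∀ n → f n ≤ u
    f≤u = proj₂ (proj₂ improved)

  archimedean : ∀ x → ∃[ n ] x < fromℤ (+ n)
  archimedean = unbounded (λ n → fromℤ (+ n)) λ s ub →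
    s - 1# ,
    <-by-difference (solve 2 (λ s o → o := s :- (s :- o)) refl s 1#) 0<1 ,
    λ n → ≤-by-difference (solve 3 (λ s o n → s :- (o :+ n) := s :- o :- n) refl s 1# (fromℤ (+ n)))
            (difference-nonNeg (ub (suc n)))

  powers-unbounded : ∀ {d} → 1# < d → ∀ x → ∃[ n ] x < d ^ n
  powers-unbounded {d} 1<d = unbounded (d ^_) λ s ub →
    let s*d⁻¹*d≈s = x*y⁻¹*y≈x {s} 0<d
        0<s = begin-strict 0# <⟨ 0<1 ⟩ 1# ≤⟨ ub 0 ⟩ s ∎
    in
    s * d ⁻¹ ,
    ≰⇒> (λ s≤s*d⁻¹ → <⇒≱ (*-monoʳ-< 0<s 1<d) (begin
      d * s          ≈⟨ *-comm d s ⟩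
      s * d          ≤⟨ *-monoʳ-≤ (proj₁ 0<d) s≤s*d⁻¹ ⟩
      s * d ⁻¹ * d   ≈⟨ s*d⁻¹*d≈s ⟩
      s              ≈⟨ *-identityˡ s ⟨
      1# * s         ∎)) ,
    λ n → *-cancelʳ-≤ 0<d (begin
      d ^ n * d      ≈⟨ *-comm _ d ⟩
      d ^ suc n      ≤⟨ ub (suc n) ⟩
      s              ≈⟨ s*d⁻¹*d≈s ⟨
      s * d ⁻¹ * d   ∎)
    where
    0<d : 0# < d
    0<d = begin-strict 0# <⟨ 0<1 ⟩ 1# <⟨ 1<d ⟩ d ∎

  floor : ∀ x → ∃[ z ] fromℤ z ≤ x × x < fromℤ z + 1#
  -- Integers are searched in the form k - N with k natural: N exceeds -x, so k = 0 starts below x,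
  -- and M exceeds x + N, so k = M is a failure.
  floor x = search (last-before-failure {P = λ k → fromℤ (+ k ℤ.- + N) ≤ x} z₀≤x M z≰x)
    where
    N M : ℕ
    N = proj₁ (archimedean (- x))
    M = proj₁ (archimedean (x + fromℤ (+ N)))
    shift : ∀ k → fromℤ (+ k ℤ.- + N) ≈ fromℤ (+ k) - fromℤ (+ N)
    shift k = trans (fromℤ-+ (+ k) (ℤ.- + N)) (+-congˡ (fromℤ-neg (+ N)))
    z₀≤x : fromℤ (+ 0 ℤ.- + N) ≤ x
    z₀≤x = begin
      fromℤ (+ 0 ℤ.- + N)  ≈⟨ trans (shift 0) (+-identityˡ _) ⟩
      - fromℤ (+ N)        ≤⟨ -x≤y⇒-y≤x (proj₁ (proj₂ (archimedean (- x)))) ⟩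
      x                    ∎
    z≰x : ¬ fromℤ (+ M ℤ.- + N) ≤ x
    z≰x z≤x = <⇒≱ (proj₂ (archimedean (x + fromℤ (+ N)))) (x-y≤z⇒x≤z+y (≤-respˡ (shift M) z≤x))
    search : (∃[ k ] fromℤ (+ k ℤ.- + N) ≤ x × ¬ fromℤ (+ suc k ℤ.- + N) ≤ x) →
             ∃[ z ] fromℤ z ≤ x × x < fromℤ z + 1#
    search (k , z≤x , z+1≰x) = + k ℤ.- + N , z≤x , (begin-strict
      x                                   <⟨ ≰⇒> z+1≰x ⟩
      fromℤ (+ suc k ℤ.- + N)             ≡⟨ ≡.cong fromℤ (ℤ.+-assoc 1ℤ (+ k) (ℤ.- + N)) ⟩
      fromℤ (ℤ.suc (+ k ℤ.- + N))         ≈⟨ fromℤ-suc (+ k ℤ.- + N) ⟩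
      fromℤ (+ k ℤ.- + N) + 1#            ∎)

  ceiling-exists : ∀ x → ∃ (IsCeiling x)
  ceiling-exists x = negate (floor (- x))
    where
    negate : (∃[ z ] fromℤ z ≤ - x × - x < fromℤ z + 1#) → ∃ (IsCeiling x)
    negate (z , z≤-x , -x<z+1) = ℤ.- z ,
      ≤-respʳ (sym (fromℤ-neg z)) (x≤-y⇒y≤-x z≤-x) ,
      (begin-strict
        fromℤ (ℤ.- z)   ≈⟨ fromℤ-neg z ⟩
        - fromℤ z       <⟨ -x<y+z⇒-y<x+z -x<z+1 ⟩
        x + 1#          ∎)

  ⌈⌉-isCeiling : ∀ x → IsCeiling x ⌈ x ⌉
  ⌈⌉-isCeiling x = choose-satisfies 0ℤ (IsCeiling x) (ceiling-exists x)

  -- An integer up to `z` is at least as far from `x` as `z` is, and any other integer is at least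
  -- as far as `ℤ.suc z`; so the nearer of these two is nearest overall.
  floor-or-suc-nearest : ∀ x z → fromℤ z ≤ x → x < fromℤ z + 1# → ∃ (IsNearestInteger x)
  floor-or-suc-nearest x z z≤x x<z+1 = nearer (total (x - fromℤ z) (fromℤ z + 1# - x))
    where
    0≤x-z : 0# ≤ x - fromℤ z
    0≤x-z = difference-nonNeg z≤x
    0≤z+1-x : 0# ≤ fromℤ z + 1# - x
    0≤z+1-x = difference-nonNeg (proj₁ x<z+1)
    below : ∣ x - fromℤ z ∣ ≤ x - fromℤ z
    below = ≤-reflexive (0≤x⇒∣x∣≈x 0≤x-z)
    above : ∣ x - fromℤ (ℤ.suc z) ∣ ≤ fromℤ z + 1# - x
    above = begin
      ∣ x - fromℤ (ℤ.suc z) ∣   ≈⟨ ∣∣-cong (+-congˡ (-‿cong (fromℤ-suc z))) ⟩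
      ∣ x - (fromℤ z + 1#) ∣    ≈⟨ ∣x-y∣≈∣y-x∣ x (fromℤ z + 1#) ⟩
      ∣ fromℤ z + 1# - x ∣      ≈⟨ 0≤x⇒∣x∣≈x 0≤z+1-x ⟩
      fromℤ z + 1# - x          ∎
    distance : ∀ w → Dec (w ℤ.≤ z) → x - fromℤ z ≤ ∣ x - fromℤ w ∣ ⊎ fromℤ z + 1# - x ≤ ∣ x - fromℤ w ∣
    distance w (yes w≤z) = inj₁ (begin
      x - fromℤ z         ≤⟨ +-mono-≤ ≤-refl (neg-antimono-≤ (fromℤ-mono-≤ w≤z)) ⟩
      x - fromℤ w         ≤⟨ x≤x⊔y _ _ ⟩
      ∣ x - fromℤ w ∣     ∎)
    distance w (no  w≰z) = inj₂ (begin
      fromℤ z + 1# - x    ≈⟨ +-congʳ (fromℤ-suc z) ⟨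
      fromℤ (ℤ.suc z) - x ≤⟨ +-monoˡ-≤ (- x) (fromℤ-mono-≤ (ℤ.i<j⇒suc[i]≤j (ℤ.≰⇒> w≰z))) ⟩
      fromℤ w - x         ≤⟨ x≤x⊔y _ _ ⟩
      ∣ fromℤ w - x ∣     ≈⟨ ∣x-y∣≈∣y-x∣ (fromℤ w) x ⟩
      ∣ x - fromℤ w ∣     ∎)
    nearer : x - fromℤ z ≤ fromℤ z + 1# - x ⊎ fromℤ z + 1# - x ≤ x - fromℤ z →
             ∃ (IsNearestInteger x)
    nearer (inj₁ a≤b) = z , λ w → ≤-trans below ([ id , ≤-trans a≤b ]′ (distance w (w ℤ.≤? z)))
    nearer (inj₂ b≤a) = ℤ.suc z , λ w → ≤-trans above ([ ≤-trans b≤a , id ]′ (distance w (w ℤ.≤? z)))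

  nearest-integer-exists : ∀ x → ∃ (IsNearestInteger x)
  nearest-integer-exists x =
    floor-or-suc-nearest x (proj₁ (floor x)) (proj₁ (proj₂ (floor x))) (proj₂ (proj₂ (floor x)))

  chosen-nearest : ∀ x → IsNearestInteger x (choose 0ℤ (IsNearestInteger x))
  chosen-nearest x = choose-satisfies 0ℤ (IsNearestInteger x) (nearest-integer-exists x)

  ‖‖≤∣-∣ : ∀ x w → ‖ x ‖ ≤ ∣ x - fromℤ w ∣
  ‖‖≤∣-∣ x w = chosen-nearest x w

  -- Quantitative continuity of the power on [0, s], used to move away from the supremum in the
  -- construction of roots. The recursion for the constant comes from expanding (t + h)(t^n + h C)
  -- and bounding t by s and h by 1.
  ^-lipschitz : ∀ n {s} → 0# ≤ s → ∃[ C ] 0# ≤ C ×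
    (∀ {t h} → 0# ≤ t → t ≤ s → 0# ≤ h → h ≤ 1# → (t + h) ^ n ≤ t ^ n + h * C)
  ^-lipschitz zero    _   = 0# , ≤-refl , λ {_} {h} _ _ _ _ →
    ≤-reflexive (solve 2 (λ o h → o := o :+ h :* con 0ℤ) refl 1# h)
  ^-lipschitz (suc n) {s} 0≤s = s ^ n + (s + 1#) * C ,
    +-nonNeg (^-nonNeg n 0≤s) (*-nonNeg (+-nonNeg 0≤s (proj₁ 0<1)) 0≤C) ,
    λ {t} {h} 0≤t t≤s 0≤h h≤1 → begin
      (t + h) * (t + h) ^ n
        ≤⟨ *-monoˡ-≤ (+-nonNeg 0≤t 0≤h) (proj₂ (proj₂ (^-lipschitz n 0≤s)) 0≤t t≤s 0≤h h≤1) ⟩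
      (t + h) * (t ^ n + h * C)
        ≈⟨ solve 4 (λ t h p C → (t :+ h) :* (p :+ h :* C) := t :* p :+ h :* (p :+ (t :+ h) :* C)) refl t h (t ^ n) C ⟩
      t * t ^ n + h * (t ^ n + (t + h) * C)
        ≤⟨ +-mono-≤ ≤-refl (*-monoˡ-≤ 0≤h (+-mono-≤ (^-mono-≤ n 0≤t t≤s) (*-monoʳ-≤ 0≤C (+-mono-≤ t≤s h≤1)))) ⟩
      t * t ^ n + h * (s ^ n + (s + 1#) * C) ∎
    where
    C : ℝ
    C = proj₁ (^-lipschitz n 0≤s)
    0≤C : 0# ≤ C
    0≤C = proj₁ (proj₂ (^-lipschitz n 0≤s))

  -- The root is the supremum of the y ≥ 0 with y^n ≤ x, a set bounded by 1 + x. If s^n were below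
  -- x, some s + h would still lie in the set; if it were above x, some s - h would already be an
  -- upper bound.
  root-exists : ∀ n .{{_ : NonZero n}} {x} → 0# ≤ x → ∃ (IsRoot n x)
  root-exists n@(suc n-1) {x} 0≤x = s , 0≤s , ≤-antisym (≮⇒≥ ¬above) (≮⇒≥ ¬below)
    where
    below : Pred ℝ 0ℓ
    below y = 0# ≤ y × y ^ n ≤ x
    x≤[1+x]^n : x ≤ (1# + x) ^ n
    x≤[1+x]^n = begin
      x                  ≈⟨ +-identityˡ x ⟨
      0# + x             ≤⟨ +-monoˡ-≤ x (proj₁ 0<1) ⟩
      1# + x             ≈⟨ *-identityʳ _ ⟨
      (1# + x) * 1#      ≤⟨ *-monoˡ-≤ (+-nonNeg (proj₁ 0<1) 0≤x) (1≤x⇒1≤x^n n-1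
                              (≤-respˡ (+-identityʳ 1#) (+-mono-≤ ≤-refl 0≤x))) ⟩
      (1# + x) ^ n       ∎
    sup : ∃ (IsSupremum below)
    sup = complete below
      (0# , ≤-refl , ≤-respˡ (sym (zeroˡ _)) 0≤x)
      (1# + x , λ y (_ , yⁿ≤x) → ^-cancel-≤ n (+-nonNeg (proj₁ 0<1) 0≤x) (≤-trans yⁿ≤x x≤[1+x]^n))
    s : ℝ
    s = proj₁ sup
    0≤s : 0# ≤ s
    0≤s = proj₁ (proj₂ sup) 0# (≤-refl , ≤-respˡ (sym (zeroˡ _)) 0≤x)
    lipschitz = ^-lipschitz n 0≤s
    C : ℝ
    C = proj₁ lipschitz
    -- Dividing by C + e rather than by C makes h ≤ 1 and h C < e hold even
    -- when C is small or zero.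
    module Step {e} (0<e : 0# < e) where
      0<C+e : 0# < C + e
      0<C+e = <-respʳ (+-comm e C) (+-pos-nonNeg 0<e (proj₁ (proj₂ lipschitz)))
      h : ℝ
      h = e * (C + e) ⁻¹
      0<h : 0# < h
      0<h = *-pos 0<e (⁻¹-pos 0<C+e)
      h[C+e]≈e : h * (C + e) ≈ e
      h[C+e]≈e = x*y⁻¹*y≈x 0<C+e
      h≤1 : h ≤ 1#
      h≤1 = *-cancelʳ-≤ 0<C+e (begin
        h * (C + e)    ≈⟨ h[C+e]≈e ⟩
        e              ≈⟨ +-identityˡ e ⟨
        0# + e         ≤⟨ +-monoˡ-≤ e (proj₁ (proj₂ lipschitz)) ⟩
        C + e          ≈⟨ *-identityˡ _ ⟨
        1# * (C + e)   ∎)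
      hC<e : h * C < e
      hC<e = begin-strict
        h * C          ≈⟨ +-identityʳ _ ⟨
        h * C + 0#     <⟨ +-monoʳ-< (h * C) (*-pos 0<h 0<e) ⟩
        h * C + h * e  ≈⟨ solve 3 (λ h C e → h :* C :+ h :* e := h :* (C :+ e)) refl h C e ⟩
        h * (C + e)    ≈⟨ h[C+e]≈e ⟩
        e              ∎
    ¬below : ¬ s ^ n < x
    ¬below sⁿ<x = <⇒≱ s<s+h (proj₁ (proj₂ sup) (s + h)
      (≤-trans 0≤s (proj₁ s<s+h) , (begin
        (s + h) ^ n            ≤⟨ proj₂ (proj₂ lipschitz) 0≤s ≤-refl (proj₁ 0<h) h≤1 ⟩
        s ^ n + h * C          ≤⟨ +-mono-≤ ≤-refl (proj₁ hC<e) ⟩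
        s ^ n + (x - s ^ n)    ≈⟨ solve 2 (λ p x → p :+ (x :- p) := x) refl (s ^ n) x ⟩
        x                      ∎)))
      where
      open Step (difference-pos sⁿ<x)
      s<s+h : s < s + h
      s<s+h = <-by-difference (solve 2 (λ s h → h := s :+ h :- s) refl s h) 0<h
    ¬above : ¬ x < s ^ n
    ¬above x<sⁿ = <⇒≱ s-h<s (proj₂ (proj₂ sup) (s - h) s-h-bound)
      where
      open Step (difference-pos x<sⁿ)
      s-h<s : s - h < s
      s-h<s = <-by-difference (solve 2 (λ s h → h := s :- (s :- h)) refl s h) 0<h
      s-h-bound : IsUpperBound below (s - h)
      -- An element y of the set beyond s - h would give s^n ≤ (y + h)^n ≤ x + h C < s^n.
      s-h-bound y (0≤y , yⁿ≤x) = ≮⇒≥ λ s-h<y → <⇒≱ (begin-strict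
        s ^ n                  ≤⟨ ^-mono-≤ n 0≤s (≤-by-difference
                                    (solve 3 (λ s h y → y :- (s :- h) := y :+ h :- s) refl s h y)
                                    (difference-nonNeg (proj₁ s-h<y))) ⟩
        (y + h) ^ n            ≤⟨ proj₂ (proj₂ lipschitz) 0≤y (proj₁ (proj₂ sup) y (0≤y , yⁿ≤x)) (proj₁ 0<h) h≤1 ⟩
        y ^ n + h * C          ≤⟨ +-monoˡ-≤ (h * C) yⁿ≤x ⟩
        x + h * C              <⟨ +-monoʳ-< x hC<e ⟩
        x + (s ^ n - x)        ≈⟨ solve 2 (λ p x → x :+ (p :- x) := p) refl (s ^ n) x ⟩
        s ^ n                  ∎) ≤-refl

  module _ {x : ℝ} (0<x : 0# < x) where

    ^ℤ-pos : ∀ i → 0# < x ^ℤ i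
    ^ℤ-pos (+ n)    = ^-pos n 0<x
    ^ℤ-pos -[1+ n ] = ⁻¹-pos (^-pos (suc n) 0<x)

    ^ℤ-⊖ : ∀ a b → x ^ℤ (a ⊖ b) * x ^ b ≈ x ^ a
    ^ℤ-⊖ zero    zero    = *-identityˡ 1#
    ^ℤ-⊖ zero    (suc b) = trans (*-comm _ _) (⁻¹-inverseʳ (pos⇒≉0 (^-pos (suc b) 0<x)))
    ^ℤ-⊖ (suc a) zero    = *-identityʳ _
    ^ℤ-⊖ (suc a) (suc b) = begin-equality
      x ^ℤ (suc a ⊖ suc b) * (x * x ^ b)  ≡⟨ ≡.cong (λ i → x ^ℤ i * (x * x ^ b)) (ℤ.[1+m]⊖[1+n]≡m⊖n a b) ⟩
      x ^ℤ (a ⊖ b) * (x * x ^ b)          ≈⟨ solve 3 (λ p x q → p :* (x :* q) := x :* (p :* q)) refl _ x (x ^ b) ⟩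
      x * (x ^ℤ (a ⊖ b) * x ^ b)          ≈⟨ *-congˡ (^ℤ-⊖ a b) ⟩
      x * x ^ a                           ∎

    ^ℤ-homo-+ⁿ : ∀ i n → x ^ℤ (i ℤ.+ + n) ≈ x ^ℤ i * x ^ n
    ^ℤ-homo-+ⁿ (+ a)    n = ^-homo-* x a n
    ^ℤ-homo-+ⁿ -[1+ a ] n = begin-equality
      x ^ℤ (n ⊖ suc a)                                 ≈⟨ x*y*y⁻¹≈x (^-pos (suc a) 0<x) ⟨
      x ^ℤ (n ⊖ suc a) * x ^ suc a * (x ^ suc a) ⁻¹    ≈⟨ *-congʳ (^ℤ-⊖ n (suc a)) ⟩
      x ^ n * (x ^ suc a) ⁻¹                           ≈⟨ *-comm _ _ ⟩
      (x ^ suc a) ⁻¹ * x ^ n                           ∎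

    ^ℤ-homo-+ : ∀ i j → x ^ℤ (i ℤ.+ j) ≈ x ^ℤ i * x ^ℤ j
    ^ℤ-homo-+ i (+ n)    = ^ℤ-homo-+ⁿ i n
    ^ℤ-homo-+ i -[1+ n ] = begin-equality
      x ^ℤ (i ℤ.+ -[1+ n ])                                 ≈⟨ x*y*y⁻¹≈x (^-pos (suc n) 0<x) ⟨
      x ^ℤ (i ℤ.+ -[1+ n ]) * x ^ suc n * (x ^ suc n) ⁻¹    ≈⟨ *-congʳ (^ℤ-homo-+ⁿ (i ℤ.+ -[1+ n ]) (suc n)) ⟨
      x ^ℤ (i ℤ.+ -[1+ n ] ℤ.+ + suc n) * (x ^ suc n) ⁻¹    ≡⟨ ≡.cong (λ k → x ^ℤ k * (x ^ suc n) ⁻¹) i-n+n≡i ⟩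
      x ^ℤ i * (x ^ suc n) ⁻¹                               ∎
      where
      i-n+n≡i : i ℤ.+ -[1+ n ] ℤ.+ + suc n ≡ i
      i-n+n≡i = ≡.trans (ℤ.+-assoc i -[1+ n ] (+ suc n))
        (≡.trans (≡.cong (λ k → i ℤ.+ k) (ℤ.+-inverseˡ (+ suc n))) (ℤ.+-identityʳ i))

    ^ℤ-^ : ∀ i n → (x ^ℤ i) ^ n ≈ x ^ℤ (i ℤ.* + n)
    ^ℤ-^ i zero    = reflexive (≡.cong (x ^ℤ_) (≡.sym (ℤ.*-zeroʳ i)))
    ^ℤ-^ i (suc n) = begin-equality
      x ^ℤ i * (x ^ℤ i) ^ n           ≈⟨ *-congˡ (^ℤ-^ i n) ⟩
      x ^ℤ i * x ^ℤ (i ℤ.* + n)       ≈⟨ ^ℤ-homo-+ i (i ℤ.* + n) ⟨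
      x ^ℤ (i ℤ.+ i ℤ.* + n)          ≡⟨ ≡.cong (x ^ℤ_) (≡.sym (ℤ.*-suc i (+ n))) ⟩
      x ^ℤ (i ℤ.* + suc n)            ∎

    ^ℤ-neg : ∀ n → x ^ℤ (ℤ.- + n) * x ^ n ≈ 1#
    ^ℤ-neg n = trans (sym (^ℤ-homo-+ⁿ (ℤ.- + n) n)) (reflexive (≡.cong (x ^ℤ_) (ℤ.+-inverseˡ (+ n))))

    ^ℚ-root : ∀ r → IsRoot (↧ₙ r) (x ^ℤ (↥ r)) (x ^ℚ r)
    ^ℚ-root r = choose-satisfies 0# (IsRoot (↧ₙ r) (x ^ℤ (↥ r)))
      (root-exists (↧ₙ r) (proj₁ (^ℤ-pos (↥ r))))

    ^ℚ-^ : ∀ r → (x ^ℚ r) ^ ↧ₙ r ≈ x ^ℤ (↥ r)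
    ^ℚ-^ r = proj₂ (^ℚ-root r)

    ^ℚ-pos : ∀ r → 0# < x ^ℚ r
    ^ℚ-pos r = proj₁ (^ℚ-root r) , λ 0≈root → proj₂ (^ℤ-pos (↥ r)) (begin-equality
      0#                  ≈⟨ zeroˡ _ ⟨
      0# ^ ↧ₙ r           ≈⟨ ^-congˡ (↧ₙ r) 0≈root ⟩
      (x ^ℚ r) ^ ↧ₙ r     ≈⟨ ^ℚ-^ r ⟩
      x ^ℤ (↥ r)          ∎)

-- Logarithms as suprema of rational exponents

module Logarithm (em : ExcludedMiddle 0ℓ) (R : CompleteOrderedField) where

  open Reals em R
  open OrderedField em R
  open Powers em R
  open ≤-Reasoning

  -- An error `w` that does not grow with M is negligible against M (u - v) by the Archimedean
  -- property. This turns brackets of bounded width into the exact law `log-*`.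
  bounded-multiples : ∀ {u v w} → (∀ M .{{_ : NonZero M}} → fromℤ (+ M) * u ≤ fromℤ (+ M) * v + w) → u ≤ v
  bounded-multiples {u} {v} {w} bound = ≮⇒≥ λ v<u → contradict v<u (archimedean (w * (u - v) ⁻¹))
    where
    contradict : v < u → ∃[ n ] w * (u - v) ⁻¹ < fromℤ (+ n) → ⊥
    -- The multiplier is `suc n` instead of `n` so that it is nonzero.
    contradict v<u (n , wδ⁻¹<n) = <⇒≱ w<Mδ (≤-by-difference
        (solve 4 (λ M u v w → M :* v :+ w :- M :* u := w :- M :* (u :- v)) refl (fromℤ (+ suc n)) u v w)
        (difference-nonNeg (bound (suc n))))
      where
      0<δ : 0# < u - v
      0<δ = difference-pos v<u
      w<Mδ : w < fromℤ (+ suc n) * (u - v)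
      w<Mδ = begin-strict
        w                              ≈⟨ x*y⁻¹*y≈x 0<δ ⟨
        w * (u - v) ⁻¹ * (u - v)       <⟨ *-monoʳ-< 0<δ wδ⁻¹<n ⟩
        fromℤ (+ n) * (u - v)          ≤⟨ *-monoʳ-≤ (proj₁ 0<δ) (≤-respˡ (+-identityˡ _) (+-monoˡ-≤ _ (proj₁ 0<1))) ⟩
        fromℤ (+ suc n) * (u - v)      ∎

  module _ {d : ℝ} (1<d : 1# < d) where

    private
      0<d : 0# < d
      0<d = begin-strict 0# <⟨ 0<1 ⟩ 1# <⟨ 1<d ⟩ d ∎

    ^ℤ-mono-< : ∀ {i j} → i ℤ.< j → d ^ℤ i < d ^ℤ j
    ^ℤ-mono-< {i} {j} i<j = begin-strict
      d ^ℤ i                    ≈⟨ *-identityˡ _ ⟨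
      1# * d ^ℤ i               <⟨ *-monoʳ-< (^ℤ-pos 0<d i) 1<d ⟩
      d * d ^ℤ i                ≤⟨ *-monoʳ-≤ (proj₁ (^ℤ-pos 0<d i)) d≤dᵏ⁺¹ ⟩
      d ^ suc k * d ^ℤ i        ≈⟨ *-comm _ _ ⟩
      d ^ℤ i * d ^ suc k        ≈⟨ ^ℤ-homo-+ⁿ 0<d i (suc k) ⟨
      d ^ℤ (i ℤ.+ + suc k)      ≡⟨ ≡.cong (d ^ℤ_) i+k+1≡j ⟩
      d ^ℤ j                    ∎
      where
      k : ℕ
      k = ℤ.∣ j ℤ.- ℤ.suc i ∣
      d≤dᵏ⁺¹ : d ≤ d ^ suc k
      d≤dᵏ⁺¹ = ≤-respˡ (*-identityʳ d) (*-monoˡ-≤ (proj₁ 0<d) (1≤x⇒1≤x^n k (proj₁ 1<d)))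
      i+k+1≡j : i ℤ.+ + suc k ≡ j
      i+k+1≡j = ≡.trans (≡.cong (λ l → i ℤ.+ (1ℤ ℤ.+ l)) (ℤ.0≤i⇒+∣i∣≡i (ℤ.i≤j⇒0≤j-i (ℤ.i<j⇒suc[i]≤j i<j))))
        (ℤ-solve i j)
        where
        ℤ-solve : ∀ i j → i ℤ.+ (1ℤ ℤ.+ (j ℤ.- (1ℤ ℤ.+ i))) ≡ j
        ℤ-solve = solve-∀

    ^ℤ-cancel-≤ : ∀ {i j} → d ^ℤ i ≤ d ^ℤ j → i ℤ.≤ j
    ^ℤ-cancel-≤ dⁱ≤dʲ = ℤ.≮⇒≥ λ j<i → <⇒≱ (^ℤ-mono-< j<i) dⁱ≤dʲ

    -- In effect the integer part of the logarithm. It shows that the set whose supremum defines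
    -- `log` is nonempty and bounded, and it supplies the brackets for `log-*`.
    power-bracket : ∀ {x} → 0# < x → ∃[ p ] d ^ℤ p ≤ x × x ≤ d ^ℤ (ℤ.suc p)
    power-bracket {x} 0<x = search (last-before-failure {P = λ k → d ^ℤ (+ k ℤ.- + N) ≤ x} low M high)
      where
      N M : ℕ
      N = proj₁ (powers-unbounded 1<d (x ⁻¹))
      M = proj₁ (powers-unbounded 1<d (x * d ^ N))
      shift : ∀ k → d ^ℤ (+ k ℤ.- + N) * d ^ N ≈ d ^ k
      shift k = trans (sym (^ℤ-homo-+ⁿ 0<d (+ k ℤ.- + N) N)) (reflexive (≡.cong (d ^ℤ_)
        (≡.trans (ℤ.+-assoc (+ k) (ℤ.- + N) (+ N))
          (≡.trans (≡.cong (λ l → + k ℤ.+ l) (ℤ.+-inverseˡ (+ N))) (ℤ.+-identityʳ (+ k))))))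
      low : d ^ℤ (+ 0 ℤ.- + N) ≤ x
      low = *-cancelʳ-≤ (^-pos N 0<d) (begin
        d ^ℤ (+ 0 ℤ.- + N) * d ^ N    ≈⟨ shift 0 ⟩
        1#                            ≈⟨ ⁻¹-inverseʳ (pos⇒≉0 0<x) ⟨
        x * x ⁻¹                      ≤⟨ *-monoˡ-≤ (proj₁ 0<x) (proj₁ (proj₂ (powers-unbounded 1<d (x ⁻¹)))) ⟩
        x * d ^ N                     ∎)
      high : ¬ d ^ℤ (+ M ℤ.- + N) ≤ x
      high p≤x = <⇒≱ (proj₂ (powers-unbounded 1<d (x * d ^ N))) (begin
        d ^ M                         ≈⟨ shift M ⟨
        d ^ℤ (+ M ℤ.- + N) * d ^ N    ≤⟨ *-monoʳ-≤ (proj₁ (^-pos N 0<d)) p≤x ⟩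
        x * d ^ N                     ∎)
      search : (∃[ k ] d ^ℤ (+ k ℤ.- + N) ≤ x × ¬ d ^ℤ (+ suc k ℤ.- + N) ≤ x) →
               ∃[ p ] d ^ℤ p ≤ x × x ≤ d ^ℤ (ℤ.suc p)
      search (k , p≤x , p+1≰x) = + k ℤ.- + N , p≤x , ≤-respʳ
        (reflexive (≡.cong (d ^ℤ_) (ℤ.+-assoc 1ℤ (+ k) (ℤ.- + N)))) (proj₁ (≰⇒> p+1≰x))

    ExponentBelow : ℝ → Pred ℝ 0ℓ
    ExponentBelow x y = ∃[ r ] y ≈ fromℚ r × d ^ℚ r ≤ x

    ratio-below : ∀ {x} p M .{{_ : NonZero M}} → 0# < x → d ^ℤ p ≤ x ^ M →
                  ExponentBelow x (fromℚ (p ℚ./ M))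
    ratio-below {x} p (suc M-1) 0<x dᵖ≤xᴹ = p ℚ./ suc M-1 , refl ,
      ^-cancel-≤ (suc M-1) (proj₁ 0<x) (≤-respˡ (sym (^ℚ-^ 0<d (p ℚ./ suc M-1))) dᵖ≤xᴹ)

    -- With r = a/b, raising d^r ≤ x to the power b M and x^M ≤ d^q to the power b gives d^(a M) ≤
    -- d^(q b); exponents can then be compared as integers.
    ratio-above : ∀ {x} q M → 0# < x → x ^ M ≤ d ^ℤ q →
                  ∀ y → ExponentBelow x y → fromℤ (+ M) * y ≤ fromℤ q
    ratio-above {x} q M 0<x xᴹ≤d^q y (r , y≈r , dʳ≤x) = *-cancelʳ-≤ 0<b (begin
      fromℤ (+ M) * y * fromℤ (↧ r)                            ≈⟨ *-congʳ (*-congˡ y≈r) ⟩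
      fromℤ (+ M) * (fromℤ (↥ r) * fromℤ (↧ r) ⁻¹) * fromℤ (↧ r) ≈⟨ *-assoc _ _ _ ⟩
      fromℤ (+ M) * (fromℤ (↥ r) * fromℤ (↧ r) ⁻¹ * fromℤ (↧ r)) ≈⟨ *-congˡ (x*y⁻¹*y≈x 0<b) ⟩
      fromℤ (+ M) * fromℤ (↥ r)                                ≈⟨ *-comm _ _ ⟩
      fromℤ (↥ r) * fromℤ (+ M)                                ≈⟨ fromℤ-* (↥ r) (+ M) ⟨
      fromℤ (↥ r ℤ.* + M)                                      ≤⟨ fromℤ-mono-≤ aM≤qb ⟩
      fromℤ (q ℤ.* ↧ r)                                        ≈⟨ fromℤ-* q (↧ r) ⟩
      fromℤ q * fromℤ (↧ r)                                    ∎)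
      where
      b : ℕ
      b = ↧ₙ r
      0<b : 0# < fromℤ (↧ r)
      0<b = fromℤ-pos b
      aM≤qb : ↥ r ℤ.* + M ℤ.≤ q ℤ.* ↧ r
      aM≤qb = ^ℤ-cancel-≤ (begin
        d ^ℤ (↥ r ℤ.* + M)     ≈⟨ ^ℤ-^ 0<d (↥ r) M ⟨
        (d ^ℤ ↥ r) ^ M         ≈⟨ ^-congˡ M (^ℚ-^ 0<d r) ⟨
        ((d ^ℚ r) ^ b) ^ M     ≤⟨ ^-mono-≤ M (^-nonNeg b 0≤dʳ) (^-mono-≤ b 0≤dʳ dʳ≤x) ⟩
        (x ^ b) ^ M            ≈⟨ ^-assocʳ x b M ⟩
        x ^ (b ℕ.* M)          ≡⟨ ≡.cong (x ^_) (ℕ.*-comm b M) ⟩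
        x ^ (M ℕ.* b)          ≈⟨ ^-assocʳ x M b ⟨
        (x ^ M) ^ b            ≤⟨ ^-mono-≤ b (^-nonNeg M (proj₁ 0<x)) xᴹ≤d^q ⟩
        (d ^ℤ q) ^ b           ≈⟨ ^ℤ-^ 0<d q b ⟩
        d ^ℤ (q ℤ.* + b)       ∎)
        where
        0≤dʳ : 0# ≤ d ^ℚ r
        0≤dʳ = proj₁ (^ℚ-pos 0<d r)

    private
      sup-exists : ∀ {x} → 0# < x → ∃ (IsSupremum (ExponentBelow x))
      sup-exists {x} 0<x = complete (ExponentBelow x)
        (fromℚ (p ℚ./ 1) , ratio-below p 1 0<x (≤-respʳ (sym (*-identityʳ x)) (proj₁ (proj₂ (power-bracket 0<x)))))
        (fromℤ (ℤ.suc p) , λ y y∈ → ≤-respˡ 1*y≈y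
          (ratio-above (ℤ.suc p) 1 0<x (≤-respˡ (sym (*-identityʳ x)) (proj₂ (proj₂ (power-bracket 0<x)))) y y∈))
        where
        p : ℤ
        p = proj₁ (power-bracket 0<x)
        1*y≈y : ∀ {y} → fromℤ (+ 1) * y ≈ y
        1*y≈y = trans (*-congʳ (+-identityʳ 1#)) (*-identityˡ _)

    log-isSupremum : ∀ {x} → 0# < x → IsSupremum (ExponentBelow x) (log d x)
    log-isSupremum {x} 0<x = choose-satisfies 0# (IsSupremum (ExponentBelow x)) (sup-exists 0<x)

    log-lower : ∀ {x} p M .{{_ : NonZero M}} → 0# < x → d ^ℤ p ≤ x ^ M →
                fromℤ p ≤ fromℤ (+ M) * log d x
    log-lower {x} p M@(suc _) 0<x dᵖ≤xᴹ = begin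
      fromℤ p                              ≈⟨ x*y⁻¹*y≈x (fromℤ-pos M) ⟨
      fromℚ (p ℚ./ M) * fromℤ (+ M)        ≤⟨ *-monoʳ-≤ (fromℤ-nonNeg M)
                                                (proj₁ (log-isSupremum 0<x) _ (ratio-below p M 0<x dᵖ≤xᴹ)) ⟩
      log d x * fromℤ (+ M)                ≈⟨ *-comm _ _ ⟩
      fromℤ (+ M) * log d x                ∎

    log-upper : ∀ {x} q M .{{_ : NonZero M}} → 0# < x → x ^ M ≤ d ^ℤ q →
                fromℤ (+ M) * log d x ≤ fromℤ q
    log-upper {x} q M 0<x xᴹ≤d^q = begin
      fromℤ (+ M) * log d x                       ≤⟨ *-monoˡ-≤ (fromℤ-nonNeg M)
                                                       (proj₂ (log-isSupremum 0<x) (fromℤ q * fromℤ (+ M) ⁻¹) bound) ⟩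
      fromℤ (+ M) * (fromℤ q * fromℤ (+ M) ⁻¹)    ≈⟨ *-comm _ _ ⟩
      fromℤ q * fromℤ (+ M) ⁻¹ * fromℤ (+ M)      ≈⟨ x*y⁻¹*y≈x (fromℤ-pos M) ⟩
      fromℤ q                                     ∎
      where
      bound : IsUpperBound (ExponentBelow x) (fromℤ q * fromℤ (+ M) ⁻¹)
      bound y y∈ = *-cancelʳ-≤ (fromℤ-pos M) (begin
        y * fromℤ (+ M)                           ≈⟨ *-comm _ _ ⟩
        fromℤ (+ M) * y                           ≤⟨ ratio-above q M 0<x xᴹ≤d^q y y∈ ⟩
        fromℤ q                                   ≈⟨ x*y⁻¹*y≈x (fromℤ-pos M) ⟨
        fromℤ q * fromℤ (+ M) ⁻¹ * fromℤ (+ M)    ∎)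

    log-base : log d d ≈ 1#
    log-base = ≤-antisym
      (≤-respˡ (1*≈ _) (≤-respʳ (+-identityʳ 1#) (log-upper 1ℤ 1 0<d ≤-refl)))
      (≤-respʳ (1*≈ _) (≤-respˡ (+-identityʳ 1#) (log-lower 1ℤ 1 0<d ≤-refl)))
      where
      1*≈ : ∀ y → fromℤ (+ 1) * y ≈ y
      1*≈ y = trans (*-congʳ (+-identityʳ 1#)) (*-identityˡ y)

    log-mono-≤ : ∀ {x y} → 0# < x → x ≤ y → log d x ≤ log d y
    log-mono-≤ {x} {y} 0<x x≤y = proj₂ (log-isSupremum 0<x) (log d y)
      λ { z (r , z≈r , dʳ≤x) → proj₁ (log-isSupremum 0<y) z (r , z≈r , ≤-trans dʳ≤x x≤y) }
      where
      0<y : 0# < y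
      0<y = begin-strict 0# <⟨ 0<x ⟩ x ≤⟨ x≤y ⟩ y ∎

    log-cong : ∀ {x y} → 0# < x → x ≈ y → log d x ≈ log d y
    log-cong 0<x x≈y = ≤-antisym (log-mono-≤ 0<x (≤-reflexive x≈y))
      (log-mono-≤ (<-respʳ x≈y 0<x) (≤-reflexive (sym x≈y)))

    -- With dᵖ ≤ xᴹ ≤ dᵖ⁺¹ and d^q ≤ yᴹ ≤ d^(q+1), both M log (x y) and
    -- M (log x + log y) lie in [p + q, p + q + 2].
    log-* : ∀ {x y} → 0# < x → 0# < y → log d (x * y) ≈ log d x + log d y
    log-* {x} {y} 0<x 0<y = ≤-antisym
      (bounded-multiples {w = fromℤ (+ 2)} λ M → upper M (power-bracket (^-pos M 0<x)) (power-bracket (^-pos M 0<y)))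
      (bounded-multiples {w = fromℤ (+ 2)} λ M → lower M (power-bracket (^-pos M 0<x)) (power-bracket (^-pos M 0<y)))
      where
      0<xy : 0# < x * y
      0<xy = *-pos 0<x 0<y
      Bracket : ℝ → Set
      Bracket z = ∃[ p ] d ^ℤ p ≤ z × z ≤ d ^ℤ (ℤ.suc p)
      exponents : ∀ p q → (1ℤ ℤ.+ p) ℤ.+ (1ℤ ℤ.+ q) ≡ p ℤ.+ q ℤ.+ + 2
      exponents = solve-∀
      upper : ∀ M .{{_ : NonZero M}} → Bracket (x ^ M) → Bracket (y ^ M) →
              fromℤ (+ M) * log d (x * y) ≤ fromℤ (+ M) * (log d x + log d y) + fromℤ (+ 2)
      upper M (p , dᵖ≤ , ≤dᵖ⁺¹) (q , d^q≤ , ≤d^q⁺¹) = begin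
        fromℤ (+ M) * log d (x * y)         ≤⟨ log-upper (ℤ.suc p ℤ.+ ℤ.suc q) M 0<xy [xy]ᴹ≤ ⟩
        fromℤ (ℤ.suc p ℤ.+ ℤ.suc q)         ≡⟨ ≡.cong fromℤ (exponents p q) ⟩
        fromℤ (p ℤ.+ q ℤ.+ + 2)             ≈⟨ fromℤ-+ (p ℤ.+ q) (+ 2) ⟩
        fromℤ (p ℤ.+ q) + fromℤ (+ 2)       ≈⟨ +-congʳ (fromℤ-+ p q) ⟩
        fromℤ p + fromℤ q + fromℤ (+ 2)     ≤⟨ +-monoˡ-≤ _ (+-mono-≤ (log-lower p M 0<x dᵖ≤) (log-lower q M 0<y d^q≤)) ⟩
        fromℤ (+ M) * log d x + fromℤ (+ M) * log d y + fromℤ (+ 2)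
                                            ≈⟨ +-congʳ (distribˡ _ _ _) ⟨
        fromℤ (+ M) * (log d x + log d y) + fromℤ (+ 2) ∎
        where
        [xy]ᴹ≤ : (x * y) ^ M ≤ d ^ℤ (ℤ.suc p ℤ.+ ℤ.suc q)
        [xy]ᴹ≤ = begin
          (x * y) ^ M                       ≈⟨ ^-distrib-* x y M ⟩
          x ^ M * y ^ M                     ≤⟨ *-mono-≤ (proj₁ (^ℤ-pos 0<d (ℤ.suc p))) (proj₁ (^-pos M 0<y)) ≤dᵖ⁺¹ ≤d^q⁺¹ ⟩
          d ^ℤ ℤ.suc p * d ^ℤ ℤ.suc q       ≈⟨ ^ℤ-homo-+ 0<d (ℤ.suc p) (ℤ.suc q) ⟨
          d ^ℤ (ℤ.suc p ℤ.+ ℤ.suc q)        ∎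
      lower : ∀ M .{{_ : NonZero M}} → Bracket (x ^ M) → Bracket (y ^ M) →
              fromℤ (+ M) * (log d x + log d y) ≤ fromℤ (+ M) * log d (x * y) + fromℤ (+ 2)
      lower M (p , dᵖ≤ , ≤dᵖ⁺¹) (q , d^q≤ , ≤d^q⁺¹) = begin
        fromℤ (+ M) * (log d x + log d y)   ≈⟨ distribˡ _ _ _ ⟩
        fromℤ (+ M) * log d x + fromℤ (+ M) * log d y
                                            ≤⟨ +-mono-≤ (log-upper (ℤ.suc p) M 0<x ≤dᵖ⁺¹) (log-upper (ℤ.suc q) M 0<y ≤d^q⁺¹) ⟩
        fromℤ (ℤ.suc p) + fromℤ (ℤ.suc q)   ≈⟨ fromℤ-+ (ℤ.suc p) (ℤ.suc q) ⟨
        fromℤ (ℤ.suc p ℤ.+ ℤ.suc q)         ≡⟨ ≡.cong fromℤ (exponents p q) ⟩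
        fromℤ (p ℤ.+ q ℤ.+ + 2)             ≈⟨ fromℤ-+ (p ℤ.+ q) (+ 2) ⟩
        fromℤ (p ℤ.+ q) + fromℤ (+ 2)       ≤⟨ +-monoˡ-≤ _ (log-lower (p ℤ.+ q) M 0<xy ≤[xy]ᴹ) ⟩
        fromℤ (+ M) * log d (x * y) + fromℤ (+ 2) ∎
        where
        ≤[xy]ᴹ : d ^ℤ (p ℤ.+ q) ≤ (x * y) ^ M
        ≤[xy]ᴹ = begin
          d ^ℤ (p ℤ.+ q)                    ≈⟨ ^ℤ-homo-+ 0<d p q ⟩
          d ^ℤ p * d ^ℤ q                   ≤⟨ *-mono-≤ (proj₁ (^-pos M 0<x)) (proj₁ (^ℤ-pos 0<d q)) dᵖ≤ d^q≤ ⟩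
          x ^ M * y ^ M                     ≈⟨ ^-distrib-* x y M ⟨
          (x * y) ^ M                       ∎

    log-one : log d 1# ≈ 0#
    log-one = begin-equality
      log d 1#                          ≈⟨ solve 1 (λ l → l := l :+ l :- l) refl _ ⟩
      log d 1# + log d 1# - log d 1#    ≈⟨ +-congʳ (log-* 0<1 0<1) ⟨
      log d (1# * 1#) - log d 1#        ≈⟨ +-congʳ (log-cong (*-pos 0<1 0<1) (*-identityˡ 1#)) ⟩
      log d 1# - log d 1#               ≈⟨ -‿inverseʳ _ ⟩
      0#                                ∎

    log-^ : ∀ {x} n → 0# < x → log d (x ^ n) ≈ fromℤ (+ n) * log d x
    log-^ {x} zero    0<x = trans log-one (sym (zeroˡ _))
    log-^ {x} (suc n) 0<x = begin-equality
      log d (x * x ^ n)                       ≈⟨ log-* 0<x (^-pos n 0<x) ⟩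
      log d x + log d (x ^ n)                 ≈⟨ +-congˡ (log-^ n 0<x) ⟩
      log d x + fromℤ (+ n) * log d x         ≈⟨ +-congʳ (*-identityˡ _) ⟨
      1# * log d x + fromℤ (+ n) * log d x    ≈⟨ distribʳ _ _ _ ⟨
      fromℤ (+ suc n) * log d x               ∎

-- Gram-Schmidt orthogonalisation and lattice determinants

module GramSchmidtProperties (em : ExcludedMiddle 0ℓ) (R : CompleteOrderedField) where

  open Reals em R
  open OrderedField em R
  open ≤-Reasoning
  open Determinant commutativeRing
    using (det; _⊗_; det-⊗; ⋀-cong; ⋀-closed; det-upperTriangular; det-lowerTriangular; product)

  ⟨⟩-comm : ∀ {n} (u v : Vector ℝ n) → ⟨ u , v ⟩ ≈ ⟨ v , u ⟩
  ⟨⟩-comm u v = sum-cong-≋ λ i → *-comm (u i) (v i)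

  ⟨⟩-congˡ : ∀ {n} {u v : Vector ℝ n} w → (∀ i → u i ≈ v i) → ⟨ u , w ⟩ ≈ ⟨ v , w ⟩
  ⟨⟩-congˡ w u≈v = sum-cong-≋ λ i → *-congʳ (u≈v i)

  ⟨⟩-+ˡ : ∀ {n} (u v w : Vector ℝ n) → ⟨ (λ i → u i + v i) , w ⟩ ≈ ⟨ u , w ⟩ + ⟨ v , w ⟩
  ⟨⟩-+ˡ u v w = trans (sum-cong-≋ λ i → distribʳ (w i) (u i) (v i)) (∑-distrib-+ (λ i → u i * w i) (λ i → v i * w i))

  ⟨⟩-scaleˡ : ∀ {n} a (u w : Vector ℝ n) → ⟨ (λ i → a * u i) , w ⟩ ≈ a * ⟨ u , w ⟩
  ⟨⟩-scaleˡ a u w = trans (sum-cong-≋ λ i → *-assoc a (u i) (w i)) (sym (*-distribˡ-sum a (λ i → u i * w i)))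

  ⟨⟩-sumˡ : ∀ {k n} (a : Vector ℝ k) (V : Vector (Vector ℝ n) k) w →
            ⟨ (λ c → sum λ l → a l * V l c) , w ⟩ ≈ sum λ l → a l * ⟨ V l , w ⟩
  ⟨⟩-sumˡ a V w = begin-equality
    sum (λ c → sum (λ l → a l * V l c) * w c)      ≈⟨ sum-cong-≋ (λ c → *-distribʳ-sum (w c) (λ l → a l * V l c)) ⟩
    sum (λ c → sum (λ l → a l * V l c * w c))      ≈⟨ ∑-comm (λ c l → a l * V l c * w c) ⟩
    sum (λ l → sum (λ c → a l * V l c * w c))      ≈⟨ sum-cong-≋ (λ l → ⟨⟩-scaleˡ (a l) (V l) w) ⟩
    sum (λ l → a l * ⟨ V l , w ⟩)                  ∎

  ∣∣²-nonNeg : ∀ {n} (v : Vector ℝ n) → 0# ≤ ∣ v ∣²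
  ∣∣²-nonNeg v = sum-nonNeg λ i → square-nonNeg (v i)

  ∣∣²≈0⇒⊥ : ∀ {n} (u v : Vector ℝ n) → ∣ v ∣² ≈ 0# → ⟨ u , v ⟩ ≈ 0#
  ∣∣²≈0⇒⊥ {n} u v ∣v∣²≈0 = trans (sum-cong-≋ λ i → trans (*-congˡ (vᵢ≈0 i)) (zeroʳ (u i))) (sum-replicate-zero n)
    where
    vᵢ≈0 : ∀ i → v i ≈ 0#
    vᵢ≈0 i = square≈0⇒≈0 (≤-antisym
      (≤-respʳ ∣v∣²≈0 (term≤sum (λ i → square-nonNeg (v i)) i)) (square-nonNeg (v i)))

  sum-single : ∀ {n} (f : Vector ℝ n) i → (∀ j → j ≢ i → f j ≈ 0#) → sum f ≈ f i
  sum-single {suc n} f Fin.zero f≈0 =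
    trans (+-congˡ (trans (sum-cong-≋ λ j → f≈0 (Fin.suc j) λ ()) (sum-replicate-zero n))) (+-identityʳ _)
  sum-single {suc n} f (Fin.suc i) f≈0 =
    trans (+-cong (f≈0 Fin.zero λ ()) (sum-single (f ∘ Fin.suc) i λ j j≢i → f≈0 (Fin.suc j) (j≢i ∘ Fin.suc-injective)))
          (+-identityˡ _)

  -- Bridges the sum over smaller indices in the Gram-Schmidt recursion and a full row of a matrix
  -- product whose entries vanish beyond `i`.
  sum-inject : ∀ {n} (f : Vector ℝ n) i → (∀ j → i Fin.< j → f j ≈ 0#) →
               sum f ≈ f i + sum {toℕ i} (λ j → f (inject j))
  sum-inject {suc n} f Fin.zero    f≈0 =
    +-congˡ (trans (sum-cong-≋ λ j → f≈0 (Fin.suc j) ℕ.z<s) (sum-replicate-zero n))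
  sum-inject {suc n} f (Fin.suc i) f≈0 = begin-equality
    f₀ + sum (f ∘ Fin.suc)    ≈⟨ +-congˡ (sum-inject (f ∘ Fin.suc) i (λ j i<j → f≈0 (Fin.suc j) (ℕ.s<s i<j))) ⟩
    f₀ + (fᵢ + rest)          ≈⟨ solve 3 (λ a b c → a :+ (b :+ c) := b :+ (a :+ c)) refl f₀ fᵢ rest ⟩
    fᵢ + (f₀ + rest)          ∎
    where
    f₀ fᵢ rest : ℝ
    f₀ = f Fin.zero
    fᵢ = f (Fin.suc i)
    rest = sum {toℕ i} (λ j → f (Fin.suc (inject j)))

  product-nonNeg : ∀ {n} {v : Vector ℝ n} → (∀ i → 0# ≤ v i) → 0# ≤ product v
  product-nonNeg {zero}  0≤v = proj₁ 0<1
  product-nonNeg {suc n} 0≤v = *-nonNeg (0≤v Fin.zero) (product-nonNeg (0≤v ∘ Fin.suc))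

  product-const : ∀ {n} {v : Vector ℝ n} {a} → (∀ i → v i ≈ a) → product v ≈ a ^ n
  product-const {zero}  v≈a = refl
  product-const {suc n} v≈a = *-cong (v≈a Fin.zero) (product-const (v≈a ∘ Fin.suc))

  1^n≈1 : ∀ n → 1# ^ n ≈ 1#
  1^n≈1 zero    = refl
  1^n≈1 (suc n) = trans (*-identityˡ _) (1^n≈1 n)

  IsInteger : Pred ℝ 0ℓ
  IsInteger x = ∃[ z ] x ≈ fromℤ z

  det-integer : ∀ {n} (Z : Fin n → Fin n → ℤ) → IsInteger (det λ i j → fromℤ (Z i j))
  det-integer Z = ⋀-closed IsInteger (0ℤ , refl) (1ℤ , sym (+-identityʳ 1#))
    (λ { (i , x≈i) (j , y≈j) → i ℤ.- j ,
         trans (+-cong x≈i (trans (-‿cong y≈j) (sym (fromℤ-neg j)))) (sym (fromℤ-+ i (ℤ.- j))) })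
    (λ { (i , x≈i) (j , y≈j) → i ℤ.* j , trans (*-cong x≈i y≈j) (sym (fromℤ-* i j)) })
    (λ i j → fromℤ (Z i j)) (λ i j → Z i j , refl) _

  module _ {N} {b : Vector (Vector ℝ N) N} (gramSchmidt : GramSchmidt b) where

    open GramSchmidt gramSchmidt

    b-expansion : ∀ i c → b i c ≈ b* i c + sum {toℕ i} (λ j → μ i (inject j) * b* (inject j) c)
    b-expansion i c = trans (solve 2 (λ x s → x := x :- s :+ s) refl (b i c) _) (+-congʳ (sym (b*-recursion i c)))

    -- If `∣ b* j ∣²` vanishes, `μ i j` contains the unspecified inverse of zero; the identity
    -- survives because `b* j` is then the zero vector and both sides are zero.
    μ-projection : ∀ i j → μ i j * ∣ b* j ∣² ≈ ⟨ b i , b* j ⟩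
    μ-projection i j with em {∣ b* j ∣² ≈ 0#}
    ... | yes ∣b*∣²≈0 = trans (trans (*-congˡ ∣b*∣²≈0) (zeroʳ _)) (sym (∣∣²≈0⇒⊥ (b i) (b* j) ∣b*∣²≈0))
    ... | no  ∣b*∣²≉0 = trans (*-assoc _ _ _)
      (trans (*-congˡ (trans (*-comm _ _) (⁻¹-inverseʳ ∣b*∣²≉0))) (*-identityʳ _))

    private
      -- Induction on a bound for the larger index. Pairing the expansion of `b i` with `b* j`, the
      -- terms with l ≠ j vanish by induction, applied to (j, l) or (l, j) according to their order,
      -- and the term l = j is all of `⟨ b i , b* j ⟩` by projection; so nothing remains for
      -- `⟨ b* i , b* j ⟩`.
      orthogonal-below : ∀ k i j → toℕ i ℕ.< k → j Fin.< i → ⟨ b* i , b* j ⟩ ≈ 0#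
      orthogonal-below (suc k) i j i<1+k j<i = begin-equality
        ⟨ b* i , w ⟩                                  ≈⟨ solve 2 (λ x y → x := x :+ y :- y) refl _ ⟨ b i , w ⟩ ⟩
        ⟨ b* i , w ⟩ + ⟨ b i , w ⟩ - ⟨ b i , w ⟩      ≈⟨ +-congʳ (+-congˡ projections) ⟨
        ⟨ b* i , w ⟩ + sum terms - ⟨ b i , w ⟩        ≈⟨ +-congʳ expansion ⟨
        ⟨ b i , w ⟩ - ⟨ b i , w ⟩                     ≈⟨ -‿inverseʳ _ ⟩
        0#                                            ∎
        where
        w : Vector ℝ N
        w = b* j
        terms : Vector ℝ (toℕ i)
        terms l = μ i (inject l) * ⟨ b* (inject l) , w ⟩
        expansion : ⟨ b i , w ⟩ ≈ ⟨ b* i , w ⟩ + sum terms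
        expansion = trans (⟨⟩-congˡ w (b-expansion i))
          (trans (⟨⟩-+ˡ (b* i) (λ c → sum {toℕ i} λ l → μ i (inject l) * b* (inject l) c) w)
                 (+-congˡ (⟨⟩-sumˡ {toℕ i} (λ l → μ i (inject l)) (λ l → b* (inject l)) w)))
        j′ : Fin (toℕ i)
        j′ = fromℕ< j<i
        inject-j′ : inject j′ ≡ j
        inject-j′ = Fin.toℕ-injective (≡.trans (Fin.toℕ-inject j′) (Fin.toℕ-fromℕ< j<i))
        inject<i : ∀ (l : Fin (toℕ i)) → inject l Fin.< i
        inject<i l = ≡.subst (ℕ._< toℕ i) (≡.sym (Fin.toℕ-inject l)) (Fin.toℕ<n l)
        other : ∀ l → Tri (inject l Fin.< j) (inject l ≡ j) (j Fin.< inject l) → l ≢ j′ → terms l ≈ 0#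
        other l (tri< l<j _ _) _ = trans (*-congˡ (trans (⟨⟩-comm (b* (inject l)) w)
          (orthogonal-below k j (inject l) (ℕ.<-≤-trans j<i (ℕ.s≤s⁻¹ i<1+k)) l<j))) (zeroʳ _)
        other l (tri≈ _ l≡j _) l≢j′ = contradiction
          (Fin.toℕ-injective (≡.trans (≡.sym (Fin.toℕ-inject l))
            (≡.trans (≡.cong toℕ l≡j) (≡.sym (Fin.toℕ-fromℕ< j<i))))) l≢j′
        other l (tri> _ _ j<l) _ = trans (*-congˡ
          (orthogonal-below k (inject l) j (ℕ.<-≤-trans (inject<i l) (ℕ.s≤s⁻¹ i<1+k)) j<l)) (zeroʳ _)
        projections : sum terms ≈ ⟨ b i , w ⟩
        projections = begin-equality
          sum terms                                   ≈⟨ sum-single terms j′ (λ l → other l (Fin.<-cmp (inject l) j)) ⟩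
          terms j′                                    ≡⟨ ≡.cong (λ l → μ i l * ⟨ b* l , w ⟩) inject-j′ ⟩
          μ i j * ∣ w ∣²                              ≈⟨ μ-projection i j ⟩
          ⟨ b i , w ⟩                                 ∎

    b*-orthogonal : ∀ i j → j Fin.< i → ⟨ b* i , b* j ⟩ ≈ 0#
    b*-orthogonal i j = orthogonal-below (suc (toℕ i)) i j (ℕ.n<1+n (toℕ i))

    private
      -- Entries of the matrix U with b = U b*. The comparison is an argument so that the lemmas
      -- below can split on it.
      coefficient : ∀ i j → Tri (j Fin.< i) (j ≡ i) (i Fin.< j) → ℝ
      coefficient i j (tri< _ _ _) = μ i j
      coefficient i j (tri≈ _ _ _) = 1#
      coefficient i j (tri> _ _ _) = 0#

      coefficient-< : ∀ i j t → j Fin.< i → coefficient i j t ≡ μ i j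
      coefficient-< i j (tri< _ _ _)   _   = ≡.refl
      coefficient-< i j (tri≈ j≮i _ _) j<i = contradiction j<i j≮i
      coefficient-< i j (tri> j≮i _ _) j<i = contradiction j<i j≮i

      coefficient-≡ : ∀ i t → coefficient i i t ≡ 1#
      coefficient-≡ i (tri< _ i≢i _) = contradiction ≡.refl i≢i
      coefficient-≡ i (tri≈ _ _ _)   = ≡.refl
      coefficient-≡ i (tri> _ i≢i _) = contradiction ≡.refl i≢i

      coefficient-> : ∀ i j t → i Fin.< j → coefficient i j t ≡ 0#
      coefficient-> i j (tri< _ _ i≮j) i<j = contradiction i<j i≮j
      coefficient-> i j (tri≈ _ _ i≮j) i<j = contradiction i<j i≮j
      coefficient-> i j (tri> _ _ _)   _   = ≡.refl

      unitriangular : Fin N → Fin N → ℝ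
      unitriangular i j = coefficient i j (Fin.<-cmp j i)

      unitriangular-≡ : ∀ i → unitriangular i i ≈ 1#
      unitriangular-≡ i = reflexive (coefficient-≡ i (Fin.<-cmp i i))

      unitriangular-> : ∀ i j → i Fin.< j → unitriangular i j ≈ 0#
      unitriangular-> i j i<j = reflexive (coefficient-> i j (Fin.<-cmp j i) i<j)

      b≈unitriangular⊗b* : ∀ i c → b i c ≈ (unitriangular ⊗ b*) i c
      b≈unitriangular⊗b* i c = begin-equality
        b i c                                                             ≈⟨ b-expansion i c ⟩
        b* i c + sum {toℕ i} (λ j → μ i (inject j) * b* (inject j) c)
          ≈⟨ +-cong (trans (*-congʳ (unitriangular-≡ i)) (*-identityˡ _))
               (sum-cong-≋ λ j → *-congʳ (reflexive (coefficient-< i (inject j) (Fin.<-cmp (inject j) i) (inject<i j)))) ⟨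
        unitriangular i i * b* i c + sum {toℕ i} (λ j → unitriangular i (inject j) * b* (inject j) c)
          ≈⟨ sum-inject (λ j → unitriangular i j * b* j c) i (λ j i<j → trans (*-congʳ (unitriangular-> i j i<j)) (zeroˡ _)) ⟨
        (unitriangular ⊗ b*) i c                                          ∎
        where
        inject<i : ∀ (j : Fin (toℕ i)) → inject j Fin.< i
        inject<i j = ≡.subst (ℕ._< toℕ i) (≡.sym (Fin.toℕ-inject j)) (Fin.toℕ<n j)

      det-unitriangular : det unitriangular ≈ 1#
      det-unitriangular = trans (det-lowerTriangular unitriangular unitriangular->)
        (trans (product-const unitriangular-≡) (1^n≈1 N))

      det-unitriangularᵀ : det (flip unitriangular) ≈ 1#
      det-unitriangularᵀ = trans (det-upperTriangular (flip unitriangular) (λ i j → unitriangular-> j i))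
        (trans (product-const unitriangular-≡) (1^n≈1 N))

      -- `b* ⊗ flip b*` is the Gram matrix of `b*`: its entries are inner products, so orthogonality
      -- clears it below the diagonal and leaves the squared lengths on it.
      det-b* : det b* * det (flip b*) ≈ product (λ i → ∣ b* i ∣²)
      det-b* = trans (sym (det-⊗ b* (flip b*))) (det-upperTriangular (b* ⊗ flip b*) b*-orthogonal)

    -- Both b = U b* and its transpose are factored; U and its transpose are unitriangular and
    -- contribute 1 each.
    det-b : det b * det (flip b) ≈ product (λ i → ∣ b* i ∣²)
    det-b = begin-equality
      det b * det (flip b)
        ≈⟨ *-cong (trans (⋀-cong b≈unitriangular⊗b* _) (det-⊗ unitriangular b*))
             (trans (⋀-cong (λ i j → trans (b≈unitriangular⊗b* j i) (⟨⟩-comm (unitriangular j) (λ k → b* k i))) _)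
                    (det-⊗ (flip b*) (flip unitriangular))) ⟩
      det unitriangular * det b* * (det (flip b*) * det (flip unitriangular))
        ≈⟨ *-cong (trans (*-congʳ det-unitriangular) (*-identityˡ _))
             (trans (*-congˡ det-unitriangularᵀ) (*-identityʳ _)) ⟩
      det b* * det (flip b*)
        ≈⟨ det-b* ⟩
      product (λ i → ∣ b* i ∣²) ∎

    -- The quotient det B · det Bᵀ / ∏ ∣ b* ∣² is the index of the sublattice
    -- squared, hence a positive integer.
    ∏∣b*∣²≤det : ∀ (B : Vector (Vector ℝ N) N) → (∀ j → Lattice b (B j)) → 0# < det B * det (flip B) →
               product (λ i → ∣ b* i ∣²) ≤ det B * det (flip B)
    ∏∣b*∣²≤det B B∈L 0<det = begin
      P                      ≈⟨ *-identityˡ P ⟨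
      1# * P                 ≤⟨ *-monoʳ-≤ 0≤P 1≤t ⟩
      fromℤ t * P            ≈⟨ det-B ⟨
      det B * det (flip B)   ∎
      where
      P : ℝ
      P = product (λ i → ∣ b* i ∣²)
      0≤P : 0# ≤ P
      0≤P = product-nonNeg (λ i → ∣∣²-nonNeg (b* i))
      V : Fin N → Fin N → ℤ
      V j = proj₁ (B∈L j)
      V′ : Fin N → Fin N → ℝ
      V′ i j = fromℤ (V i j)
      z z′ t : ℤ
      z = proj₁ (det-integer V)
      z′ = proj₁ (det-integer (flip V))
      t = z ℤ.* z′
      det-B : det B * det (flip B) ≈ fromℤ t * P
      det-B = begin-equality
        det B * det (flip B)
          ≈⟨ *-cong (trans (⋀-cong (λ j → proj₂ (B∈L j)) _) (det-⊗ V′ b))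
               (trans (⋀-cong (λ i j → trans (proj₂ (B∈L j) i) (⟨⟩-comm (V′ j) (λ k → b k i))) _)
                      (det-⊗ (flip b) (flip V′))) ⟩
        det V′ * det b * (det (flip b) * det (flip V′))
          ≈⟨ solve 4 (λ v b b′ v′ → v :* b :* (b′ :* v′) := v :* v′ :* (b :* b′)) refl
               (det V′) (det b) (det (flip b)) (det (flip V′)) ⟩
        det V′ * det (flip V′) * (det b * det (flip b))
          ≈⟨ *-cong (trans (*-cong (proj₂ (det-integer V)) (proj₂ (det-integer (flip V)))) (sym (fromℤ-* z z′))) det-b ⟩
        fromℤ t * P ∎
      0<t : 0# < fromℤ t
      0<t = ≰⇒> λ t≤0 → <⇒≱ 0<det (begin
        det B * det (flip B)   ≈⟨ det-B ⟩
        fromℤ t * P            ≤⟨ *-monoʳ-≤ 0≤P t≤0 ⟩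
        0# * P                 ≈⟨ zeroˡ P ⟩
        0#                     ∎)
      1≤t : 1# ≤ fromℤ t
      1≤t = ≤-respˡ (+-identityʳ 1#) (fromℤ-mono-≤ (ℤ.i<j⇒suc[i]≤j (fromℤ-cancel-< {0ℤ} {t} 0<t)))

-- The first vector of a reduced basis

module ReducedBasis (em : ExcludedMiddle 0ℓ) (R : CompleteOrderedField) where

  open Reals em R
  open OrderedField em R
  open GramSchmidtProperties em R
  open Determinant commutativeRing using (det; det-upperTriangular; det-lowerTriangular; product)
  open ≤-Reasoning

  -- 0 + 1 + ... + (n - 1) = n(n - 1)/2, the exponent of β accumulated along a basis of n vectors.
  triangle : ℕ → ℕ
  triangle zero    = 0
  triangle (suc n) = n ℕ.+ triangle n

  triangle+triangle : ∀ n → triangle n ℕ.+ triangle n ℕ.+ n ≡ n ℕ.* n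
  triangle+triangle zero    = ≡.refl
  triangle+triangle (suc n) = ≡.trans (regroup n (triangle n))
    (≡.trans (≡.cong (λ s → suc (n ℕ.+ n ℕ.+ s)) (triangle+triangle n)) (expand n))
    where
    regroup : ∀ n t → n ℕ.+ t ℕ.+ (n ℕ.+ t) ℕ.+ (1 ℕ.+ n) ≡ 1 ℕ.+ (n ℕ.+ n ℕ.+ (t ℕ.+ t ℕ.+ n))
    regroup = ℕ-solve-∀
    expand : ∀ n → 1 ℕ.+ (n ℕ.+ n ℕ.+ n ℕ.* n) ≡ (1 ℕ.+ n) ℕ.* (1 ℕ.+ n)
    expand = ℕ-solve-∀

  -- Iterating the step gives ν_0 ≤ β^i ν_i, and multiplying over all i collects the triangular
  -- exponent. The induction keeps one factor ν_0, trades each of the others for β ν_1, and recurses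
  -- on the tail.
  geometric-chain : ∀ {n β} (ν : Vector ℝ (suc n)) → 0# ≤ β → (∀ i → 0# ≤ ν i) →
    (∀ i j → toℕ i ≡ suc (toℕ j) → ν j ≤ β * ν i) →
    ν Fin.zero ^ suc n ≤ β ^ triangle (suc n) * product ν
  geometric-chain {zero}      ν 0≤β 0≤ν step = ≤-reflexive (sym (*-identityˡ _))
  geometric-chain {suc n} {β} ν 0≤β 0≤ν step = begin
    ν₀ * ν₀ ^ suc n
      ≤⟨ *-monoˡ-≤ (0≤ν Fin.zero) (^-mono-≤ (suc n) (0≤ν Fin.zero) (step (Fin.suc Fin.zero) Fin.zero ≡.refl)) ⟩
    ν₀ * (β * ν₁) ^ suc n
      ≈⟨ *-congˡ (^-distrib-* β ν₁ (suc n)) ⟩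
    ν₀ * (β ^ suc n * ν₁ ^ suc n)
      ≤⟨ *-monoˡ-≤ (0≤ν Fin.zero) (*-monoˡ-≤ (^-nonNeg (suc n) 0≤β)
           (geometric-chain (ν ∘ Fin.suc) 0≤β (0≤ν ∘ Fin.suc) (λ i j i≡1+j → step (Fin.suc i) (Fin.suc j) (≡.cong suc i≡1+j)))) ⟩
    ν₀ * (β ^ suc n * (β ^ triangle (suc n) * P))
      ≈⟨ solve 4 (λ a b c d → a :* (b :* (c :* d)) := (b :* c) :* (a :* d)) refl ν₀ (β ^ suc n) (β ^ triangle (suc n)) P ⟩
    β ^ suc n * β ^ triangle (suc n) * product ν
      ≈⟨ *-congʳ (^-homo-* β (suc n) (triangle (suc n))) ⟨
    β ^ triangle (suc (suc n)) * product ν ∎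
    where
    ν₀ ν₁ P : ℝ
    ν₀ = ν Fin.zero
    ν₁ = ν (Fin.suc Fin.zero)
    P = product (ν ∘ Fin.suc)

  pythagoras : ∀ {n} (u v : Vector ℝ n) a → ⟨ u , v ⟩ ≈ 0# →
               ∣ (λ c → u c + a * v c) ∣² ≈ ∣ u ∣² + a * a * ∣ v ∣²
  pythagoras u v a ⟨u,v⟩≈0 = begin-equality
    ⟨ w , w ⟩                                                 ≈⟨ expand w ⟩
    ⟨ u , w ⟩ + a * ⟨ v , w ⟩
      ≈⟨ +-cong (trans (⟨⟩-comm u w) (expand u)) (*-congˡ (trans (⟨⟩-comm v w) (expand v))) ⟩
    ⟨ u , u ⟩ + a * ⟨ v , u ⟩ + a * (⟨ u , v ⟩ + a * ⟨ v , v ⟩)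
      ≈⟨ +-cong (+-congˡ (*-congˡ (trans (⟨⟩-comm v u) ⟨u,v⟩≈0))) (*-congˡ (+-congʳ ⟨u,v⟩≈0)) ⟩
    ⟨ u , u ⟩ + a * 0# + a * (0# + a * ⟨ v , v ⟩)
      ≈⟨ solve 3 (λ x a y → x :+ a :* con 0ℤ :+ a :* (con 0ℤ :+ a :* y) := x :+ a :* a :* y) refl (∣ u ∣²) a (∣ v ∣²) ⟩
    ∣ u ∣² + a * a * ∣ v ∣²                                   ∎
    where
    w : Vector ℝ _
    w c = u c + a * v c
    expand : ∀ x → ⟨ w , x ⟩ ≈ ⟨ u , x ⟩ + a * ⟨ v , x ⟩
    expand x = trans (⟨⟩-+ˡ u (λ c → a * v c) x) (+-congˡ (⟨⟩-scaleˡ a v x))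

  module _ {α : ℝ} (¼<α : fromℚ (+ 1 ℚ./ 4) < α) where

    private
      four γ : ℝ
      four = fromℤ (+ 4)
      γ = four * α - 1#

      0<γ : 0# < γ
      0<γ = difference-pos (begin-strict
        1#                              ≈⟨ +-identityʳ 1# ⟨
        fromℤ (+ 1)                     ≈⟨ x*y⁻¹*y≈x (fromℤ-pos 4) ⟨
        fromℤ (+ 1) * four ⁻¹ * four    <⟨ *-monoʳ-< (fromℤ-pos 4) ¼<α ⟩
        α * four                        ≈⟨ *-comm α four ⟩
        four * α                        ∎)

    β-pos : 0# < β[ α ]
    β-pos = *-pos (fromℤ-pos 4) (⁻¹-pos 0<γ)

    module _ {N} {b : Vector (Vector ℝ N) N} (reduced : IsReduced α b) where

      open IsReduced reduced

      private
        4μ²≤1 : ∀ i j → j Fin.< i → four * (μ i j * μ i j) ≤ 1#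
        4μ²≤1 i j j<i = begin
          four * (x * x)
            ≈⟨ *-congˡ (∣∣-square x) ⟨
          four * (∣ x ∣ * ∣ x ∣)
            ≈⟨ solve 1 (λ y → con (+ 4) :* (y :* y) := y :* con (+ 2) :* (y :* con (+ 2))) refl ∣ x ∣ ⟩
          ∣ x ∣ * two * (∣ x ∣ * two)
            ≤⟨ *-mono-≤ (proj₁ 0<1) (*-nonNeg (∣∣-nonNeg x) (fromℤ-nonNeg 2)) 2∣x∣≤1 2∣x∣≤1 ⟩
          1# * 1#
            ≈⟨ *-identityʳ 1# ⟩
          1# ∎
          where
          x two : ℝ
          x = μ i j
          two = fromℤ (+ 2)
          2∣x∣≤1 : ∣ x ∣ * two ≤ 1#
          2∣x∣≤1 = begin
            ∣ x ∣ * two                      ≤⟨ *-monoʳ-≤ (fromℤ-nonNeg 2) (size i j j<i) ⟩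
            fromℤ (+ 1) * two ⁻¹ * two       ≈⟨ x*y⁻¹*y≈x (fromℤ-pos 2) ⟩
            fromℤ (+ 1)                      ≈⟨ +-identityʳ 1# ⟩
            1#                               ∎

      -- By orthogonality the Lovász condition reads |b*_i|² + μ² |b*_j|² ≥ α |b*_j|². With μ² ≤ 1/4
      -- this becomes |b*_i|² ≥ (α - 1/4) |b*_j|², and β is the inverse of α - 1/4. The computation
      -- is multiplied through by γ = 4α - 1.
      lovász-step : ∀ i j → toℕ i ≡ suc (toℕ j) → ∣ b* j ∣² ≤ β[ α ] * ∣ b* i ∣²
      lovász-step i j i≡1+j = *-cancelʳ-≤ 0<γ (begin
        νⱼ * γ                                   ≈⟨ solve 4 (λ n f a o → n :* (f :* a :- o) := f :* (a :* n) :- n :* o)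
                                                      refl νⱼ four α 1# ⟩
        four * (α * νⱼ) - νⱼ * 1#                ≤⟨ +-monoˡ-≤ _ (*-monoˡ-≤ (fromℤ-nonNeg 4) (lovász i j i≡1+j)) ⟩
        four * ∣ (λ c → b* i c + x * b* j c) ∣² - νⱼ * 1#
                                                 ≈⟨ +-congʳ (*-congˡ (pythagoras (b* i) (b* j) x
                                                      (b*-orthogonal gramSchmidt i j j<i))) ⟩
        four * (νᵢ + x * x * νⱼ) - νⱼ * 1#       ≈⟨ solve 5 (λ f n x m o → f :* (n :+ x :* x :* m) :- m :* o
                                                      := f :* n :+ (f :* (x :* x) :* m :- o :* m)) refl four νᵢ x νⱼ 1# ⟩
        four * νᵢ + (four * (x * x) * νⱼ - 1# * νⱼ)
                                                 ≤⟨ +-mono-≤ ≤-refl (+-monoˡ-≤ _ (*-monoʳ-≤ (∣∣²-nonNeg (b* j)) (4μ²≤1 i j j<i))) ⟩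
        four * νᵢ + (1# * νⱼ - 1# * νⱼ)          ≈⟨ trans (+-congˡ (-‿inverseʳ _)) (+-identityʳ _) ⟩
        four * νᵢ                                ≈⟨ *-congʳ (x*y⁻¹*y≈x 0<γ) ⟨
        four * γ ⁻¹ * γ * νᵢ                     ≈⟨ solve 3 (λ b g n → b :* g :* n := b :* n :* g) refl β[ α ] γ νᵢ ⟩
        β[ α ] * νᵢ * γ                          ∎)
        where
        x νᵢ νⱼ : ℝ
        x = μ i j
        νᵢ = ∣ b* i ∣²
        νⱼ = ∣ b* j ∣²
        j<i : j Fin.< i
        j<i = ≡.subst (toℕ j ℕ.<_) (≡.sym i≡1+j) (ℕ.n<1+n (toℕ j))

    reduced-first : ∀ {N} {b : Vector (Vector ℝ (suc N)) (suc N)} (reduced : IsReduced α b) →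
      ∣ b Fin.zero ∣² ^ suc N ≤ β[ α ] ^ triangle (suc N) * product (λ i → ∣ IsReduced.b* reduced i ∣²)
    reduced-first {N} {b} reduced = begin
      ∣ b Fin.zero ∣² ^ suc N
        ≈⟨ ^-congˡ (suc N) (sum-cong-≋ (λ c → *-cong (b₀≈b*₀ c) (b₀≈b*₀ c))) ⟩
      ∣ b* Fin.zero ∣² ^ suc N
        ≤⟨ geometric-chain (λ i → ∣ b* i ∣²) (proj₁ β-pos) (λ i → ∣∣²-nonNeg (b* i)) (lovász-step reduced) ⟩
      β[ α ] ^ triangle (suc N) * product (λ i → ∣ b* i ∣²) ∎
      where
      open IsReduced reduced
      b₀≈b*₀ : ∀ c → b Fin.zero c ≈ b* Fin.zero c
      b₀≈b*₀ c = trans (b-expansion gramSchmidt Fin.zero c) (+-identityʳ _)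

-- The lattice of the basis matrix

module BasisMatrix (em : ExcludedMiddle 0ℓ) (R : CompleteOrderedField) where

  open Reals em R
  open OrderedField em R
  open GramSchmidtProperties em R
  open ReducedBasis em R
  open Determinant commutativeRing using (det; det-upperTriangular; det-lowerTriangular; product)
  open SumSplitting using (sum-↑)
  open ≤-Reasoning

  ↑-elim : ∀ n {m} (P : Fin (n ℕ.+ m) → Set) → (∀ i → P (i ↑ˡ m)) → (∀ j → P (n ↑ʳ j)) → ∀ r → P r
  ↑-elim zero    P left right r           = right r
  ↑-elim (suc n) P left right Fin.zero    = left Fin.zero
  ↑-elim (suc n) P left right (Fin.suc r) = ↑-elim n (P ∘ Fin.suc) (left ∘ Fin.suc) right r

  ↑ˡ<↑ʳ : ∀ {n m} (i : Fin n) (j : Fin m) → i ↑ˡ m Fin.< n ↑ʳ j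
  ↑ˡ<↑ʳ {n} {m} i j = ≡.subst₂ ℕ._<_ (≡.sym (Fin.toℕ-↑ˡ i m)) (≡.sym (Fin.toℕ-↑ʳ n j))
    (ℕ.<-≤-trans (Fin.toℕ<n i) (ℕ.m≤m+n n (toℕ j)))

  δ-diagonal : ∀ {k} (i : Fin k) → δ i i ≡ 1#
  δ-diagonal i with i Fin.≟ i
  ... | yes _  = ≡.refl
  ... | no i≢i = contradiction ≡.refl i≢i

  δ-off-diagonal : ∀ {k} {i j : Fin k} → i ≢ j → δ i j ≡ 0#
  δ-off-diagonal {i = i} {j} i≢j with i Fin.≟ j
  ... | yes i≡j = contradiction i≡j i≢j
  ... | no  _   = ≡.refl

  ∑δ : ∀ {k} (i : Fin k) (x : Vector ℝ k) → sum (λ j → δ i j * x j) ≈ x i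
  ∑δ i x = begin-equality
    sum (λ j → δ i j * x j)   ≈⟨ sum-single (λ j → δ i j * x j) i (λ j j≢i →
                                   trans (*-congʳ (reflexive (δ-off-diagonal (j≢i ∘ ≡.sym)))) (zeroˡ _)) ⟩
    δ i i * x i               ≡⟨ ≡.cong (_* x i) (δ-diagonal i) ⟩
    1# * x i                  ≈⟨ *-identityˡ _ ⟩
    x i                       ∎

  module _ {n m : ℕ} (A : Matrix n m) (c : ℝ) where

    private
      B : Matrix (n ℕ.+ m) (n ℕ.+ m)
      B = basisMatrix A c

    basisMatrix-topLeft : ∀ i j → B (i ↑ˡ m) (j ↑ˡ m) ≡ δ i j
    basisMatrix-topLeft i j rewrite Fin.splitAt-↑ˡ n i m | Fin.splitAt-↑ˡ n j m = ≡.refl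

    basisMatrix-topRight : ∀ i j → B (i ↑ˡ m) (n ↑ʳ j) ≡ A i j
    basisMatrix-topRight i j rewrite Fin.splitAt-↑ˡ n i m | Fin.splitAt-↑ʳ n m j = ≡.refl

    basisMatrix-bottomLeft : ∀ i j → B (n ↑ʳ i) (j ↑ˡ m) ≡ 0#
    basisMatrix-bottomLeft i j rewrite Fin.splitAt-↑ʳ n m i | Fin.splitAt-↑ˡ n j m = ≡.refl

    basisMatrix-bottomRight : ∀ i j → B (n ↑ʳ i) (n ↑ʳ j) ≡ c * δ i j
    basisMatrix-bottomRight i j rewrite Fin.splitAt-↑ʳ n m i | Fin.splitAt-↑ʳ n m j = ≡.refl

    basisMatrix-top : ∀ i (x : Vector ℝ (n ℕ.+ m)) →
      sum (λ s → B (i ↑ˡ m) s * x s) ≈ x (i ↑ˡ m) + sum (λ j → A i j * x (n ↑ʳ j))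
    basisMatrix-top i x = trans (sum-↑ +-commutativeMonoid n (λ s → B (i ↑ˡ m) s * x s)) (+-cong
      (trans (sum-cong-≋ λ j → *-congʳ (reflexive (basisMatrix-topLeft i j))) (∑δ i (λ j → x (j ↑ˡ m))))
      (sum-cong-≋ λ j → *-congʳ (reflexive (basisMatrix-topRight i j))))

    basisMatrix-bottom : ∀ i (x : Vector ℝ (n ℕ.+ m)) →
      sum (λ s → B (n ↑ʳ i) s * x s) ≈ c * x (n ↑ʳ i)
    basisMatrix-bottom i x = trans (sum-↑ +-commutativeMonoid n (λ s → B (n ↑ʳ i) s * x s)) (trans (+-cong
      (trans (sum-cong-≋ λ j → trans (*-congʳ (reflexive (basisMatrix-bottomLeft i j))) (zeroˡ _)) (sum-replicate-zero n))
      (trans (sum-cong-≋ λ j → trans (*-congʳ (reflexive (basisMatrix-bottomRight i j))) (*-assoc c (δ i j) _))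
        (trans (sym (*-distribˡ-sum c (λ j → δ i j * x (n ↑ʳ j)))) (*-congˡ (∑δ i (λ j → x (n ↑ʳ j)))))))
      (+-identityˡ _))

    basisMatrix-upperTriangular : ∀ r s → s Fin.< r → B r s ≈ 0#
    basisMatrix-upperTriangular = ↑-elim n _
      (λ i → ↑-elim n _
        (λ j j<i → reflexive (≡.trans (basisMatrix-topLeft i j)
          (δ-off-diagonal λ i≡j → Fin.<⇒≢ j<i (≡.cong (_↑ˡ m) (≡.sym i≡j)))))
        (λ j j<i → contradiction j<i (ℕ.<-asym (↑ˡ<↑ʳ i j))))
      (λ i → ↑-elim n _
        (λ j _ → reflexive (basisMatrix-bottomLeft i j))
        (λ j j<i → trans (reflexive (≡.trans (basisMatrix-bottomRight i j)
          (≡.cong (c *_) (δ-off-diagonal λ i≡j → Fin.<⇒≢ j<i (≡.cong (n ↑ʳ_) (≡.sym i≡j)))))) (zeroʳ c)))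

    basisMatrix-diagonal : product (λ r → B r r) ≈ c ^ m
    basisMatrix-diagonal = trans (sum-↑ *-commutativeMonoid n (λ r → B r r)) (trans (*-cong
      (trans (product-const {n} λ i → reflexive (≡.trans (basisMatrix-topLeft i i) (δ-diagonal i))) (1^n≈1 n))
      (product-const {m} λ j → trans (reflexive (≡.trans (basisMatrix-bottomRight j j) (≡.cong (c *_) (δ-diagonal j))))
        (*-identityʳ c)))
      (*-identityˡ _))

    -- The basis vectors are the rows of `columns B`, whose transpose is `B`; so this is the
    -- expression `det b * det (flip b)` for the input basis of the reduction.
    det-basisMatrix : det (columns B) * det B ≈ c ^ m * c ^ m
    det-basisMatrix = *-cong
      (trans (det-lowerTriangular (columns B) (λ i j → basisMatrix-upperTriangular j i)) basisMatrix-diagonal)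
      (trans (det-upperTriangular B basisMatrix-upperTriangular) basisMatrix-diagonal)

    -- Back substitution: the lower block forces the last m coordinates to vanish, after which the
    -- upper block determines the others.
    columns-linearlyIndependent : ¬ c ≈ 0# → LinearlyIndependent (columns B)
    columns-linearlyIndependent c≉0 x ∑≈0 = ↑-elim n (λ r → x r ≈ 0#)
      (λ i → begin-equality
        x (i ↑ˡ m)                                          ≈⟨ +-identityʳ _ ⟨
        x (i ↑ˡ m) + 0#                                     ≈⟨ +-congˡ (trans (sum-cong-≋ λ j →
                                                                 trans (*-congˡ (bottom j)) (zeroʳ (A i j))) (sum-replicate-zero m)) ⟨
        x (i ↑ˡ m) + sum (λ j → A i j * x (n ↑ʳ j))         ≈⟨ basisMatrix-top i x ⟨
        sum (λ s → B (i ↑ˡ m) s * x s)                      ≈⟨ rows (i ↑ˡ m) ⟩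
        0#                                                  ∎)
      bottom
      where
      rows : ∀ r → sum (λ s → B r s * x s) ≈ 0#
      rows r = trans (sum-cong-≋ λ s → *-comm (B r s) (x s)) (∑≈0 r)
      bottom : ∀ j → x (n ↑ʳ j) ≈ 0#
      bottom j = *-cancelˡ-0 c≉0 (trans (sym (basisMatrix-bottom j x)) (rows (n ↑ʳ j)))

  basis⊆Lattice : ∀ {N k} (b : Vector (Vector ℝ N) k) j → Lattice b (b j)
  basis⊆Lattice b j = (λ l → coefficient l (l Fin.≟ j)) , λ i → begin-equality
    b j i
      ≈⟨ trans (*-congʳ (trans (reflexive (≡.cong fromℤ (coefficient-≡ (j Fin.≟ j)))) (+-identityʳ 1#))) (*-identityˡ _) ⟨
    fromℤ (coefficient j (j Fin.≟ j)) * b j i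
      ≈⟨ sum-single (λ l → fromℤ (coefficient l (l Fin.≟ j)) * b l i) j (λ l l≢j →
           trans (*-congʳ (reflexive (≡.cong fromℤ (coefficient-≢ l (l Fin.≟ j) l≢j)))) (zeroˡ _)) ⟨
    sum (λ l → fromℤ (coefficient l (l Fin.≟ j)) * b l i) ∎
    where
    coefficient : ∀ l → Dec (l ≡ j) → ℤ
    coefficient l (yes _) = 1ℤ
    coefficient l (no _)  = 0ℤ
    coefficient-≡ : ∀ l≟j → coefficient j l≟j ≡ 1ℤ
    coefficient-≡ (yes _)  = ≡.refl
    coefficient-≡ (no j≢j) = contradiction ≡.refl j≢j
    coefficient-≢ : ∀ l l≟j → l ≢ j → coefficient l l≟j ≡ 0ℤ
    coefficient-≢ l (yes l≡j) l≢j = contradiction l≡j l≢j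
    coefficient-≢ l (no _)    _   = ≡.refl

  module _ {α : ℝ} (¼<α : fromℚ (+ 1 ℚ./ 4) < α) where

    first-vector-bound : ∀ n m .{{_ : NonZero n}} (A : Matrix n m) {c} → 0# < c → (lll : LLLAlgorithm α (n ℕ.+ m)) →
      ∣ LLLAlgorithm.reduce lll (columns (basisMatrix A c)) (firstIndex n m) ∣² ^ (n ℕ.+ m)
        ≤ β[ α ] ^ triangle (n ℕ.+ m) * (c ^ m * c ^ m)
    -- Matching `n` with a successor makes `firstIndex n m` compute to `Fin.zero`.
    first-vector-bound n@(suc _) m A {c} 0<c lll = begin
      ∣ reduce b (firstIndex n m) ∣² ^ (n ℕ.+ m)
        ≤⟨ reduced-first ¼<α reduced ⟩
      β[ α ] ^ triangle (n ℕ.+ m) * product (λ i → ∣ IsReduced.b* reduced i ∣²)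
        ≤⟨ *-monoˡ-≤ (^-nonNeg (triangle (n ℕ.+ m)) (proj₁ (β-pos ¼<α)))
             (∏∣b*∣²≤det (IsReduced.gramSchmidt reduced) b
               (λ j → proj₂ (proj₂ (isBasis b independent)) (basis⊆Lattice b j))
               (<-respʳ (sym (det-basisMatrix A c)) (*-pos (^-pos m 0<c) (^-pos m 0<c)))) ⟩
      β[ α ] ^ triangle (n ℕ.+ m) * (det b * det (basisMatrix A c))
        ≈⟨ *-congˡ (det-basisMatrix A c) ⟩
      β[ α ] ^ triangle (n ℕ.+ m) * (c ^ m * c ^ m) ∎
      where
      open LLLAlgorithm lll
      b : Vector (Vector ℝ (n ℕ.+ m)) (n ℕ.+ m)
      b = columns (basisMatrix A c)
      independent : LinearlyIndependent b
      independent = columns-linearlyIndependent A c (pos⇒≉0 0<c)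
      reduced : IsReduced α (reduce b)
      reduced = isReduced b independent

-- Clearing the denominators of exponents

module RationalExponents (em : ExcludedMiddle 0ℓ) (R : CompleteOrderedField) where

  open Reals em R
  open OrderedField em R
  open Powers em R
  open ≤-Reasoning

  fromℚ-/ : ∀ p k .{{_ : NonZero k}} → fromℚ (p ℚ./ k) * fromℤ (+ k) ≈ fromℤ p
  fromℚ-/ p k@(suc _) = x*y⁻¹*y≈x (fromℤ-pos k)

  -- The powers of β have denominators 4m and 4n, those of ε, d and Q only m and n; this passes
  -- between the two scales.
  ^4* : ∀ x k → x ^ (4 ℕ.* k) ≈ (x ^ k) ^ 4
  ^4* x k = trans (reflexive (≡.cong (x ^_) (ℕ.*-comm 4 k))) (sym (^-assocʳ x k 4))

  module _ {x : ℝ} (0<x : 0# < x) where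

    ^ℚ-/ : ∀ p k .{{_ : NonZero k}} → (x ^ℚ (p ℚ./ k)) ^ k ≈ x ^ℤ p
    ^ℚ-/ p k@(suc _) = ^ℚ-^ 0<x (p ℚ./ k)

    ^ℚ-neg-/ : ∀ a k .{{_ : NonZero k}} → (x ^ℚ (ℚ.- (+ a ℚ./ k))) ^ k * x ^ a ≈ 1#
    ^ℚ-neg-/ a k@(suc _) = trans (*-congʳ (^ℚ-^ 0<x (ℚ.- (+ a ℚ./ k)))) (^ℤ-neg 0<x a)

    ^ℚ-1+/ : ∀ a k .{{_ : NonZero k}} → (x ^ℚ (ℚ.1ℚᵘ ℚ.+ + a ℚ./ k)) ^ k ≈ x ^ (a ℕ.+ k)
    ^ℚ-1+/ a k@(suc _) = begin-equality
      -- The unnormalised sum has denominator 1 * k and numerator 1 * k + a * 1; both have to be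
      -- brought into these shapes before the root property applies.
      (x ^ℚ (ℚ.1ℚᵘ ℚ.+ + a ℚ./ k)) ^ k              ≡⟨ ≡.cong ((x ^ℚ (ℚ.1ℚᵘ ℚ.+ + a ℚ./ k)) ^_) (≡.sym (ℕ.*-identityˡ k)) ⟩
      (x ^ℚ (ℚ.1ℚᵘ ℚ.+ + a ℚ./ k)) ^ (1 ℕ.* k)      ≈⟨ ^ℚ-^ 0<x (ℚ.1ℚᵘ ℚ.+ + a ℚ./ k) ⟩
      x ^ℤ (1ℤ ℤ.* + k ℤ.+ + a ℤ.* 1ℤ)              ≡⟨ ≡.cong (x ^ℤ_) (numerator (+ a) (+ k)) ⟩
      x ^ (a ℕ.+ k)                                 ∎
      where
      numerator : ∀ a k → 1ℤ ℤ.* k ℤ.+ a ℤ.* 1ℤ ≡ a ℤ.+ k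
      numerator = solve-∀

-- The iterations of the algorithm

module ILLLAnalysis (em : ExcludedMiddle 0ℓ) (R : CompleteOrderedField) where

  open Reals em R
  open OrderedField em R
  open Powers em R
  open Logarithm em R
  open GramSchmidtProperties em R
  open ReducedBasis em R
  open BasisMatrix em R
  open RationalExponents em R
  open Solver using (_:^_)
  open ≤-Reasoning

  module _ {n m : ℕ} .{{_ : NonZero n}} .{{_ : NonZero m}} (A : Matrix n m) (α ε d qmax : ℝ)
           (¼<α : fromℚ (+ 1 ℚ./ 4) < α) (0<ε : 0# < ε) (1<d : 1# < d)
           (lll : LLLAlgorithm α (n ℕ.+ m)) where

    open ILLL A α ε d qmax lll
    open LLLAlgorithm lll

    -- `G` is N(N - 1), written as twice a triangular number because it arises by squaring the bound
    -- on the first vector. `Γ` is the same number in the integer form used by the statement.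
    N G : ℕ
    N = n ℕ.+ m
    G = triangle N ℕ.+ triangle N

    Γ : ℤ
    Γ = (+ m ℤ.+ + n ℤ.- 1ℤ) ℤ.* (+ m ℤ.+ + n)

    β : ℝ
    β = β[ α ]

    private
      0<d : 0# < d
      0<d = begin-strict 0# <⟨ 0<1 ⟩ 1# <⟨ 1<d ⟩ d ∎

      0<β : 0# < β
      0<β = β-pos ¼<α

      G+N≡N² : + G ℤ.+ (+ n ℤ.+ + m) ≡ (+ n ℤ.+ + m) ℤ.* (+ n ℤ.+ + m)
      G+N≡N² = ≡.trans (≡.cong +_ (triangle+triangle N)) (ℤ.pos-* N N)

      G≡N²-N : + G ≡ (+ n ℤ.+ + m) ℤ.* (+ n ℤ.+ + m) ℤ.- (+ n ℤ.+ + m)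
      G≡N²-N = ≡.trans (cancel (+ G) (+ n ℤ.+ + m)) (≡.cong (ℤ._- (+ n ℤ.+ + m)) G+N≡N²)
        where
        cancel : ∀ g s → g ≡ g ℤ.+ s ℤ.- s
        cancel = solve-∀

      Γ≡G : Γ ≡ + G
      Γ≡G = ≡.trans (expand (+ n) (+ m)) (≡.sym G≡N²-N)
        where
        expand : ∀ n m → (m ℤ.+ n ℤ.- 1ℤ) ℤ.* (m ℤ.+ n) ≡ (n ℤ.+ m) ℤ.* (n ℤ.+ m) ℤ.- (n ℤ.+ m)
        expand = solve-∀

      negated≡-G : (1ℤ ℤ.- + m ℤ.- + n) ℤ.* (+ n ℤ.+ + m) ≡ ℤ.- + G
      negated≡-G = ≡.trans (expand (+ n) (+ m)) (≡.cong ℤ.-_ (≡.sym G≡N²-N))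
        where
        expand : ∀ n m → (1ℤ ℤ.- m ℤ.- n) ℤ.* (n ℤ.+ m) ≡ ℤ.- ((n ℤ.+ m) ℤ.* (n ℤ.+ m) ℤ.- (n ℤ.+ m))
        expand = solve-∀

      instance
        4n-nonZero : NonZero (4 ℕ.* n)
        4n-nonZero = ℕ.m*n≢0 4 n

        4m-nonZero : NonZero (4 ℕ.* m)
        4m-nonZero = ℕ.m*n≢0 4 m

        N-nonZero : NonZero N
        N-nonZero = ℕ.>-nonZero (ℕ.<-≤-trans (ℕ.>-nonZero⁻¹ n) (ℕ.m≤m+n n m))

    bound-pos : ∀ a k .{{_ : NonZero k}} {x} → 0# < x → 0# < x ^ℚ (ℚ.- (+ a ℚ./ k)) * β ^ℚ (Γ /4· k)
    bound-pos a k 0<x = *-pos (^ℚ-pos 0<x (ℚ.- (+ a ℚ./ k))) (^ℚ-pos 0<β (Γ /4· k))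

    -- Both T(Q) = Q^(-m/n) β^(Γ/4n) and the lower bound ε^(-n/m) β^(Γ/4m)
    -- on Q are of this shape.
    bound-power : ∀ a k .{{_ : NonZero k}} {x} → 0# < x →
      (x ^ℚ (ℚ.- (+ a ℚ./ k)) * β ^ℚ (Γ /4· k)) ^ (4 ℕ.* k) * x ^ (4 ℕ.* a) ≈ β ^ G
    bound-power a k {x} 0<x = begin-equality
      (u * v) ^ (4 ℕ.* k) * x ^ (4 ℕ.* a)
        ≈⟨ *-cong (^-distrib-* u v (4 ℕ.* k)) (^4* x a) ⟩
      u ^ (4 ℕ.* k) * v ^ (4 ℕ.* k) * (x ^ a) ^ 4
        ≈⟨ *-congʳ (*-cong (^4* u k) (^ℚ-/ 0<β Γ (4 ℕ.* k) {{ℕ.m*n≢0 4 k}})) ⟩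
      (u ^ k) ^ 4 * β ^ℤ Γ * (x ^ a) ^ 4
        ≈⟨ solve 3 (λ p b q → p :^ 4 :* b :* q :^ 4 := (p :* q) :^ 4 :* b) refl (u ^ k) (β ^ℤ Γ) (x ^ a) ⟩
      (u ^ k * x ^ a) ^ 4 * β ^ℤ Γ
        ≈⟨ *-cong (trans (^-congˡ 4 (^ℚ-neg-/ 0<x a k)) (1^n≈1 4)) (reflexive (≡.cong (β ^ℤ_) Γ≡G)) ⟩
      1# * β ^ G
        ≈⟨ *-identityˡ _ ⟩
      β ^ G ∎
      where
      u v : ℝ
      u = x ^ℚ (ℚ.- (+ a ℚ./ k))
      v = β ^ℚ (Γ /4· k)

    c-pos : ∀ k → 0# < c k
    c-pos zero    = *-pos
      (^ℚ-pos 0<β ((1ℤ ℤ.- + m ℤ.- + n) ℤ.* (+ n ℤ.+ + m) /4· m))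
      (^ℚ-pos 0<ε (ℚ.1ℚᵘ ℚ.+ + n ℚ./ m))
    c-pos (suc k) = *-pos (c-pos k) (^ℚ-pos 0<d (ℚ.- (+ N ℚ./ m)))

    -- The 4m-th power turns the exponent of β in c(ε) into -G and that of ε into 4N, and each
    -- iteration contributes d^(-4N). The negative powers are moved to the left to avoid division.
    c-power : ∀ k → c k ^ (4 ℕ.* m) * β ^ G * (d ^ k) ^ (4 ℕ.* N) ≈ ε ^ (4 ℕ.* N)
    c-power zero = begin-equality
      (u * v) ^ (4 ℕ.* m) * β ^ G * 1# ^ (4 ℕ.* N)
        ≈⟨ *-cong (*-congʳ (^-distrib-* u v (4 ℕ.* m))) (1^n≈1 (4 ℕ.* N)) ⟩
      u ^ (4 ℕ.* m) * v ^ (4 ℕ.* m) * β ^ G * 1#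
        ≈⟨ trans (*-identityʳ _) (*-congʳ (*-cong (^ℚ-/ 0<β ((1ℤ ℤ.- + m ℤ.- + n) ℤ.* (+ n ℤ.+ + m)) (4 ℕ.* m))
             (^4* v m))) ⟩
      β ^ℤ ((1ℤ ℤ.- + m ℤ.- + n) ℤ.* (+ n ℤ.+ + m)) * (v ^ m) ^ 4 * β ^ G
        ≈⟨ *-congʳ (*-cong (reflexive (≡.cong (β ^ℤ_) negated≡-G)) (^-congˡ 4 (^ℚ-1+/ 0<ε n m))) ⟩
      β ^ℤ (ℤ.- + G) * (ε ^ N) ^ 4 * β ^ G
        ≈⟨ solve 3 (λ a e b → a :* e :* b := e :* (a :* b)) refl (β ^ℤ (ℤ.- + G)) ((ε ^ N) ^ 4) (β ^ G) ⟩
      (ε ^ N) ^ 4 * (β ^ℤ (ℤ.- + G) * β ^ G)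
        ≈⟨ *-cong (sym (^4* ε N)) (^ℤ-neg 0<β G) ⟩
      ε ^ (4 ℕ.* N) * 1#
        ≈⟨ *-identityʳ _ ⟩
      ε ^ (4 ℕ.* N) ∎
      where
      u v : ℝ
      u = β ^ℚ ((1ℤ ℤ.- + m ℤ.- + n) ℤ.* (+ n ℤ.+ + m) /4· m)
      v = ε ^ℚ (ℚ.1ℚᵘ ℚ.+ + n ℚ./ m)
    c-power (suc k) = begin-equality
      (c k * w) ^ (4 ℕ.* m) * β ^ G * (d * d ^ k) ^ (4 ℕ.* N)
        ≈⟨ *-cong (*-congʳ (^-distrib-* (c k) w (4 ℕ.* m))) (^-distrib-* d (d ^ k) (4 ℕ.* N)) ⟩
      c k ^ (4 ℕ.* m) * w ^ (4 ℕ.* m) * β ^ G * (d ^ (4 ℕ.* N) * (d ^ k) ^ (4 ℕ.* N))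
        ≈⟨ solve 5 (λ a w b d e → a :* w :* b :* (d :* e) := a :* b :* e :* (w :* d)) refl
             (c k ^ (4 ℕ.* m)) (w ^ (4 ℕ.* m)) (β ^ G) (d ^ (4 ℕ.* N)) ((d ^ k) ^ (4 ℕ.* N)) ⟩
      c k ^ (4 ℕ.* m) * β ^ G * (d ^ k) ^ (4 ℕ.* N) * (w ^ (4 ℕ.* m) * d ^ (4 ℕ.* N))
        ≈⟨ *-cong (c-power k) (trans (*-cong (^4* w m) (^4* d N)) (sym (^-distrib-* (w ^ m) (d ^ N) 4))) ⟩
      ε ^ (4 ℕ.* N) * (w ^ m * d ^ N) ^ 4
        ≈⟨ *-congˡ (trans (^-congˡ 4 (^ℚ-neg-/ 0<d N m)) (1^n≈1 4)) ⟩
      ε ^ (4 ℕ.* N) * 1#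
        ≈⟨ *-identityʳ _ ⟩
      ε ^ (4 ℕ.* N) ∎
      where
      w : ℝ
      w = d ^ℚ (ℚ.- (+ N ℚ./ m))

    η : ℕ → ℝ
    η k = ε * (d ^ k) ⁻¹

    η-pos : ∀ k → 0# < η k
    η-pos k = *-pos 0<ε (⁻¹-pos (^-pos k 0<d))

    -- The equation for which c(η) is normalised: its left side is the square of the bound that the
    -- reduced basis gives for |b_1|^(2N).
    c-η : ∀ k → c k ^ (4 ℕ.* m) * β ^ G ≈ η k ^ (4 ℕ.* N)
    c-η k = *-cancelʳ-≈ (^-pos (4 ℕ.* N) (^-pos k 0<d)) (begin-equality
      c k ^ (4 ℕ.* m) * β ^ G * (d ^ k) ^ (4 ℕ.* N)    ≈⟨ c-power k ⟩
      ε ^ (4 ℕ.* N)                                    ≈⟨ ^-congˡ (4 ℕ.* N) (x*y⁻¹*y≈x (^-pos k 0<d)) ⟨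
      (η k * d ^ k) ^ (4 ℕ.* N)                        ≈⟨ ^-distrib-* (η k) (d ^ k) (4 ℕ.* N) ⟩
      η k ^ (4 ℕ.* N) * (d ^ k) ^ (4 ℕ.* N)            ∎)

    first : ℕ → Vector ℝ N
    first k = reduce (columns (basisMatrix A (c k))) (firstIndex n m)

    -- The bound is squared once before the N-th root is taken, since c^(4m) β^G, and not c^(2m)
    -- with the triangular exponent, is available as a power of η.
    first-bound : ∀ k → ∣ first k ∣² ≤ η k * η k
    first-bound k = ^-cancel-≤ N (square-nonNeg (η k)) (^-cancel-≤ 2 (^-nonNeg N (square-nonNeg (η k))) (begin
      (∣ first k ∣² ^ N) ^ 2
        ≤⟨ ^-mono-≤ 2 (^-nonNeg N (∣∣²-nonNeg (first k))) (first-vector-bound ¼<α n m A (c-pos k) lll) ⟩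
      (β ^ triangle N * (c k ^ m * c k ^ m)) ^ 2
        ≈⟨ solve 2 (λ b p → (b :* (p :* p)) :^ 2 := p :^ 4 :* (b :* b)) refl (β ^ triangle N) (c k ^ m) ⟩
      (c k ^ m) ^ 4 * (β ^ triangle N * β ^ triangle N)
        ≈⟨ *-cong (^4* (c k) m) (^-homo-* β (triangle N) (triangle N)) ⟨
      c k ^ (4 ℕ.* m) * β ^ G
        ≈⟨ c-η k ⟩
      η k ^ (4 ℕ.* N)
        ≈⟨ ^4* (η k) N ⟩
      (η k ^ N) ^ 4
        ≈⟨ solve 1 (λ p → p :^ 4 := (p :* p) :^ 2) refl (η k ^ N) ⟩
      (η k ^ N * η k ^ N) ^ 2
        ≈⟨ ^-congˡ 2 (^-distrib-* (η k) (η k) N) ⟨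
      ((η k * η k) ^ N) ^ 2 ∎))

    first-component : ∀ k r → first k r * first k r ≤ η k * η k
    first-component k r = ≤-trans (term≤sum (λ i → square-nonNeg (first k i)) r) (first-bound k)

    private
      ++-left : ∀ (p : Vector ℤ n) (q : Vector ℤ m) i → (p ++ q) (i ↑ˡ m) ≡ p i
      ++-left p q i rewrite Fin.splitAt-↑ˡ n i m = ≡.refl

      ++-right : ∀ (p : Vector ℤ n) (q : Vector ℤ m) j → (p ++ q) (n ↑ʳ j) ≡ q j
      ++-right p q j rewrite Fin.splitAt-↑ʳ n m j = ≡.refl

      ++-parts : ∀ (z : Vector ℤ N) s → ((λ i → z (i ↑ˡ m)) ++ (λ j → z (n ↑ʳ j))) s ≡ z s
      ++-parts z = ↑-elim n _ (++-left _ _) (++-right _ _)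

    yields : ∀ k → ∃ (Yields k)
    yields k = (λ j → z (n ↑ʳ j)) , (λ i → z (i ↑ˡ m)) , λ i → begin-equality
      first k i
        ≈⟨ proj₂ first∈L i ⟩
      sum (λ s → fromℤ (z s) * basisMatrix A (c k) i s)
        ≈⟨ sum-cong-≋ (λ s → trans (*-comm _ _) (*-congˡ (reflexive (≡.cong fromℤ (≡.sym (++-parts z s)))))) ⟩
      sum (λ s → basisMatrix A (c k) i s * fromℤ (((λ i → z (i ↑ˡ m)) ++ (λ j → z (n ↑ʳ j))) s)) ∎
      where
      b : Vector (Vector ℝ N) N
      b = columns (basisMatrix A (c k))
      first∈L : Lattice b (first k)
      first∈L = proj₁ (proj₂ (isBasis b (columns-linearlyIndependent A (c k) (pos⇒≉0 (c-pos k)))))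
        (basis⊆Lattice (reduce b) (firstIndex n m))
      z : Vector ℤ N
      z = proj₁ first∈L

    yields-top : ∀ k q → Yields k q → ∀ i → ‖ sum (λ j → fromℤ (q j) * A i j) ‖ ≤ η k
    yields-top k q (p , first≈) i = begin
      -- The i-th coordinate of the vector is p_i + Σ a_ij q_j, so the integer to compare with is
      -- -p_i.
      ‖ s ‖                              ≤⟨ ‖‖≤∣-∣ s (ℤ.- p i) ⟩
      ∣ s - fromℤ (ℤ.- p i) ∣            ≈⟨ ∣∣-cong s+p≈first ⟩
      ∣ first k (i ↑ˡ m) ∣               ≤⟨ square≤⇒∣∣≤ (proj₁ (η-pos k)) (first-component k (i ↑ˡ m)) ⟩
      η k                                ∎
      where
      s : ℝ
      s = sum (λ j → fromℤ (q j) * A i j)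
      x : Vector ℝ N
      x r = fromℤ ((p ++ q) r)
      s+p≈first : s - fromℤ (ℤ.- p i) ≈ first k (i ↑ˡ m)
      s+p≈first = begin-equality
        s - fromℤ (ℤ.- p i)
          ≈⟨ trans (+-congˡ (trans (-‿cong (fromℤ-neg (p i))) (⁻¹-involutive _))) (+-comm _ _) ⟩
        fromℤ (p i) + s
          ≈⟨ +-cong (reflexive (≡.cong fromℤ (≡.sym (++-left p q i))))
               (sum-cong-≋ λ j → trans (*-comm _ _) (*-congˡ (reflexive (≡.cong fromℤ (≡.sym (++-right p q j)))))) ⟩
        x (i ↑ˡ m) + sum (λ j → A i j * x (n ↑ʳ j))
          ≈⟨ basisMatrix-top A (c k) i x ⟨
        sum (λ r → basisMatrix A (c k) (i ↑ˡ m) r * x r)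
          ≈⟨ first≈ (i ↑ˡ m) ⟨
        first k (i ↑ˡ m) ∎

    yields-bottom : ∀ k q → Yields k q → ∀ j → c k * ∣ fromℤ (q j) ∣ ≤ η k
    yields-bottom k q (p , first≈) j = square-cancel-≤ (proj₁ (η-pos k)) (begin
      c k * ∣ y ∣ * (c k * ∣ y ∣)        ≈⟨ solve 2 (λ c y → c :* y :* (c :* y) := c :* c :* (y :* y)) refl (c k) ∣ y ∣ ⟩
      c k * c k * (∣ y ∣ * ∣ y ∣)        ≈⟨ *-congˡ (∣∣-square y) ⟩
      c k * c k * (y * y)                ≈⟨ solve 2 (λ c y → c :* c :* (y :* y) := c :* y :* (c :* y)) refl (c k) y ⟩
      c k * y * (c k * y)                ≈⟨ *-cong cy≈first cy≈first ⟩
      first k (n ↑ʳ j) * first k (n ↑ʳ j) ≤⟨ first-component k (n ↑ʳ j) ⟩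
      η k * η k                          ∎)
      where
      y : ℝ
      y = fromℤ (q j)
      x : Vector ℝ N
      x r = fromℤ ((p ++ q) r)
      cy≈first : c k * y ≈ first k (n ↑ʳ j)
      cy≈first = begin-equality
        c k * y                                             ≈⟨ *-congˡ (reflexive (≡.cong fromℤ (++-right p q j))) ⟨
        c k * x (n ↑ʳ j)                                    ≈⟨ basisMatrix-bottom A (c k) j x ⟨
        sum (λ r → basisMatrix A (c k) (n ↑ʳ j) r * x r)    ≈⟨ first≈ (n ↑ʳ j) ⟨
        first k (n ↑ʳ j)                                    ∎

    module _ {Q : ℝ} (0<Q : 0# < Q) where

      T : ℝ
      T = Q ^ℚ (ℚ.- (+ m ℚ./ n)) * β ^ℚ (Γ /4· n)

      T-pos : 0# < T
      T-pos = bound-pos m n 0<Q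

      T-power : T ^ (4 ℕ.* n) * Q ^ (4 ℕ.* m) ≈ β ^ G
      T-power = bound-power m n 0<Q

      -- T^(4n) Q^(4m) and E^(4m) ε^(4n) both equal β^G, so E ≤ Q pushes T below ε.
      T≤ε : ε ^ℚ (ℚ.- (+ n ℚ./ m)) * β ^ℚ (Γ /4· m) ≤ Q → T ≤ ε
      T≤ε E≤Q = ^-cancel-≤ (4 ℕ.* n) (proj₁ 0<ε) (*-cancelʳ-≤ (^-pos (4 ℕ.* m) 0<Q) (begin
        T ^ (4 ℕ.* n) * Q ^ (4 ℕ.* m)          ≈⟨ T-power ⟩
        β ^ G                                  ≈⟨ bound-power n m 0<ε ⟨
        E ^ (4 ℕ.* m) * ε ^ (4 ℕ.* n)          ≤⟨ *-monoʳ-≤ (proj₁ (^-pos (4 ℕ.* n) 0<ε))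
                                                    (^-mono-≤ (4 ℕ.* m) (proj₁ (bound-pos n m 0<ε)) E≤Q) ⟩
        Q ^ (4 ℕ.* m) * ε ^ (4 ℕ.* n)          ≈⟨ *-comm _ _ ⟩
        ε ^ (4 ℕ.* n) * Q ^ (4 ℕ.* m)          ∎))
        where
        E : ℝ
        E = ε ^ℚ (ℚ.- (+ n ℚ./ m)) * β ^ℚ (Γ /4· m)

      -- The 4m-th powers are compared after multiplication by η^(4N) = c^(4m) β^G. Replacing β^G by
      -- T^(4n) Q^(4m) brings in Q, and the bounds c y ≤ η and T ≤ η contribute 4m + 4n = 4N factors
      -- η, which cancel.
      coordinate-bound : ∀ k → T * d ^ k ≤ ε → ∀ {y} → 0# ≤ y → c k * y ≤ η k → y ≤ Q
      coordinate-bound k Tdᵏ≤ε {y} 0≤y cy≤η =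
        ^-cancel-≤ (4 ℕ.* m) (proj₁ 0<Q) (*-cancelʳ-≤ (^-pos (4 ℕ.* N) (η-pos k)) (begin
          y ^ (4 ℕ.* m) * η k ^ (4 ℕ.* N)
            ≈⟨ *-congˡ (c-η k) ⟨
          y ^ (4 ℕ.* m) * (c k ^ (4 ℕ.* m) * β ^ G)
            ≈⟨ solve 3 (λ y c b → y :* (c :* b) := c :* y :* b) refl (y ^ (4 ℕ.* m)) (c k ^ (4 ℕ.* m)) (β ^ G) ⟩
          c k ^ (4 ℕ.* m) * y ^ (4 ℕ.* m) * β ^ G
            ≈⟨ *-cong (^-distrib-* (c k) y (4 ℕ.* m)) T-power ⟨
          (c k * y) ^ (4 ℕ.* m) * (T ^ (4 ℕ.* n) * Q ^ (4 ℕ.* m))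
            ≤⟨ *-mono-≤ (^-nonNeg (4 ℕ.* m) (proj₁ (η-pos k)))
                 (*-nonNeg (^-nonNeg (4 ℕ.* n) (proj₁ T-pos)) (^-nonNeg (4 ℕ.* m) (proj₁ 0<Q)))
                 (^-mono-≤ (4 ℕ.* m) (*-nonNeg (proj₁ (c-pos k)) 0≤y) cy≤η)
                 (*-monoʳ-≤ (^-nonNeg (4 ℕ.* m) (proj₁ 0<Q)) (^-mono-≤ (4 ℕ.* n) (proj₁ T-pos) T≤η)) ⟩
          η k ^ (4 ℕ.* m) * (η k ^ (4 ℕ.* n) * Q ^ (4 ℕ.* m))
            ≈⟨ solve 3 (λ a b q → a :* (b :* q) := q :* (b :* a)) refl (η k ^ (4 ℕ.* m)) (η k ^ (4 ℕ.* n)) (Q ^ (4 ℕ.* m)) ⟩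
          Q ^ (4 ℕ.* m) * (η k ^ (4 ℕ.* n) * η k ^ (4 ℕ.* m))
            ≈⟨ *-congˡ (^-homo-* (η k) (4 ℕ.* n) (4 ℕ.* m)) ⟨
          Q ^ (4 ℕ.* m) * η k ^ (4 ℕ.* n ℕ.+ 4 ℕ.* m)
            ≡⟨ ≡.cong (λ e → Q ^ (4 ℕ.* m) * η k ^ e) (≡.sym (ℕ.*-distribˡ-+ 4 n m)) ⟩
          Q ^ (4 ℕ.* m) * η k ^ (4 ℕ.* N) ∎))
        where
        T≤η : T ≤ η k
        T≤η = *-cancelʳ-≤ (^-pos k 0<d) (≤-respʳ (sym (x*y⁻¹*y≈x (^-pos k 0<d))) Tdᵏ≤ε)

      denominators-bounded : ∀ k → T * d ^ k ≤ ε → ∀ q → Yields k q → maximum (λ j → ∣ fromℤ (q j) ∣) ≤ Q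
      denominators-bounded k Tdᵏ≤ε q yield = maximum-lub (proj₁ 0<Q) λ j →
        coordinate-bound k Tdᵏ≤ε (∣∣-nonNeg (fromℤ (q j))) (yields-bottom k q yield j)

      -- Since d > 1, the condition on k passes to all smaller indices; their tuples are bounded by
      -- Q ≤ qmax, so none of them triggers the stopping rule.
      executed : Q ≤ qmax → ∀ k → T * d ^ k ≤ ε → Executed k
      executed Q≤qmax zero    _        = Executed.start
      executed Q≤qmax (suc k) Tdᵏ⁺¹≤ε = continue (executed Q≤qmax k Tdᵏ≤ε) (proj₂ (yields k))
        (≤-trans (denominators-bounded k Tdᵏ≤ε (proj₁ (yields k)) (proj₂ (yields k))) Q≤qmax)
        where
        Tdᵏ≤ε : T * d ^ k ≤ ε
        Tdᵏ≤ε = begin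
          T * d ^ k            ≈⟨ *-congˡ (*-identityˡ _) ⟨
          T * (1# * d ^ k)     ≤⟨ *-monoˡ-≤ (proj₁ T-pos) (*-monoʳ-≤ (^-nonNeg k (proj₁ 0<d)) (proj₁ 1<d)) ⟩
          T * d ^ suc k        ≤⟨ Tdᵏ⁺¹≤ε ⟩
          ε                    ∎

      last-iteration : T ≤ ε → ∃[ k ] T * d ^ k ≤ ε × ¬ T * d ^ suc k ≤ ε
      last-iteration T≤ε = last-before-failure {P = λ k → T * d ^ k ≤ ε}
        (≤-respˡ (sym (*-identityʳ T)) T≤ε)
        -- An exponent K with d^K > ε / T provides the failure from which the search descends.
        (proj₁ (powers-unbounded 1<d (ε * T ⁻¹)))
        λ Tdᴷ≤ε → <⇒≱ (*-monoʳ-< T-pos (proj₂ (powers-unbounded 1<d (ε * T ⁻¹))))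
          (≤-respʳ (sym (x*y⁻¹*y≈x T-pos)) (≤-respˡ (*-comm T _) Tdᴷ≤ε))

      η≤dT : ∀ k → ¬ T * d ^ suc k ≤ ε → η k ≤ d * T
      η≤dT k Tdᵏ⁺¹≰ε = *-cancelʳ-≤ (^-pos k 0<d) (begin
        η k * d ^ k        ≈⟨ x*y⁻¹*y≈x (^-pos k 0<d) ⟩
        ε                  ≤⟨ proj₁ (≰⇒> Tdᵏ⁺¹≰ε) ⟩
        T * (d * d ^ k)    ≈⟨ solve 3 (λ t d p → t :* (d :* p) := d :* t :* p) refl T d (d ^ k) ⟩
        d * T * d ^ k      ∎)

      L : ℝ → ℝ
      L = log d

      -- The logarithm of (T d^k)^(4n) Q^(4m) ≤ ε^(4n) qmax^(4m), with T and Q eliminated on the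
      -- left through T^(4n) Q^(4m) = β^G. The multiples of 4n clear the denominators in `k′`.
      log-bound : Q ≤ qmax → ∀ k → T * d ^ k ≤ ε →
        fromℤ (+ G) * L β + fromℤ (+ (4 ℕ.* n)) * fromℤ (+ k)
          ≤ fromℤ (+ (4 ℕ.* n)) * L ε + fromℤ (+ (4 ℕ.* m)) * L qmax
      log-bound Q≤qmax k Tdᵏ≤ε = begin
        fromℤ (+ G) * L β + fromℤ (+ (4 ℕ.* n)) * fromℤ (+ k)
          ≈⟨ +-cong (log-^ 1<d G 0<β) (trans (log-^ 1<d (4 ℕ.* n) (^-pos k 0<d))
               (*-congˡ (trans (log-^ 1<d k 0<d) (trans (*-congˡ (log-base 1<d)) (*-identityʳ _))))) ⟨
        L (β ^ G) + L ((d ^ k) ^ (4 ℕ.* n))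
          ≈⟨ log-* 1<d (^-pos G 0<β) (^-pos (4 ℕ.* n) (^-pos k 0<d)) ⟨
        L (β ^ G * (d ^ k) ^ (4 ℕ.* n))
          ≤⟨ log-mono-≤ 1<d (*-pos (^-pos G 0<β) (^-pos (4 ℕ.* n) (^-pos k 0<d))) powers ⟩
        L (ε ^ (4 ℕ.* n) * qmax ^ (4 ℕ.* m))
          ≈⟨ log-* 1<d (^-pos (4 ℕ.* n) 0<ε) (^-pos (4 ℕ.* m) 0<qmax) ⟩
        L (ε ^ (4 ℕ.* n)) + L (qmax ^ (4 ℕ.* m))
          ≈⟨ +-cong (log-^ 1<d (4 ℕ.* n) 0<ε) (log-^ 1<d (4 ℕ.* m) 0<qmax) ⟩
        fromℤ (+ (4 ℕ.* n)) * L ε + fromℤ (+ (4 ℕ.* m)) * L qmax ∎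
        where
        0<qmax : 0# < qmax
        0<qmax = begin-strict 0# <⟨ 0<Q ⟩ Q ≤⟨ Q≤qmax ⟩ qmax ∎
        powers : β ^ G * (d ^ k) ^ (4 ℕ.* n) ≤ ε ^ (4 ℕ.* n) * qmax ^ (4 ℕ.* m)
        powers = begin
          β ^ G * (d ^ k) ^ (4 ℕ.* n)
            ≈⟨ *-congʳ T-power ⟨
          T ^ (4 ℕ.* n) * Q ^ (4 ℕ.* m) * (d ^ k) ^ (4 ℕ.* n)
            ≈⟨ solve 3 (λ t q p → t :* q :* p := t :* p :* q) refl (T ^ (4 ℕ.* n)) (Q ^ (4 ℕ.* m)) ((d ^ k) ^ (4 ℕ.* n)) ⟩
          T ^ (4 ℕ.* n) * (d ^ k) ^ (4 ℕ.* n) * Q ^ (4 ℕ.* m)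
            ≈⟨ *-congʳ (^-distrib-* T (d ^ k) (4 ℕ.* n)) ⟨
          (T * d ^ k) ^ (4 ℕ.* n) * Q ^ (4 ℕ.* m)
            ≤⟨ *-mono-≤ (^-nonNeg (4 ℕ.* n) (proj₁ 0<ε)) (^-nonNeg (4 ℕ.* m) (proj₁ 0<Q))
                 (^-mono-≤ (4 ℕ.* n) (*-nonNeg (proj₁ T-pos) (^-nonNeg k (proj₁ 0<d))) Tdᵏ≤ε)
                 (^-mono-≤ (4 ℕ.* m) (proj₁ 0<Q) Q≤qmax) ⟩
          ε ^ (4 ℕ.* n) * qmax ^ (4 ℕ.* m) ∎

      -- The ceiling only enlarges X, so it suffices that k + 1 ≤ X; the summand `1#` of X absorbs
      -- the shift caused by counting iterations from zero. Multiplied by 4n, what remains is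
      -- `log-bound`.
      within-limit : Q ≤ qmax → ∀ k → T * d ^ k ≤ ε → + suc k ℤ.≤ k′
      within-limit Q≤qmax k Tdᵏ≤ε = fromℤ-cancel-≤ (≤-trans 1+k≤X (proj₁ (⌈⌉-isCeiling X)))
        where
        F F′ X : ℝ
        F = fromℚ (+ m ℚ./ n)
        F′ = fromℚ (Γ /4· n)
        X = F * L qmax + 1# + L ε - F′ * L β
        4n : ℝ
        4n = fromℤ (+ (4 ℕ.* n))
        4nF : F * 4n ≈ fromℤ (+ (4 ℕ.* m))
        4nF = begin-equality
          F * 4n                               ≡⟨ ≡.cong (λ e → F * fromℤ e) (≡.trans (ℤ.pos-* 4 n) (ℤ.*-comm (+ 4) (+ n))) ⟩
          F * fromℤ (+ n ℤ.* + 4)              ≈⟨ trans (*-congˡ (fromℤ-* (+ n) (+ 4))) (sym (*-assoc _ _ _)) ⟩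
          F * fromℤ (+ n) * fromℤ (+ 4)        ≈⟨ *-congʳ (fromℚ-/ (+ m) n) ⟩
          fromℤ (+ m) * fromℤ (+ 4)            ≈⟨ fromℤ-* (+ m) (+ 4) ⟨
          fromℤ (+ m ℤ.* + 4)                  ≡⟨ ≡.cong fromℤ (≡.trans (ℤ.*-comm (+ m) (+ 4)) (≡.sym (ℤ.pos-* 4 m))) ⟩
          fromℤ (+ (4 ℕ.* m))                  ∎
        4nF′ : F′ * 4n ≈ fromℤ (+ G)
        4nF′ = trans (fromℚ-/ Γ (4 ℕ.* n)) (reflexive (≡.cong fromℤ Γ≡G))
        1+k≤X : fromℤ (+ suc k) ≤ X
        1+k≤X = *-cancelʳ-≤ (fromℤ-pos (4 ℕ.* n)) (≤-by-difference
          (trans (+-congʳ (+-congˡ (*-congʳ (sym 4nF)))) (trans (+-congˡ (-‿cong (+-congʳ (*-congʳ (sym 4nF′)))))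
            (solve 8 (λ e f g b q k o t →
              t :* e :+ f :* t :* q :- (g :* t :* b :+ t :* k) :=
              (f :* q :+ o :+ e :- g :* b) :* t :- (o :+ k) :* t)
              refl (L ε) F F′ (L β) (L qmax) (fromℤ (+ k)) 1# 4n)))
          (difference-nonNeg (log-bound Q≤qmax k Tdᵏ≤ε)))

      numerators-bounded : ∀ k → ¬ T * d ^ suc k ≤ ε → ∀ q → Yields k q →
        maximum (λ i → ‖ sum (λ j → fromℤ (q j) * A i j) ‖)
          ≤ d * Q ^ℚ (ℚ.- (+ m ℚ./ n)) * β ^ℚ (Γ /4· n)
      numerators-bounded k Tdᵏ⁺¹≰ε q yield = begin
        maximum (λ i → ‖ sum (λ j → fromℤ (q j) * A i j) ‖)
          ≤⟨ maximum-lub (proj₁ (η-pos k)) (yields-top k q yield) ⟩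
        η k
          ≤⟨ η≤dT k Tdᵏ⁺¹≰ε ⟩
        d * T
          ≈⟨ *-assoc d (Q ^ℚ (ℚ.- (+ m ℚ./ n))) (β ^ℚ (Γ /4· n)) ⟨
        d * Q ^ℚ (ℚ.- (+ m ℚ./ n)) * β ^ℚ (Γ /4· n) ∎

      Approximates : Vector ℤ m → Set
      Approximates q = Found q
        × maximum (λ j → ∣ fromℤ (q j) ∣) ≤ Q
        × maximum (λ i → ‖ sum (λ j → fromℤ (q j) * A i j) ‖)
            ≤ d * Q ^ℚ (ℚ.- (+ m ℚ./ n)) * β ^ℚ (Γ /4· n)

      last-iteration-approximates : Q ≤ qmax → ∀ k → T * d ^ k ≤ ε → ¬ T * d ^ suc k ≤ ε →
        ∀ q → Yields k q → Approximates q
      last-iteration-approximates Q≤qmax k Tdᵏ≤ε Tdᵏ⁺¹≰ε q yield =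
        (k , executed Q≤qmax k Tdᵏ≤ε , within-limit Q≤qmax k Tdᵏ≤ε , yield) ,
        denominators-bounded k Tdᵏ≤ε q yield ,
        numerators-bounded k Tdᵏ⁺¹≰ε q yield

      approximations-exist : ε ^ℚ (ℚ.- (+ n ℚ./ m)) * β ^ℚ (Γ /4· m) ≤ Q → Q ≤ qmax → ∃ Approximates
      approximations-exist E≤Q Q≤qmax = conclude (last-iteration (T≤ε E≤Q))
        where
        conclude : (∃[ k ] T * d ^ k ≤ ε × ¬ T * d ^ suc k ≤ ε) → ∃ Approximates
        conclude (k , Tdᵏ≤ε , Tdᵏ⁺¹≰ε) =
          proj₁ (yields k) ,
          last-iteration-approximates Q≤qmax k Tdᵏ≤ε Tdᵏ⁺¹≰ε (proj₁ (yields k)) (proj₂ (yields k))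

theorem3 : (em : ExcludedMiddle 0ℓ) (R : CompleteOrderedField) → let open Reals em R in
    (n m : ℕ) .{{_ : NonZero n}} .{{_ : NonZero m}} (A : Matrix n m) (α ε d qmax : ℝ) →
    fromℚ (+ 1 / 4) < α → α < 1# →
    0# < ε → ε < 1# → 1# < d → 1# < qmax →
    (lll : LLLAlgorithm α (n ℕ.+ m)) → let open ILLL A α ε d qmax lll in
    (Q : ℝ) →
    ε ^ℚ (ℚ.- (+ n / m)) * β[ α ] ^ℚ ((+ m ℤ.+ + n ℤ.- 1ℤ) ℤ.* (+ m ℤ.+ + n) /4· m) ≤ Q →
    Q ≤ qmax →
    ∃[ q ] (Found q
      × maximum (λ j → ∣ fromℤ (q j) ∣) ≤ Q
      × maximum (λ i → ‖ sum (λ j → fromℤ (q j) * A i j) ‖)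
          ≤ d * Q ^ℚ (ℚ.- (+ m / n)) * β[ α ] ^ℚ ((+ m ℤ.+ + n ℤ.- 1ℤ) ℤ.* (+ m ℤ.+ + n) /4· n))
theorem3 em R n m A α ε d qmax ¼<α _ 0<ε _ 1<d _ lll Q E≤Q Q≤qmax =
  approximations-exist A α ε d qmax ¼<α 0<ε 1<d lll 0<Q E≤Q Q≤qmax
  where
  open Reals em R
  open OrderedField em R
  open ILLLAnalysis em R
  open ≤-Reasoning
  0<Q : 0# < Q
  0<Q = begin-strict
    0#    <⟨ bound-pos A α ε d qmax ¼<α 0<ε 1<d lll n m 0<ε ⟩
    _     ≤⟨ E≤Q ⟩
    Q     ∎
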